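{- Assume Conjecture 1 (stated in the context). Let $\delta>0$ be fixed. Then for every integer $y\ge 1$ there exists $x_0(\delta,y)$ such that for all integers $x\ge x_0(\delta,y)$, $$W(x,y)\le (1+\delta)\frac{\log x}{\log\log x}.$$
   Context: $\mathbb{N}$ denotes the positive integers and $\log$ the natural logarithm. For $n\in\mathbb{N}$, $\omega(n)$ is the number of distinct prime divisors of $n$ and $\gamma(n):=\prod_{p\mid n}p$ is the product of the distinct primes dividing $n$ (so $\gamma(1)=1$). Define $$H(n):=\frac{\gamma(n)}{(\log\gamma(n))^{\omega(n)}}\qquad(n\in\mathbb{N}),$$ with the convention $0^0=1$, so that $H(1)=1$. For $y\in\mathbb{N}$ and $x\in\mathbb{Z}_{\ge 0}$ define $$W(x,y):=\sum_{j=1}^{y}\omega(x+j).$$ Conjecture 1 is the following statement: for every $\epsilon>0$ there exists a constant $C(\epsilon)$ such that for all $(a,b,c)\in\mathbb{N}^3$ with $\gcd(a,b,c)=1$ and $a+b=c$, one has $c<C(\epsilon)\,H(abc)^{1+\epsilon}$. -}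

module Defs where

open import Data.Empty using (⊥-elim)
open import Data.Integer as ℤ using (+_)
import Data.Integer.Properties as ℤ
open import Data.List.Base using (List; []; _∷_; filter; length; map; upTo)
open import Data.List.Relation.Unary.All using (All; []; _∷_)
import Data.List.Relation.Unary.All as All
open import Data.List.Relation.Unary.All.Properties using (all-filter)
open import Data.Nat as ℕ using (ℕ; zero; suc)
import Data.Nat.Properties as ℕ
open import Data.Nat.Coprimality using (1-coprimeTo) renaming (sym to coprime-sym)
open import Data.Nat.Divisibility using (_∣?_)
open import Data.Nat.GCD using (gcd)
open import Data.Nat.ListAction using (sum; product)
open import Data.Nat.Primality using (Prime; prime?; prime⇒nonZero; prime⇒nonTrivial)
open import Data.Product using (∃-syntax; _×_; _,_; proj₁; proj₂)
open import Data.Rational renaming (∣_∣ to abs)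
open import Data.Rational.Properties
open import Data.Rational.Solver using (module +-*-Solver)
open import Data.Sum using (_⊎_; inj₁; inj₂)
open import Relation.Binary.PropositionalEquality
open import Relation.Nullary using (¬_; yes; no)
open import Relation.Nullary.Decidable using (_×-dec_)
open +-*-Solver

fromℕ : ℕ → ℚ
fromℕ n = + n / 1

2ℚ : ℚ
2ℚ = fromℕ 2

-- The value at 0 is junk: below, recip is only relevant at terms of sequences
-- that are eventually bounded away from 0.
recip : ℚ → ℚ
recip q with q ≟ 0ℚ
... | yes _   = 0ℚ
... | no  q≢0 = (1/ q) {{≢-nonZero q≢0}}

infixr 8 _^ℚ_
_^ℚ_ : ℚ → ℕ → ℚ
q ^ℚ zero  = 1ℚ
q ^ℚ suc n = q * q ^ℚ n

Σ< : ℕ → (ℕ → ℚ) → ℚ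
Σ< zero    t = 0ℚ
Σ< (suc n) t = Σ< n t + t n

≤⇒0≤- : ∀ {p q} → p ≤ q → 0ℚ ≤ q - p
≤⇒0≤- {p} {q} h = subst (_≤ q - p) (+-inverseʳ p) (+-monoˡ-≤ (- p) h)

0≤-⇒≤ : ∀ {p q} → 0ℚ ≤ q - p → p ≤ q
0≤-⇒≤ {p} {q} h = subst₂ _≤_ (+-identityˡ p)
  (solve 2 (λ p q → q :- p :+ p := q) refl p q) (+-monoˡ-≤ p h)

<⇒0<- : ∀ {p q} → p < q → 0ℚ < q - p
<⇒0<- {p} {q} h = subst (_< q - p) (+-inverseʳ p) (+-monoˡ-< (- p) h)

0<-⇒< : ∀ {p q} → 0ℚ < q - p → p < q
0<-⇒< {p} {q} h = subst₂ _<_ (+-identityˡ p)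
  (solve 2 (λ p q → q :- p :+ p := q) refl p q) (+-monoˡ-< p h)

+-nonneg : ∀ {p q} → 0ℚ ≤ p → 0ℚ ≤ q → 0ℚ ≤ p + q
+-nonneg = +-mono-≤

+-pos : ∀ {p q} → 0ℚ < p → 0ℚ < q → 0ℚ < p + q
+-pos = +-mono-<

*-nonneg : ∀ {p q} → 0ℚ ≤ p → 0ℚ ≤ q → 0ℚ ≤ p * q
*-nonneg {p} {q} hp hq = nonNegative⁻¹ (p * q)
  {{nonNeg*nonNeg⇒nonNeg p {{nonNegative hp}} q {{nonNegative hq}}}}

*-pos : ∀ {p q} → 0ℚ < p → 0ℚ < q → 0ℚ < p * q
*-pos {p} {q} hp hq = positive⁻¹ (p * q)
  {{pos*pos⇒pos p {{positive hp}} q {{positive hq}}}}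

*-monoˡ : ∀ {p q} r → 0ℚ ≤ r → p ≤ q → p * r ≤ q * r
*-monoˡ r h = *-monoʳ-≤-nonNeg r {{nonNegative h}}

*-monoʳ : ∀ {p q} r → 0ℚ ≤ r → p ≤ q → r * p ≤ r * q
*-monoʳ r h = *-monoˡ-≤-nonNeg r {{nonNegative h}}

*-mono : ∀ {p q r s} → 0ℚ ≤ p → 0ℚ ≤ r → p ≤ q → r ≤ s → p * r ≤ q * s
*-mono {q = q} {r = r} 0≤p 0≤r p≤q r≤s =
  ≤-trans (*-monoˡ r 0≤r p≤q) (*-monoʳ q (≤-trans 0≤p p≤q) r≤s)

0<1 : 0ℚ < 1ℚ
0<1 = positive⁻¹ 1ℚ

0<½ : 0ℚ < ½
0<½ = positive⁻¹ ½

0<2 : 0ℚ < 2ℚ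
0<2 = positive⁻¹ 2ℚ

half : ∀ {η} → 0ℚ < η → 0ℚ < ½ * η
half = *-pos 0<½

½+½ : ∀ η → ½ * η + ½ * η ≡ η
½+½ = solve 1 (λ η → con ½ :* η :+ con ½ :* η := η) refl

recip-inverse : ∀ {q} → 0ℚ < q → q * recip q ≡ 1ℚ
recip-inverse {q} 0<q with q ≟ 0ℚ
... | yes q≡0 = ⊥-elim (<⇒≢ 0<q (sym q≡0))
... | no  q≢0 = *-inverseʳ q {{≢-nonZero q≢0}}

recip-pos : ∀ {q} → 0ℚ < q → 0ℚ < recip q
recip-pos {q} 0<q with q ≟ 0ℚ
... | yes q≡0 = ⊥-elim (<⇒≢ 0<q (sym q≡0))
... | no  q≢0 = positive⁻¹ ((1/ q) {{≢-nonZero q≢0}}) {{1/pos⇒pos q {{positive 0<q}}}}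

recip-difference : ∀ {p q} → 0ℚ < p → 0ℚ < q → recip p - recip q ≡ (q - p) * (recip p * recip q)
recip-difference {p} {q} 0<p 0<q = begin
  u - v                     ≡⟨ cong₂ _-_ (*-identityˡ u) (*-identityˡ v) ⟨
  1ℚ * u - 1ℚ * v           ≡⟨ cong₂ (λ a b → a * u - b * v) (recip-inverse 0<q) (recip-inverse 0<p) ⟨
  q * v * u - p * u * v     ≡⟨ solve 4 (λ p q u v → q :* v :* u :- p :* u :* v := (q :- p) :* (u :* v)) refl p q u v ⟩
  (q - p) * (u * v)         ∎
  where
  open ≡-Reasoning
  u = recip p
  v = recip q

recip-antitone : ∀ {p q} → 0ℚ < p → p ≤ q → recip q ≤ recip p
recip-antitone {p} {q} 0<p p≤q = 0≤-⇒≤ (subst (0ℚ ≤_) (sym (recip-difference 0<p 0<q))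
  (*-nonneg (≤⇒0≤- p≤q) (*-nonneg (<⇒≤ (recip-pos 0<p)) (<⇒≤ (recip-pos 0<q)))))
  where 0<q = <-≤-trans 0<p p≤q

abs-nonneg : ∀ p → 0ℚ ≤ abs p
abs-nonneg = 0≤∣p∣

abs≤ : ∀ {p r} → p ≤ r → - p ≤ r → abs p ≤ r
abs≤ {p} {r} h₁ h₂ with ∣p∣≡p∨∣p∣≡-p p
... | inj₁ e = subst (_≤ r) (sym e) h₁
... | inj₂ e = subst (_≤ r) (sym e) h₂

≤abs : ∀ p → p ≤ abs p
≤abs p with ≤-total 0ℚ p
... | inj₁ h = ≤-reflexive (sym (0≤p⇒∣p∣≡p h))
... | inj₂ h = ≤-trans h (0≤∣p∣ p)

-≤abs : ∀ p → - p ≤ abs p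
-≤abs p = subst (- p ≤_) (∣-p∣≡∣p∣ p) (≤abs (- p))

abs-minus-comm : ∀ p q → abs (p - q) ≡ abs (q - p)
abs-minus-comm p q = trans (sym (∣-p∣≡∣p∣ (p - q)))
  (cong abs (solve 2 (λ p q → :- (p :- q) := q :- p) refl p q))

abs-triangle : ∀ p q r → abs (p - r) ≤ abs (p - q) + abs (q - r)
abs-triangle p q r = subst (λ z → abs z ≤ abs (p - q) + abs (q - r))
  (solve 3 (λ p q r → p :- q :+ (q :- r) := p :- r) refl p q r)
  (∣p+q∣≤∣p∣+∣q∣ (p - q) (q - r))

fromℕ-mkℚ : ∀ k → fromℕ k ≡ mkℚ (+ k) 0 (coprime-sym (1-coprimeTo k))
fromℕ-mkℚ k = normalize-coprime (coprime-sym (1-coprimeTo k))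

fromℕ-suc : ∀ n → fromℕ (suc n) ≡ 1ℚ + fromℕ n
fromℕ-suc n = sym (trans (cong (_+_ 1ℚ) (fromℕ-mkℚ n))
  (cong (λ i → (+ 1 ℤ.+ i) / 1) (ℤ.*-identityʳ (+ n))))

fromℕ-nonneg : ∀ n → 0ℚ ≤ fromℕ n
fromℕ-nonneg zero    = ≤-refl
fromℕ-nonneg (suc n) = subst (0ℚ ≤_) (sym (fromℕ-suc n)) (+-nonneg (<⇒≤ 0<1) (fromℕ-nonneg n))

fromℕ-pos : ∀ n → 0ℚ < fromℕ (suc n)
fromℕ-pos n = subst (0ℚ <_) (sym (fromℕ-suc n)) (+-mono-<-≤ 0<1 (fromℕ-nonneg n))

fromℕ-mono : ∀ {m n} → m ℕ.≤ n → fromℕ m ≤ fromℕ n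
fromℕ-mono {n = n} ℕ.z≤n = fromℕ-nonneg n
fromℕ-mono (ℕ.s≤s {m} {n} h) =
  subst₂ _≤_ (sym (fromℕ-suc m)) (sym (fromℕ-suc n)) (+-monoʳ-≤ 1ℚ (fromℕ-mono h))

fromℕ-* : ∀ m n → fromℕ (m ℕ.* n) ≡ fromℕ m * fromℕ n
fromℕ-* zero    n = sym (*-zeroˡ (fromℕ n))
fromℕ-* (suc m) n = begin
  fromℕ (n ℕ.+ m ℕ.* n)           ≡⟨ fromℕ-+ n (m ℕ.* n) ⟩
  fromℕ n + fromℕ (m ℕ.* n)       ≡⟨ cong (_+_ (fromℕ n)) (fromℕ-* m n) ⟩
  fromℕ n + fromℕ m * fromℕ n     ≡⟨ solve 2 (λ a b → b :+ a :* b := (con 1ℚ :+ a) :* b) refl (fromℕ m) (fromℕ n) ⟩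
  (1ℚ + fromℕ m) * fromℕ n        ≡⟨ cong (_* fromℕ n) (fromℕ-suc m) ⟨
  fromℕ (suc m) * fromℕ n         ∎
  where
  open ≡-Reasoning
  fromℕ-+ : ∀ a b → fromℕ (a ℕ.+ b) ≡ fromℕ a + fromℕ b
  fromℕ-+ zero    b = sym (+-identityˡ (fromℕ b))
  fromℕ-+ (suc a) b = trans (fromℕ-suc (a ℕ.+ b)) (trans (cong (_+_ 1ℚ) (fromℕ-+ a b))
    (trans (sym (+-assoc 1ℚ (fromℕ a) (fromℕ b))) (cong (_+ fromℕ b) (sym (fromℕ-suc a)))))

archimedean : ∀ q → ∃[ n ] q ≤ fromℕ n
archimedean q@(mkℚ (+ n) d-1 _) = n , subst (q ≤_) (sym (fromℕ-mkℚ n)) (*≤* (begin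
  + n ℤ.* + 1          ≡⟨ ℤ.*-identityʳ (+ n) ⟩
  + n                  ≤⟨ ℤ.+≤+ (ℕ.m≤m*n n (suc d-1)) ⟩
  + (n ℕ.* suc d-1)    ≡⟨ ℤ.pos-* n (suc d-1) ⟩
  + n ℤ.* + suc d-1    ∎))
  where open ℤ.≤-Reasoning
archimedean q@(mkℚ (ℤ.-[1+ _ ]) _ _) = 0 , <⇒≤ (negative⁻¹ q)

^ℚ-nonneg : ∀ {q} → 0ℚ ≤ q → ∀ n → 0ℚ ≤ q ^ℚ n
^ℚ-nonneg h zero    = <⇒≤ 0<1
^ℚ-nonneg h (suc n) = *-nonneg h (^ℚ-nonneg h n)

^ℚ-distrib-* : ∀ p q n → (p * q) ^ℚ n ≡ p ^ℚ n * q ^ℚ n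
^ℚ-distrib-* p q zero    = refl
^ℚ-distrib-* p q (suc n) = trans (cong (p * q *_) (^ℚ-distrib-* p q n))
  (solve 4 (λ p q a b → p :* q :* (a :* b) := p :* a :* (q :* b)) refl p q (p ^ℚ n) (q ^ℚ n))

1^ℚ : ∀ n → 1ℚ ^ℚ n ≡ 1ℚ
1^ℚ zero    = refl
1^ℚ (suc n) = trans (*-identityˡ (1ℚ ^ℚ n)) (1^ℚ n)

abs-^ℚ : ∀ {p r} → abs p ≤ r → ∀ n → abs (p ^ℚ n) ≤ r ^ℚ n
abs-^ℚ h zero = ≤-refl
abs-^ℚ {p} {r} h (suc n) = subst (_≤ r * r ^ℚ n) (sym (∣p*q∣≡∣p∣*∣q∣ p (p ^ℚ n)))
  (*-mono (abs-nonneg p) (abs-nonneg (p ^ℚ n)) h (abs-^ℚ h n))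

^ℚ-lipschitz : ∀ {p q r} → abs p ≤ r → abs q ≤ r → ∀ n →
  abs (p ^ℚ suc n - q ^ℚ suc n) ≤ abs (p - q) * (fromℕ (suc n) * r ^ℚ n)
^ℚ-lipschitz {p} {q} hp hq zero = ≤-reflexive (trans
  (cong abs (solve 2 (λ p q → p :* con 1ℚ :- q :* con 1ℚ := p :- q) refl p q))
  (sym (trans (cong (abs (p - q) *_) (*-identityʳ 1ℚ)) (*-identityʳ _))))
^ℚ-lipschitz {p} {q} {r} hp hq (suc n) = begin
  abs (p * p′ - q * q′)
    ≡⟨ cong abs (solve 4 (λ p q a b → p :* a :- q :* b := p :* (a :- b) :+ (p :- q) :* b) refl p q p′ q′) ⟩
  abs (p * (p′ - q′) + (p - q) * q′)
    ≤⟨ ∣p+q∣≤∣p∣+∣q∣ (p * (p′ - q′)) ((p - q) * q′) ⟩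
  abs (p * (p′ - q′)) + abs ((p - q) * q′)
    ≡⟨ cong₂ _+_ (∣p*q∣≡∣p∣*∣q∣ p (p′ - q′)) (∣p*q∣≡∣p∣*∣q∣ (p - q) q′) ⟩
  abs p * abs (p′ - q′) + abs (p - q) * abs q′
    ≤⟨ +-mono-≤
         (*-mono (abs-nonneg p) (abs-nonneg (p′ - q′)) hp (^ℚ-lipschitz hp hq n))
         (*-monoʳ (abs (p - q)) (abs-nonneg (p - q)) (abs-^ℚ hq (suc n))) ⟩
  r * (abs (p - q) * (fromℕ (suc n) * r ^ℚ n)) + abs (p - q) * (r * r ^ℚ n)
    ≡⟨ solve 4 (λ r d k x → r :* (d :* (k :* x)) :+ d :* (r :* x) := d :* ((con 1ℚ :+ k) :* (r :* x)))
         refl r (abs (p - q)) (fromℕ (suc n)) (r ^ℚ n) ⟩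
  abs (p - q) * ((1ℚ + fromℕ (suc n)) * (r * r ^ℚ n))
    ≡⟨ cong (λ k → abs (p - q) * (k * (r * r ^ℚ n))) (fromℕ-suc (suc n)) ⟨
  abs (p - q) * (fromℕ (suc (suc n)) * (r * r ^ℚ n)) ∎
  where
  open ≤-Reasoning
  p′ = p ^ℚ suc n
  q′ = q ^ℚ suc n

bernoulli : ∀ {ρ} → 0ℚ ≤ ρ → ∀ n → ρ ^ℚ n * (1ℚ + fromℕ n * (1ℚ - ρ)) ≤ 1ℚ
bernoulli {ρ} 0≤ρ zero = ≤-reflexive
  (solve 1 (λ ρ → con 1ℚ :* (con 1ℚ :+ con 0ℚ :* (con 1ℚ :- ρ)) := con 1ℚ) refl ρ)
bernoulli {ρ} 0≤ρ (suc n) = ≤-trans (0≤-⇒≤ (subst (0ℚ ≤_) eq nonneg)) (bernoulli 0≤ρ n)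
  where
  x = ρ ^ℚ n
  k = fromℕ n
  square-nonneg : ∀ s → 0ℚ ≤ s * s
  square-nonneg s with ≤-total 0ℚ s
  ... | inj₁ h = *-nonneg h h
  ... | inj₂ h = subst (0ℚ ≤_) (solve 1 (λ s → (:- s) :* (:- s) := s :* s) refl s)
    (*-nonneg (neg-antimono-≤ h) (neg-antimono-≤ h))
  nonneg : 0ℚ ≤ x * ((1ℚ + k) * ((1ℚ - ρ) * (1ℚ - ρ)))
  nonneg = *-nonneg (^ℚ-nonneg 0≤ρ n)
    (*-nonneg (+-nonneg (<⇒≤ 0<1) (fromℕ-nonneg n)) (square-nonneg (1ℚ - ρ)))
  eq : x * ((1ℚ + k) * ((1ℚ - ρ) * (1ℚ - ρ))) ≡
       x * (1ℚ + k * (1ℚ - ρ)) - ρ * x * (1ℚ + fromℕ (suc n) * (1ℚ - ρ))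
  eq = trans
    (solve 3 (λ ρ x k → x :* ((con 1ℚ :+ k) :* ((con 1ℚ :- ρ) :* (con 1ℚ :- ρ))) :=
       x :* (con 1ℚ :+ k :* (con 1ℚ :- ρ)) :- ρ :* x :* (con 1ℚ :+ (con 1ℚ :+ k) :* (con 1ℚ :- ρ)))
       refl ρ x k)
    (cong (λ k′ → x * (1ℚ + k * (1ℚ - ρ)) - ρ * x * (1ℚ + k′ * (1ℚ - ρ))) (sym (fromℕ-suc n)))

Null : (ℕ → ℚ) → Set
Null g = ∀ {η} → 0ℚ < η → ∃[ N ] g N ≤ η

geometric-null : ∀ {K ρ} → 0ℚ ≤ K → 0ℚ ≤ ρ → ρ < 1ℚ → Null (λ n → K * ρ ^ℚ n)
geometric-null {K} {ρ} 0≤K 0≤ρ ρ<1 {η} 0<η = n , (begin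
  K * x                         ≡⟨ trans (sym (*-identityʳ (K * x))) (cong (K * x *_) (sym (recip-inverse 0<ηs))) ⟩
  K * x * (ηs * recip ηs)       ≡⟨ solve 4 (λ K x e s → K :* x :* (e :* s) := x :* (K :* s) :* e) refl K x ηs (recip ηs) ⟩
  x * (K * recip ηs) * ηs       ≤⟨ *-monoˡ ηs (<⇒≤ 0<ηs) (*-monoʳ x 0≤x (proj₂ arch)) ⟩
  x * fromℕ n * (η * s)         ≡⟨ solve 4 (λ x k η s → x :* k :* (η :* s) := η :* (x :* (k :* s))) refl x (fromℕ n) η s ⟩
  η * (x * (fromℕ n * s))       ≤⟨ *-monoʳ η (<⇒≤ 0<η) (*-monoʳ x 0≤x (p≤1+p (fromℕ n * s))) ⟩
  η * (x * (1ℚ + fromℕ n * s))  ≤⟨ *-monoʳ η (<⇒≤ 0<η) (bernoulli 0≤ρ n) ⟩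
  η * 1ℚ                        ≡⟨ *-identityʳ η ⟩
  η                             ∎)
  where
  open ≤-Reasoning
  s = 1ℚ - ρ
  ηs = η * s
  0<ηs : 0ℚ < ηs
  0<ηs = *-pos 0<η (<⇒0<- ρ<1)
  arch = archimedean (K * recip ηs)
  n = proj₁ arch
  x = ρ ^ℚ n
  0≤x = ^ℚ-nonneg 0≤ρ n
  p≤1+p : ∀ p → p ≤ 1ℚ + p
  p≤1+p p = subst (_≤ 1ℚ + p) (+-identityˡ p) (+-monoˡ-≤ p (<⇒≤ 0<1))

Eventually : (ℕ → Set) → Set
Eventually P = ∃[ N ] (∀ n → N ℕ.≤ n → P n)

eventually-∧ : ∀ {P Q R : ℕ → Set} → (∀ {n} → P n → Q n → R n) →
  Eventually P → Eventually Q → Eventually R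
eventually-∧ f (M , p) (N , q) = M ℕ.⊔ N , λ n h →
  f (p n (ℕ.≤-trans (ℕ.m≤m⊔n M N) h)) (q n (ℕ.≤-trans (ℕ.m≤n⊔m M N) h))

eventually-map : ∀ {P Q : ℕ → Set} → (∀ {n} → P n → Q n) → Eventually P → Eventually Q
eventually-map f (N , p) = N , λ n h → f (p n h)

Cauchy : (ℕ → ℚ) → Set
Cauchy s = ∀ {η} → 0ℚ < η → ∃[ N ] (∀ m n → N ℕ.≤ m → N ℕ.≤ n → abs (s m - s n) ≤ η)

-- Real numbers are Cauchy sequences of rationals.  Operations act termwise, with
-- series truncated at the index n in term n; equality of reals is not needed.
record ℝ : Set where
  no-eta-equality
  field
    seq    : ℕ → ℚ
    cauchy : Cauchy seq

open ℝ public

infix 4 _<ᴿ_ _≤ᴿ_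

record _<ᴿ_ (x y : ℝ) : Set where
  no-eta-equality
  pattern
  constructor separated
  field
    {gap} : ℚ
    0<gap : 0ℚ < gap
    apart : Eventually (λ n → seq x n + gap ≤ seq y n)

_≤ᴿ_ : ℝ → ℝ → Set
x ≤ᴿ y = ¬ (y <ᴿ x)

ι : ℚ → ℝ
ι q .seq _ = q
ι q .cauchy {η} 0<η = 0 , λ _ _ _ _ → subst (_≤ η) (sym (cong abs (+-inverseʳ q))) (<⇒≤ 0<η)

0ᴿ 1ᴿ 2ᴿ : ℝ
0ᴿ = ι 0ℚ
1ᴿ = ι 1ℚ
2ᴿ = ι 2ℚ

Bounded : ℝ → ℚ → Set
Bounded x M = Eventually (λ n → abs (seq x n) ≤ M)

bounded : ∀ x → ∃[ M ] 0ℚ < M × Bounded x M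
bounded x with cauchy x 0<1
... | N , close = abs (seq x N) + 1ℚ , +-mono-≤-< (abs-nonneg (seq x N)) 0<1 , N , λ n N≤n → begin
  abs (seq x n)                            ≡⟨ cong abs (solve 2 (λ a b → a := b :+ (a :- b)) refl (seq x n) (seq x N)) ⟩
  abs (seq x N + (seq x n - seq x N))      ≤⟨ ∣p+q∣≤∣p∣+∣q∣ (seq x N) (seq x n - seq x N) ⟩
  abs (seq x N) + abs (seq x n - seq x N)  ≤⟨ +-monoʳ-≤ (abs (seq x N)) (close n N N≤n ℕ.≤-refl) ⟩
  abs (seq x N) + 1ℚ                       ∎
  where open ≤-Reasoning

-- A sequence of functions whose values, at nearby points of D and at late
-- indices, are close: precisely what makes  n ↦ f n (x n)  Cauchy.
LocallyUniform : (ℚ → Set) → (ℕ → ℚ → ℚ) → Set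
LocallyUniform D f = ∀ {η} → 0ℚ < η → ∃[ δ ] 0ℚ < δ × ∃[ N ]
  (∀ m n → N ℕ.≤ m → N ℕ.≤ n → ∀ {p q} → D p → D q → abs (p - q) ≤ δ → abs (f m p - f n q) ≤ η)

diagonal-cauchy : ∀ {D f} → LocallyUniform D f → ∀ x → Eventually (λ n → D (seq x n)) →
  Cauchy (λ n → f n (seq x n))
diagonal-cauchy uniform x (L , inD) 0<η with uniform 0<η
... | δ , 0<δ , M , close with cauchy x 0<δ
... | N , near = L ℕ.⊔ (M ℕ.⊔ N) , λ m n hm hn →
  close m n (≤M hm) (≤M hn) (inD m (≤L hm)) (inD n (≤L hn)) (near m n (≤N hm) (≤N hn))
  where
  ≤L : ∀ {k} → L ℕ.⊔ (M ℕ.⊔ N) ℕ.≤ k → L ℕ.≤ k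
  ≤L = ℕ.≤-trans (ℕ.m≤m⊔n L (M ℕ.⊔ N))
  ≤M : ∀ {k} → L ℕ.⊔ (M ℕ.⊔ N) ℕ.≤ k → M ℕ.≤ k
  ≤M = ℕ.≤-trans (ℕ.≤-trans (ℕ.m≤m⊔n M N) (ℕ.m≤n⊔m L (M ℕ.⊔ N)))
  ≤N : ∀ {k} → L ℕ.⊔ (M ℕ.⊔ N) ℕ.≤ k → N ℕ.≤ k
  ≤N = ℕ.≤-trans (ℕ.≤-trans (ℕ.m≤n⊔m M N) (ℕ.m≤n⊔m L (M ℕ.⊔ N)))

infixl 6 _+ᴿ_ _-ᴿ_
infixl 7 _*ᴿ_

_+ᴿ_ : ℝ → ℝ → ℝ
(x +ᴿ y) .seq n = seq x n + seq y n
(x +ᴿ y) .cauchy {η} 0<η with cauchy x (half 0<η) | cauchy y (half 0<η)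
... | M , cx | N , cy = M ℕ.⊔ N , λ m n hm hn → begin
  abs (seq x m + seq y m - (seq x n + seq y n))
    ≡⟨ cong abs (solve 4 (λ a b c d → a :+ b :- (c :+ d) := a :- c :+ (b :- d)) refl (seq x m) (seq y m) (seq x n) (seq y n)) ⟩
  abs (seq x m - seq x n + (seq y m - seq y n))
    ≤⟨ ∣p+q∣≤∣p∣+∣q∣ (seq x m - seq x n) (seq y m - seq y n) ⟩
  abs (seq x m - seq x n) + abs (seq y m - seq y n)
    ≤⟨ +-mono-≤ (cx m n (ℕ.≤-trans (ℕ.m≤m⊔n M N) hm) (ℕ.≤-trans (ℕ.m≤m⊔n M N) hn))
                (cy m n (ℕ.≤-trans (ℕ.m≤n⊔m M N) hm) (ℕ.≤-trans (ℕ.m≤n⊔m M N) hn)) ⟩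
  ½ * η + ½ * η
    ≡⟨ ½+½ η ⟩
  η ∎
  where open ≤-Reasoning

*-close : ∀ {A B η a b c d} → 0ℚ < A → 0ℚ < B → abs a ≤ A → abs d ≤ B →
  abs (a - c) ≤ ½ * η * recip B → abs (b - d) ≤ ½ * η * recip A → abs (a * b - c * d) ≤ η
*-close {A} {B} {η} {a} {b} {c} {d} 0<A 0<B ha hd hac hbd = begin
  abs (a * b - c * d)
    ≡⟨ cong abs (solve 4 (λ a b c d → a :* b :- c :* d := a :* (b :- d) :+ (a :- c) :* d) refl a b c d) ⟩
  abs (a * (b - d) + (a - c) * d)
    ≤⟨ ∣p+q∣≤∣p∣+∣q∣ (a * (b - d)) ((a - c) * d) ⟩
  abs (a * (b - d)) + abs ((a - c) * d)
    ≡⟨ cong₂ _+_ (∣p*q∣≡∣p∣*∣q∣ a (b - d)) (∣p*q∣≡∣p∣*∣q∣ (a - c) d) ⟩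
  abs a * abs (b - d) + abs (a - c) * abs d
    ≤⟨ +-mono-≤ (*-mono (abs-nonneg a) (abs-nonneg (b - d)) ha hbd)
                (*-mono (abs-nonneg (a - c)) (abs-nonneg d) hac hd) ⟩
  A * (h * recip A) + h * recip B * B
    ≡⟨ solve 5 (λ A a B b h → A :* (h :* a) :+ h :* b :* B := h :* (A :* a) :+ h :* (B :* b))
         refl A (recip A) B (recip B) h ⟩
  h * (A * recip A) + h * (B * recip B)
    ≡⟨ cong₂ (λ u v → h * u + h * v) (recip-inverse 0<A) (recip-inverse 0<B) ⟩
  h * 1ℚ + h * 1ℚ
    ≡⟨ cong₂ _+_ (*-identityʳ h) (*-identityʳ h) ⟩
  h + h
    ≡⟨ ½+½ η ⟩
  η ∎
  where
  open ≤-Reasoning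
  h = ½ * η

*-cauchy : ∀ x y → Cauchy (λ n → seq x n * seq y n)
*-cauchy x y {η} 0<η = N , λ m n hm hn → *-close 0<A 0<B
  (bx m (ℕ.≤-trans N₁≤N hm)) (by n (ℕ.≤-trans N₂≤N hn))
  (cx m n (ℕ.≤-trans N₃≤N hm) (ℕ.≤-trans N₃≤N hn))
  (cy m n (ℕ.≤-trans N₄≤N hm) (ℕ.≤-trans N₄≤N hn))
  where
  A = proj₁ (bounded x)
  B = proj₁ (bounded y)
  0<A = proj₁ (proj₂ (bounded x))
  0<B = proj₁ (proj₂ (bounded y))
  N₁ = proj₁ (proj₂ (proj₂ (bounded x)))
  N₂ = proj₁ (proj₂ (proj₂ (bounded y)))
  bx = proj₂ (proj₂ (proj₂ (bounded x)))
  by = proj₂ (proj₂ (proj₂ (bounded y)))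
  closeX = cauchy x (*-pos (half 0<η) (recip-pos 0<B))
  closeY = cauchy y (*-pos (half 0<η) (recip-pos 0<A))
  N₃ = proj₁ closeX
  N₄ = proj₁ closeY
  cx = proj₂ closeX
  cy = proj₂ closeY
  N = N₁ ℕ.⊔ N₂ ℕ.⊔ (N₃ ℕ.⊔ N₄)
  N₁≤N : N₁ ℕ.≤ N
  N₁≤N = ℕ.≤-trans (ℕ.m≤m⊔n N₁ N₂) (ℕ.m≤m⊔n (N₁ ℕ.⊔ N₂) (N₃ ℕ.⊔ N₄))
  N₂≤N : N₂ ℕ.≤ N
  N₂≤N = ℕ.≤-trans (ℕ.m≤n⊔m N₁ N₂) (ℕ.m≤m⊔n (N₁ ℕ.⊔ N₂) (N₃ ℕ.⊔ N₄))
  N₃≤N : N₃ ℕ.≤ N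
  N₃≤N = ℕ.≤-trans (ℕ.m≤m⊔n N₃ N₄) (ℕ.m≤n⊔m (N₁ ℕ.⊔ N₂) (N₃ ℕ.⊔ N₄))
  N₄≤N : N₄ ℕ.≤ N
  N₄≤N = ℕ.≤-trans (ℕ.m≤n⊔m N₃ N₄) (ℕ.m≤n⊔m (N₁ ℕ.⊔ N₂) (N₃ ℕ.⊔ N₄))

_*ᴿ_ : ℝ → ℝ → ℝ
(x *ᴿ y) .seq n = seq x n * seq y n
(x *ᴿ y) .cauchy = *-cauchy x y

_-ᴿ_ : ℝ → ℝ → ℝ
x -ᴿ y = x +ᴿ ι (- 1ℚ) *ᴿ y

infixr 8 _^ᴿ_
_^ᴿ_ : ℝ → ℕ → ℝ
x ^ᴿ zero  = 1ᴿ
x ^ᴿ suc n = x *ᴿ x ^ᴿ n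

lowerBound : ∀ {x} → 0ᴿ <ᴿ x → ∃[ η ] 0ℚ < η × Eventually (λ n → η ≤ seq x n)
lowerBound {x} (separated {η} 0<η ev) =
  η , 0<η , eventually-map (λ {n} → subst (_≤ seq x n) (+-identityˡ η)) ev

recip-uniform : ∀ {η} → 0ℚ < η → LocallyUniform (η ≤_) (λ _ → recip)
recip-uniform {η} 0<η {ε} 0<ε = ε * recip R² , *-pos 0<ε (recip-pos 0<R²) , 0 ,
  λ _ _ _ _ {p} {q} hp hq near → let 0<p = <-≤-trans 0<η hp ; 0<q = <-≤-trans 0<η hq in begin
  abs (recip p - recip q)                  ≡⟨ cong abs (recip-difference 0<p 0<q) ⟩
  abs ((q - p) * (recip p * recip q))      ≡⟨ ∣p*q∣≡∣p∣*∣q∣ (q - p) (recip p * recip q) ⟩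
  abs (q - p) * abs (recip p * recip q)    ≡⟨ cong₂ _*_ (abs-minus-comm q p) (0≤p⇒∣p∣≡p (*-nonneg (<⇒≤ (recip-pos 0<p)) (<⇒≤ (recip-pos 0<q)))) ⟩
  abs (p - q) * (recip p * recip q)        ≤⟨ *-mono (abs-nonneg (p - q)) (*-nonneg (<⇒≤ (recip-pos 0<p)) (<⇒≤ (recip-pos 0<q))) near
                                                (*-mono (<⇒≤ (recip-pos 0<p)) (<⇒≤ (recip-pos 0<q)) (recip-antitone 0<η hp) (recip-antitone 0<η hq)) ⟩
  ε * recip R² * R²                        ≡⟨ solve 3 (λ ε a b → ε :* a :* b := ε :* (b :* a)) refl ε (recip R²) R² ⟩
  ε * (R² * recip R²)                      ≡⟨ cong (ε *_) (recip-inverse 0<R²) ⟩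
  ε * 1ℚ                                   ≡⟨ *-identityʳ ε ⟩
  ε                                        ∎
  where
  open ≤-Reasoning
  R² = recip η * recip η
  0<R² : 0ℚ < R²
  0<R² = *-pos (recip-pos 0<η) (recip-pos 0<η)

infixl 7 _÷ᴿ_[_]

inv : (x : ℝ) → 0ᴿ <ᴿ x → ℝ
inv x 0<x .seq n = recip (seq x n)
inv x 0<x .cauchy = let η , 0<η , ev = lowerBound 0<x in
  diagonal-cauchy {f = λ _ → recip} (recip-uniform 0<η) x ev

_÷ᴿ_[_] : ℝ → (y : ℝ) → 0ᴿ <ᴿ y → ℝ
x ÷ᴿ y [ 0<y ] = x *ᴿ inv y 0<y

<ᴿ-intro : ∀ {η x} → 0ℚ < η → Eventually (λ n → η ≤ seq x n) → 0ᴿ <ᴿ x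
<ᴿ-intro {η} {x} 0<η ev =
  separated 0<η (eventually-map (λ {n} → subst (_≤ seq x n) (sym (+-identityˡ η))) ev)

*ᴿ-pos : ∀ {x y} → 0ᴿ <ᴿ x → 0ᴿ <ᴿ y → 0ᴿ <ᴿ x *ᴿ y
*ᴿ-pos {x} {y} 0<x 0<y =
  let η , 0<η , hx = lowerBound 0<x
      θ , 0<θ , hy = lowerBound 0<y
  in <ᴿ-intro (*-pos 0<η 0<θ) (eventually-∧ (*-mono (<⇒≤ 0<η) (<⇒≤ 0<θ)) hx hy)

inv-pos : ∀ {x} (0<x : 0ᴿ <ᴿ x) → 0ᴿ <ᴿ inv x 0<x
inv-pos {x} 0<x =
  let η , 0<η , hx = lowerBound 0<x
      M , 0<M , bx = bounded x
  in <ᴿ-intro (recip-pos 0<M) (eventually-∧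
       (λ {n} a b → recip-antitone (<-≤-trans 0<η a) (≤-trans (≤abs (seq x n)) b)) hx bx)

1ᴿ-pos : 0ᴿ <ᴿ 1ᴿ
1ᴿ-pos = <ᴿ-intro 0<1 (0 , λ _ _ → ≤-refl)

^ᴿ-pos : ∀ {x} → 0ᴿ <ᴿ x → ∀ n → 0ᴿ <ᴿ x ^ᴿ n
^ᴿ-pos 0<x zero    = 1ᴿ-pos
^ᴿ-pos 0<x (suc n) = *ᴿ-pos 0<x (^ᴿ-pos 0<x n)

Σ<-mono : ∀ {t} → (∀ i → 0ℚ ≤ t i) → ∀ {m n} → m ℕ.≤ n → Σ< m t ≤ Σ< n t
Σ<-mono {t} 0≤t {m} {n} m≤n = go (ℕ.≤⇒≤′ m≤n)
  where
  go : ∀ {n} → m ℕ.≤′ n → Σ< m t ≤ Σ< n t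
  go ℕ.≤′-refl = ≤-refl
  go (ℕ.≤′-step {n} h) = ≤-trans (go h)
    (subst (_≤ Σ< n t + t n) (+-identityʳ (Σ< n t)) (+-monoʳ-≤ (Σ< n t) (0≤t n)))

term≤Σ< : ∀ {t} → (∀ i → 0ℚ ≤ t i) → ∀ {i n} → i ℕ.< n → t i ≤ Σ< n t
term≤Σ< {t} 0≤t {i} i<n = ≤-trans
  (subst (_≤ Σ< i t + t i) (+-identityˡ (t i)) (+-monoˡ-≤ (t i) (Σ<-nonneg i)))
  (Σ<-mono 0≤t i<n)
  where
  Σ<-nonneg : ∀ n → 0ℚ ≤ Σ< n t
  Σ<-nonneg n = Σ<-mono 0≤t {0} {n} ℕ.z≤n

-- Uniform convergence by comparison with a telescoping series g i - g (i+1).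
module _ {D : ℚ → Set} {t : ℕ → ℚ → ℚ} {g : ℕ → ℚ}
  (0≤g : ∀ i → 0ℚ ≤ g i) (g→0 : Null g)
  (bound : ∀ i {p} → D p → abs (t i p) ≤ g i - g (suc i))
  (lipschitz : ∀ i {p q} → D p → D q → abs (t i p - t i q) ≤ abs (p - q) * (g i - g (suc i)))
  where

  private
    S : ℕ → ℚ → ℚ
    S n p = Σ< n (λ i → t i p)

    drop-nonneg : ∀ a {b} → 0ℚ ≤ b → a - b ≤ a
    drop-nonneg a {b} 0≤b = subst (a - b ≤_) (+-identityʳ a) (+-monoʳ-≤ a (neg-antimono-≤ 0≤b))

    S-tail : ∀ {m n p} → D p → m ℕ.≤′ n → abs (S n p - S m p) ≤ g m - g n
    S-tail {m} {p = p} d ℕ.≤′-refl = ≤-reflexive (trans (cong abs (+-inverseʳ (S m p))) (sym (+-inverseʳ (g m))))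
    S-tail {m} {p = p} d (ℕ.≤′-step {n} h) = begin
      abs (S n p + t n p - S m p)           ≡⟨ cong abs (solve 3 (λ a b c → a :+ b :- c := a :- c :+ b) refl (S n p) (t n p) (S m p)) ⟩
      abs (S n p - S m p + t n p)           ≤⟨ ∣p+q∣≤∣p∣+∣q∣ (S n p - S m p) (t n p) ⟩
      abs (S n p - S m p) + abs (t n p)     ≤⟨ +-mono-≤ (S-tail d h) (bound n d) ⟩
      g m - g n + (g n - g (suc n))         ≡⟨ solve 3 (λ a b c → a :- b :+ (b :- c) := a :- c) refl (g m) (g n) (g (suc n)) ⟩
      g m - g (suc n)                       ∎
      where open ≤-Reasoning

    S-lipschitz : ∀ n {p q} → D p → D q → abs (S n p - S n q) ≤ abs (p - q) * (g 0 - g n)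
    S-lipschitz zero {p} {q} dp dq = ≤-reflexive (sym (trans (cong (abs (p - q) *_) (+-inverseʳ (g 0))) (*-zeroʳ (abs (p - q)))))
    S-lipschitz (suc n) {p} {q} dp dq = begin
      abs (S n p + t n p - (S n q + t n q))
        ≡⟨ cong abs (solve 4 (λ a b c d → a :+ b :- (c :+ d) := a :- c :+ (b :- d)) refl (S n p) (t n p) (S n q) (t n q)) ⟩
      abs (S n p - S n q + (t n p - t n q))
        ≤⟨ ∣p+q∣≤∣p∣+∣q∣ (S n p - S n q) (t n p - t n q) ⟩
      abs (S n p - S n q) + abs (t n p - t n q)
        ≤⟨ +-mono-≤ (S-lipschitz n dp dq) (lipschitz n dp dq) ⟩
      abs (p - q) * (g 0 - g n) + abs (p - q) * (g n - g (suc n))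
        ≡⟨ solve 4 (λ e a b c → e :* (a :- b) :+ e :* (b :- c) := e :* (a :- c)) refl (abs (p - q)) (g 0) (g n) (g (suc n)) ⟩
      abs (p - q) * (g 0 - g (suc n)) ∎
      where open ≤-Reasoning

  series-uniform : LocallyUniform D S
  series-uniform {η} 0<η = δ , 0<δ , N , λ m n hm hn {p} {q} dp dq near → begin
    abs (S m p - S n q)
      ≤⟨ abs-triangle (S m p) (S N p) (S n q) ⟩
    abs (S m p - S N p) + abs (S N p - S n q)
      ≤⟨ +-monoʳ-≤ (abs (S m p - S N p)) (abs-triangle (S N p) (S N q) (S n q)) ⟩
    abs (S m p - S N p) + (abs (S N p - S N q) + abs (S N q - S n q))
      ≤⟨ +-mono-≤ (tail dp hm) (+-mono-≤ (middle dp dq near)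
           (subst (_≤ ½ * h) (abs-minus-comm (S n q) (S N q)) (tail dq hn))) ⟩
    ½ * h + (h + ½ * h)
      ≡⟨ solve 1 (λ η → con ½ :* (con ½ :* η) :+ (con ½ :* η :+ con ½ :* (con ½ :* η)) := η) refl η ⟩
    η ∎
    where
    open ≤-Reasoning
    h = ½ * η
    0<h : 0ℚ < h
    0<h = half 0<η
    G = 1ℚ + g 0
    0<G : 0ℚ < G
    0<G = +-mono-<-≤ 0<1 (0≤g 0)
    δ = h * recip G
    0<δ : 0ℚ < δ
    0<δ = *-pos 0<h (recip-pos 0<G)
    N = proj₁ (g→0 (half 0<h))
    tail : ∀ {m p} → D p → N ℕ.≤ m → abs (S m p - S N p) ≤ ½ * h
    tail {m} d hm = ≤-trans (S-tail d (ℕ.≤⇒≤′ hm))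
      (≤-trans (drop-nonneg (g N) (0≤g m)) (proj₂ (g→0 (half 0<h))))
    g0≤G : g 0 ≤ G
    g0≤G = subst (_≤ G) (+-identityˡ (g 0)) (+-monoˡ-≤ (g 0) (<⇒≤ 0<1))
    middle : ∀ {p q} → D p → D q → abs (p - q) ≤ δ → abs (S N p - S N q) ≤ h
    middle {p} {q} dp dq near = begin
      abs (S N p - S N q)          ≤⟨ S-lipschitz N dp dq ⟩
      abs (p - q) * (g 0 - g N)    ≤⟨ *-monoʳ (abs (p - q)) (abs-nonneg (p - q)) (≤-trans (drop-nonneg (g 0) (0≤g N)) g0≤G) ⟩
      abs (p - q) * G              ≤⟨ *-monoˡ G (<⇒≤ 0<G) near ⟩
      h * recip G * G              ≡⟨ solve 3 (λ h a b → h :* a :* b := h :* (b :* a)) refl h (recip G) G ⟩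
      h * (G * recip G)            ≡⟨ cong (h *_) (recip-inverse 0<G) ⟩
      h * 1ℚ                       ≡⟨ *-identityʳ h ⟩
      h                            ∎

eventually-antitone-bounded : ∀ {v} → (∀ i → 0ℚ ≤ v i) → ∀ R → (∀ i → R ℕ.≤ i → v (suc i) ≤ v i) →
  ∃[ K ] 0ℚ ≤ K × (∀ i → v i ≤ K)
eventually-antitone-bounded {v} 0≤v R dec =
  Σ< (suc R) v , ≤-trans (0≤v R) (term≤Σ< 0≤v (ℕ.n<1+n R)) , all
  where
  after : ∀ {i} → R ℕ.≤′ i → v i ≤ v R
  after ℕ.≤′-refl       = ≤-refl
  after (ℕ.≤′-step {i} h) = ≤-trans (dec i (ℕ.≤′⇒≤ h)) (after h)
  all : ∀ i → v i ≤ Σ< (suc R) v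
  all i with ℕ.≤-total i R
  ... | inj₁ h = term≤Σ< 0≤v (ℕ.s≤s h)
  ... | inj₂ h = ≤-trans (after (ℕ.≤⇒≤′ h)) (term≤Σ< 0≤v (ℕ.n<1+n R))

fromℕ-pos′ : ∀ n → .{{ℕ.NonZero n}} → 0ℚ < fromℕ n
fromℕ-pos′ (suc n) = fromℕ-pos n

recip-* : ∀ {p q} → 0ℚ < p → 0ℚ < q → recip (p * q) ≡ recip p * recip q
recip-* {p} {q} 0<p 0<q = begin
  w                          ≡⟨ *-identityʳ w ⟨
  w * 1ℚ                     ≡⟨ cong (w *_) (*-identityʳ 1ℚ) ⟨
  w * (1ℚ * 1ℚ)              ≡⟨ cong₂ (λ a b → w * (a * b)) (recip-inverse 0<p) (recip-inverse 0<q) ⟨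
  w * (p * u * (q * v))      ≡⟨ solve 5 (λ p q u v w → w :* (p :* u :* (q :* v)) := p :* q :* w :* (u :* v)) refl p q u v w ⟩
  p * q * w * (u * v)        ≡⟨ cong (_* (u * v)) (recip-inverse (*-pos 0<p 0<q)) ⟩
  1ℚ * (u * v)               ≡⟨ *-identityˡ (u * v) ⟩
  u * v                      ∎
  where
  open ≡-Reasoning
  u = recip p
  v = recip q
  w = recip (p * q)

expTerm : ℕ → ℚ → ℚ
expTerm i q = q ^ℚ i * recip (fromℕ (i ℕ.!))

recip!-pos : ∀ i → 0ℚ < recip (fromℕ (i ℕ.!))
recip!-pos i = recip-pos (fromℕ-pos′ (i ℕ.!) {{i ℕ.!≢0}})

recip!-suc : ∀ i → recip (fromℕ (suc i ℕ.!)) ≡ recip (fromℕ (suc i)) * recip (fromℕ (i ℕ.!))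
recip!-suc i = trans (cong recip (fromℕ-* (suc i) (i ℕ.!)))
  (recip-* (fromℕ-pos i) (fromℕ-pos′ (i ℕ.!) {{i ℕ.!≢0}}))

expTerm-nonneg : ∀ {q} → 0ℚ ≤ q → ∀ i → 0ℚ ≤ expTerm i q
expTerm-nonneg h i = *-nonneg (^ℚ-nonneg h i) (<⇒≤ (recip!-pos i))

expTerm-bounded : ∀ {q} → 0ℚ ≤ q → ∃[ K ] 0ℚ ≤ K × (∀ i → expTerm i q ≤ K)
expTerm-bounded {q} 0≤q = eventually-antitone-bounded (expTerm-nonneg 0≤q) (proj₁ (archimedean q)) λ i R≤i → begin
  q * q ^ℚ i * recip (fromℕ (suc i ℕ.!))
    ≡⟨ cong (q * q ^ℚ i *_) (recip!-suc i) ⟩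
  q * q ^ℚ i * (recip (fromℕ (suc i)) * recip (fromℕ (i ℕ.!)))
    ≡⟨ solve 4 (λ q x a b → q :* x :* (a :* b) := q :* a :* (x :* b)) refl q (q ^ℚ i) (recip (fromℕ (suc i))) (recip (fromℕ (i ℕ.!))) ⟩
  q * recip (fromℕ (suc i)) * expTerm i q
    ≤⟨ *-monoˡ (expTerm i q) (expTerm-nonneg 0≤q i) (*-monoˡ (recip (fromℕ (suc i))) (<⇒≤ (recip-pos (fromℕ-pos i)))
         (≤-trans (proj₂ (archimedean q)) (fromℕ-mono (ℕ.m≤n⇒m≤1+n R≤i)))) ⟩
  fromℕ (suc i) * recip (fromℕ (suc i)) * expTerm i q
    ≡⟨ cong (_* expTerm i q) (recip-inverse (fromℕ-pos i)) ⟩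
  1ℚ * expTerm i q
    ≡⟨ *-identityˡ (expTerm i q) ⟩
  expTerm i q ∎
  where open ≤-Reasoning

module _ {r : ℚ} (0<r : 0ℚ < r) where

  private
    0≤r = <⇒≤ 0<r

    bnd = expTerm-bounded (*-nonneg (<⇒≤ 0<2) 0≤r)

    K : ℚ
    K = proj₁ bnd

    0≤K : 0ℚ ≤ K
    0≤K = proj₁ (proj₂ bnd)

    x : ℕ → ℚ
    x i = ½ ^ℚ i

    0≤x : ∀ i → 0ℚ ≤ x i
    0≤x = ^ℚ-nonneg (<⇒≤ 0<½)

    expTerm≤ : ∀ i → expTerm i r ≤ K * x i
    expTerm≤ i = begin
      r ^ℚ i * c                      ≡⟨ cong (_* c) (*-identityˡ (r ^ℚ i)) ⟨
      1ℚ * r ^ℚ i * c                 ≡⟨ cong (λ a → a * r ^ℚ i * c) (trans (sym (^ℚ-distrib-* ½ 2ℚ i)) (1^ℚ i)) ⟨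
      x i * 2ℚ ^ℚ i * r ^ℚ i * c      ≡⟨ solve 4 (λ x y z c → x :* y :* z :* c := y :* z :* c :* x) refl (x i) (2ℚ ^ℚ i) (r ^ℚ i) c ⟩
      2ℚ ^ℚ i * r ^ℚ i * c * x i      ≡⟨ cong (λ a → a * c * x i) (^ℚ-distrib-* 2ℚ r i) ⟨
      expTerm i (2ℚ * r) * x i        ≤⟨ *-monoˡ (x i) (0≤x i) (proj₂ (proj₂ bnd) i) ⟩
      K * x i                         ∎
      where
      open ≤-Reasoning
      c = recip (fromℕ (i ℕ.!))

    4K : ℚ
    4K = fromℕ 4 * K

    0≤4K : 0ℚ ≤ 4K
    0≤4K = *-nonneg (fromℕ-nonneg 4) 0≤K

    g : ℕ → ℚ
    g i = 4K * x i

    g-step : ∀ i → 2ℚ * (K * x i) ≡ g i - g (suc i)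
    g-step i = solve 2 (λ K x → con 2ℚ :* (K :* x) := con (fromℕ 4) :* K :* x :- con (fromℕ 4) :* K :* (con ½ :* x)) refl K (x i)

    p≤2p : ∀ {p} → 0ℚ ≤ p → p ≤ 2ℚ * p
    p≤2p {p} h = 0≤-⇒≤ (subst (0ℚ ≤_) (solve 1 (λ p → p := con 2ℚ :* p :- p) refl p) h)

    bound : ∀ i {p} → abs p ≤ r → abs (expTerm i p) ≤ g i - g (suc i)
    bound i {p} hp = begin
      abs (p ^ℚ i * c)        ≡⟨ ∣p*q∣≡∣p∣*∣q∣ (p ^ℚ i) c ⟩
      abs (p ^ℚ i) * abs c    ≡⟨ cong (abs (p ^ℚ i) *_) (0≤p⇒∣p∣≡p (<⇒≤ (recip!-pos i))) ⟩
      abs (p ^ℚ i) * c        ≤⟨ *-monoˡ c (<⇒≤ (recip!-pos i)) (abs-^ℚ hp i) ⟩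
      expTerm i r             ≤⟨ expTerm≤ i ⟩
      K * x i                 ≤⟨ p≤2p (*-nonneg 0≤K (0≤x i)) ⟩
      2ℚ * (K * x i)          ≡⟨ g-step i ⟩
      g i - g (suc i)         ∎
      where
      open ≤-Reasoning
      c = recip (fromℕ (i ℕ.!))

    lipschitz : ∀ i {p q} → abs p ≤ r → abs q ≤ r →
      abs (expTerm i p - expTerm i q) ≤ abs (p - q) * (g i - g (suc i))
    lipschitz zero {p} {q} hp hq = subst (_≤ abs (p - q) * (g 0 - g 1)) (sym (cong abs (+-inverseʳ (expTerm 0 p))))
      (*-nonneg (abs-nonneg (p - q)) (subst (0ℚ ≤_) (g-step 0) (*-nonneg (<⇒≤ 0<2) (*-nonneg 0≤K (0≤x 0)))))
    lipschitz (suc i) {p} {q} hp hq = begin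
      abs (p ^ℚ suc i * c′ - q ^ℚ suc i * c′)
        ≡⟨ cong abs (solve 3 (λ a b c → a :* c :- b :* c := (a :- b) :* c) refl (p ^ℚ suc i) (q ^ℚ suc i) c′) ⟩
      abs ((p ^ℚ suc i - q ^ℚ suc i) * c′)
        ≡⟨ ∣p*q∣≡∣p∣*∣q∣ (p ^ℚ suc i - q ^ℚ suc i) c′ ⟩
      abs (p ^ℚ suc i - q ^ℚ suc i) * abs c′
        ≡⟨ cong (abs (p ^ℚ suc i - q ^ℚ suc i) *_) (0≤p⇒∣p∣≡p (<⇒≤ (recip!-pos (suc i)))) ⟩
      abs (p ^ℚ suc i - q ^ℚ suc i) * c′
        ≤⟨ *-monoˡ c′ (<⇒≤ (recip!-pos (suc i))) (^ℚ-lipschitz hp hq i) ⟩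
      d * (k * r ^ℚ i) * c′
        ≡⟨ cong (d * (k * r ^ℚ i) *_) (recip!-suc i) ⟩
      d * (k * r ^ℚ i) * (recip k * c)
        ≡⟨ solve 5 (λ d k y a c → d :* (k :* y) :* (a :* c) := k :* a :* (d :* (y :* c))) refl d k (r ^ℚ i) (recip k) c ⟩
      k * recip k * (d * expTerm i r)
        ≡⟨ trans (cong (_* (d * expTerm i r)) (recip-inverse (fromℕ-pos i))) (*-identityˡ (d * expTerm i r)) ⟩
      d * expTerm i r
        ≤⟨ *-monoʳ d (abs-nonneg (p - q)) (expTerm≤ i) ⟩
      d * (K * x i)
        ≡⟨ cong (d *_) (trans (solve 2 (λ K x → K :* x := con 2ℚ :* (K :* (con ½ :* x))) refl K (x i)) (g-step (suc i))) ⟩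
      d * (g (suc i) - g (suc (suc i))) ∎
      where
      open ≤-Reasoning
      c = recip (fromℕ (i ℕ.!))
      c′ = recip (fromℕ (suc i ℕ.!))
      d = abs (p - q)
      k = fromℕ (suc i)

  exp-uniform : LocallyUniform (λ q → abs q ≤ r) (λ n q → Σ< n (λ i → expTerm i q))
  exp-uniform = series-uniform {t = expTerm} {g = g} (λ i → *-nonneg 0≤4K (0≤x i))
    (geometric-null 0≤4K (<⇒≤ 0<½) (*<* (ℤ.+<+ (ℕ.s≤s (ℕ.s≤s ℕ.z≤n))))) bound lipschitz

exp : ℝ → ℝ
exp x .seq n = Σ< n (λ i → expTerm i (seq x n))
exp x .cauchy = let r , 0<r , bx = bounded x in
  diagonal-cauchy {f = λ n q → Σ< n (λ i → expTerm i q)} (exp-uniform 0<r) x bx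

artanhTerm : ℕ → ℚ → ℚ
artanhTerm i z = z ^ℚ suc (2 ℕ.* i) * recip (fromℕ (suc (2 ℕ.* i)))

^ℚ-double : ∀ r i → r ^ℚ (2 ℕ.* i) ≡ (r * r) ^ℚ i
^ℚ-double r i = trans (^ℚ-+ i (i ℕ.+ 0)) (trans (cong (λ k → r ^ℚ i * r ^ℚ k) (ℕ.+-identityʳ i)) (sym (^ℚ-distrib-* r r i)))
  where
  ^ℚ-+ : ∀ m n → r ^ℚ (m ℕ.+ n) ≡ r ^ℚ m * r ^ℚ n
  ^ℚ-+ zero    n = sym (*-identityˡ (r ^ℚ n))
  ^ℚ-+ (suc m) n = trans (cong (r *_) (^ℚ-+ m n)) (sym (*-assoc r (r ^ℚ m) (r ^ℚ n)))

recip-odd-pos : ∀ i → 0ℚ < recip (fromℕ (suc (2 ℕ.* i)))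
recip-odd-pos i = recip-pos (fromℕ-pos (2 ℕ.* i))

artanhTerm-nonneg : ∀ {z} → 0ℚ ≤ z → ∀ i → 0ℚ ≤ artanhTerm i z
artanhTerm-nonneg 0≤z i = *-nonneg (^ℚ-nonneg 0≤z (suc (2 ℕ.* i))) (<⇒≤ (recip-odd-pos i))

module _ {r : ℚ} (0≤r : 0ℚ ≤ r) (r<1 : r < 1ℚ) where

  private
    ρ = r * r

    0≤ρ : 0ℚ ≤ ρ
    0≤ρ = *-nonneg 0≤r 0≤r

    ρ<1 : ρ < 1ℚ
    ρ<1 = ≤-<-trans (subst (ρ ≤_) (*-identityʳ r) (*-monoʳ r 0≤r (<⇒≤ r<1))) r<1

    B = recip (1ℚ - ρ)

    0≤B : 0ℚ ≤ B
    0≤B = <⇒≤ (recip-pos (<⇒0<- ρ<1))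

    g : ℕ → ℚ
    g i = B * ρ ^ℚ i

    g-step : ∀ i → r ^ℚ (2 ℕ.* i) ≡ g i - g (suc i)
    g-step i = trans (^ℚ-double r i) (trans (sym (*-identityˡ (ρ ^ℚ i)))
      (trans (cong (_* ρ ^ℚ i) (sym (recip-inverse (<⇒0<- ρ<1))))
        (solve 3 (λ ρ B y → (con 1ℚ :- ρ) :* B :* y := B :* y :- B :* (ρ :* y)) refl ρ B (ρ ^ℚ i))))

    lipschitz : ∀ i {p q} → abs p ≤ r → abs q ≤ r →
      abs (artanhTerm i p - artanhTerm i q) ≤ abs (p - q) * (g i - g (suc i))
    lipschitz i {p} {q} hp hq = begin
      abs (p′ * c - q′ * c)
        ≡⟨ cong abs (solve 3 (λ a b c → a :* c :- b :* c := (a :- b) :* c) refl p′ q′ c) ⟩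
      abs ((p′ - q′) * c)
        ≡⟨ ∣p*q∣≡∣p∣*∣q∣ (p′ - q′) c ⟩
      abs (p′ - q′) * abs c
        ≡⟨ cong (abs (p′ - q′) *_) (0≤p⇒∣p∣≡p (<⇒≤ (recip-odd-pos i))) ⟩
      abs (p′ - q′) * c
        ≤⟨ *-monoˡ c (<⇒≤ (recip-odd-pos i)) (^ℚ-lipschitz hp hq (2 ℕ.* i)) ⟩
      d * (k * r ^ℚ (2 ℕ.* i)) * c
        ≡⟨ solve 4 (λ d k y a → d :* (k :* y) :* a := k :* a :* (d :* y)) refl d k (r ^ℚ (2 ℕ.* i)) c ⟩
      k * c * (d * r ^ℚ (2 ℕ.* i))
        ≡⟨ trans (cong (_* (d * r ^ℚ (2 ℕ.* i))) (recip-inverse (fromℕ-pos (2 ℕ.* i)))) (*-identityˡ (d * r ^ℚ (2 ℕ.* i))) ⟩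
      d * r ^ℚ (2 ℕ.* i)
        ≡⟨ cong (d *_) (g-step i) ⟩
      d * (g i - g (suc i)) ∎
      where
      open ≤-Reasoning
      k = fromℕ (suc (2 ℕ.* i))
      c = recip k
      d = abs (p - q)
      p′ = p ^ℚ suc (2 ℕ.* i)
      q′ = q ^ℚ suc (2 ℕ.* i)

    artanhTerm-zero : ∀ i → artanhTerm i 0ℚ ≡ 0ℚ
    artanhTerm-zero i = trans (cong (_* recip (fromℕ (suc (2 ℕ.* i)))) (*-zeroˡ (0ℚ ^ℚ (2 ℕ.* i)))) (*-zeroˡ (recip (fromℕ (suc (2 ℕ.* i)))))

    bound : ∀ i {p} → abs p ≤ r → abs (artanhTerm i p) ≤ g i - g (suc i)
    bound i {p} hp = begin
      abs (artanhTerm i p)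
        ≡⟨ cong abs (trans (sym (+-identityʳ (artanhTerm i p))) (cong (λ y → artanhTerm i p - y) (sym (artanhTerm-zero i)))) ⟩
      abs (artanhTerm i p - artanhTerm i 0ℚ)
        ≤⟨ lipschitz i hp 0≤r ⟩
      abs (p - 0ℚ) * (g i - g (suc i))
        ≡⟨ cong₂ (λ a b → abs a * b) (+-identityʳ p) (sym (g-step i)) ⟩
      abs p * r ^ℚ (2 ℕ.* i)
        ≤⟨ *-monoˡ (r ^ℚ (2 ℕ.* i)) (^ℚ-nonneg 0≤r (2 ℕ.* i)) (≤-trans hp (<⇒≤ r<1)) ⟩
      1ℚ * r ^ℚ (2 ℕ.* i)
        ≡⟨ trans (*-identityˡ (r ^ℚ (2 ℕ.* i))) (g-step i) ⟩
      g i - g (suc i) ∎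
      where open ≤-Reasoning

  artanh-uniform : LocallyUniform (λ z → abs z ≤ r) (λ n z → Σ< n (λ i → artanhTerm i z))
  artanh-uniform = series-uniform {t = artanhTerm} {g = g}
    (λ i → *-nonneg 0≤B (^ℚ-nonneg 0≤ρ i)) (geometric-null 0≤B 0≤ρ ρ<1) bound lipschitz

∣_∣<1 : ℝ → Set
∣ z ∣<1 = ∃[ r ] r < 1ℚ × Eventually (λ n → abs (seq z n) ≤ r)

artanh : (z : ℝ) → ∣ z ∣<1 → ℝ
artanh z ∣z∣<1 .seq n = Σ< n (λ i → artanhTerm i (seq z n))
artanh z (r , r<1 , N , bz) .cauchy =
  diagonal-cauchy {f = λ n q → Σ< n (λ i → artanhTerm i q)}
    (artanh-uniform (≤-trans (abs-nonneg (seq z N)) (bz N ℕ.≤-refl)) r<1) z (N , bz)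

+ᴿ-pos : ∀ {x y} → 0ᴿ <ᴿ x → 0ᴿ <ᴿ y → 0ᴿ <ᴿ x +ᴿ y
+ᴿ-pos {x} {y} 0<x 0<y =
  let η , 0<η , hx = lowerBound 0<x
      θ , 0<θ , hy = lowerBound 0<y
  in <ᴿ-intro (+-pos 0<η 0<θ) (eventually-∧ +-mono-≤ hx hy)

cayley : (x : ℝ) → 0ᴿ <ᴿ x → ℝ
cayley x 0<x = (x -ᴿ 1ᴿ) ÷ᴿ (x +ᴿ 1ᴿ) [ +ᴿ-pos 0<x 1ᴿ-pos ]

cayley≡ : ∀ {q} → 0ℚ < q → (q + - 1ℚ * 1ℚ) * recip (q + 1ℚ) ≡ 1ℚ - 2ℚ * recip (q + 1ℚ)
cayley≡ {q} 0<q = trans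
  (solve 2 (λ q u → (q :+ :- con 1ℚ :* con 1ℚ) :* u := (q :+ con 1ℚ) :* u :- con 2ℚ :* u) refl q u)
  (cong (_- 2ℚ * u) (recip-inverse (+-pos 0<q 0<1)))
  where u = recip (q + 1ℚ)

-cayley≡ : ∀ {q} → 0ℚ < q → - ((q + - 1ℚ * 1ℚ) * recip (q + 1ℚ)) ≡ 1ℚ - 2ℚ * (q * recip (q + 1ℚ))
-cayley≡ {q} 0<q = trans
  (solve 2 (λ q u → :- ((q :+ :- con 1ℚ :* con 1ℚ) :* u) := (q :+ con 1ℚ) :* u :- con 2ℚ :* (q :* u)) refl q u)
  (cong (_- 2ℚ * (q * u)) (recip-inverse (+-pos 0<q 0<1)))
  where u = recip (q + 1ℚ)

∣cayley∣<1 : ∀ x 0<x → ∣ cayley x 0<x ∣<1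
∣cayley∣<1 x 0<x =
  let η , 0<η , hx = lowerBound 0<x
      M , 0<M , bx = bounded x
      R = recip (M + 1ℚ)
      0<R = recip-pos (+-pos 0<M 0<1)
      a = 1ℚ - 2ℚ * R
      b = 1ℚ - 2ℚ * (η * R)
  in a ⊔ b
   , ⊔-< (1-pos (*-pos 0<2 0<R)) (1-pos (*-pos 0<2 (*-pos 0<η 0<R)))
   , eventually-∧ (λ {n} η≤q ∣q∣≤M → in-range 0<η η≤q (≤-trans (≤abs (seq x n)) ∣q∣≤M)) hx bx
  where
  1-pos : ∀ {p} → 0ℚ < p → 1ℚ - p < 1ℚ
  1-pos {p} h = subst (1ℚ - p <_) (+-identityʳ 1ℚ) (+-monoʳ-< 1ℚ (neg-antimono-< h))
  ⊔-< : ∀ {a b} → a < 1ℚ → b < 1ℚ → a ⊔ b < 1ℚ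
  ⊔-< {a} {b} ha hb with ≤-total a b
  ... | inj₁ h = subst (_< 1ℚ) (sym (p≤q⇒p⊔q≡q h)) hb
  ... | inj₂ h = subst (_< 1ℚ) (sym (p≥q⇒p⊔q≡p h)) ha
  1-anti : ∀ {p p′} → p ≤ p′ → 1ℚ - 2ℚ * p′ ≤ 1ℚ - 2ℚ * p
  1-anti h = +-monoʳ-≤ 1ℚ (neg-antimono-≤ (*-monoʳ 2ℚ (<⇒≤ 0<2) h))
  in-range : ∀ {η q M} → 0ℚ < η → η ≤ q → q ≤ M →
    abs ((q + - 1ℚ * 1ℚ) * recip (q + 1ℚ)) ≤
    (1ℚ - 2ℚ * recip (M + 1ℚ)) ⊔ (1ℚ - 2ℚ * (η * recip (M + 1ℚ)))
  in-range {η} {q} {M} 0<η η≤q q≤M = abs≤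
    (≤-trans (≤-reflexive (cayley≡ 0<q)) (≤-trans (1-anti R≤u) (p≤p⊔q a b)))
    (≤-trans (≤-reflexive (-cayley≡ 0<q))
      (≤-trans (1-anti (*-mono (<⇒≤ 0<η) (<⇒≤ 0<R) η≤q R≤u)) (p≤q⊔p a b)))
    where
    a = 1ℚ - 2ℚ * recip (M + 1ℚ)
    b = 1ℚ - 2ℚ * (η * recip (M + 1ℚ))
    0<q = <-≤-trans 0<η η≤q
    0<R = recip-pos (+-pos (<-≤-trans 0<q q≤M) 0<1)
    R≤u : recip (M + 1ℚ) ≤ recip (q + 1ℚ)
    R≤u = recip-antitone (+-pos 0<q 0<1) (+-monoˡ-≤ 1ℚ q≤M)

-- log x = 2 artanh ((x - 1) / (x + 1)), natural logarithm.
log : (x : ℝ) → 0ᴿ <ᴿ x → ℝ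
log x 0<x = 2ᴿ *ᴿ artanh (cayley x 0<x) (∣cayley∣<1 x 0<x)

artanh-sum≥ : ∀ {z n} → 0ℚ ≤ z → 1 ℕ.≤ n → z ≤ Σ< n (λ i → artanhTerm i z)
artanh-sum≥ {z} {n} 0≤z 1≤n = ≤-trans (≤-reflexive (solve 1 (λ z → z := z :* con 1ℚ :* con 1ℚ) refl z))
  (term≤Σ< (artanhTerm-nonneg 0≤z) 1≤n)

log-pos : ∀ {x} (0<x : 0ᴿ <ᴿ x) → 1ᴿ <ᴿ x → 0ᴿ <ᴿ log x 0<x
log-pos {x} 0<x (separated {η} 0<η hx) =
  let M , 0<M , bx = bounded x
      R = recip (M + 1ℚ)
      0<ηR = *-pos 0<η (recip-pos (+-pos 0<M 0<1))
  in <ᴿ-intro (*-pos 0<2 0<ηR)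
       (eventually-∧ (λ {n} f 1≤n → f 1≤n)
         (eventually-∧ (λ {n} lo hi 1≤n → *-monoʳ 2ℚ (<⇒≤ 0<2)
            (let z≥ = cayley≥ 0<η lo (≤-trans (≤abs (seq x n)) hi)
             in ≤-trans z≥ (artanh-sum≥ (≤-trans (<⇒≤ 0<ηR) z≥) 1≤n))) hx bx)
         (1 , λ _ h → h))
  where
  cayley≥ : ∀ {η q M} → 0ℚ < η → 1ℚ + η ≤ q → q ≤ M →
    η * recip (M + 1ℚ) ≤ (q + - 1ℚ * 1ℚ) * recip (q + 1ℚ)
  cayley≥ {η} {q} {M} 0<η lo hi = *-mono (<⇒≤ 0<η)
    (<⇒≤ (recip-pos (+-pos (<-≤-trans 0<q hi) 0<1)))
    (subst (_≤ q - 1ℚ) (solve 1 (λ η → con 1ℚ :+ η :- con 1ℚ := η) refl η) (+-monoˡ-≤ (- 1ℚ) lo))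
    (recip-antitone (+-pos 0<q 0<1) (+-monoˡ-≤ 1ℚ hi))
    where
    0<q : 0ℚ < q
    0<q = <-≤-trans (+-pos 0<1 0<η) lo

-- Real exponents: x ^ e = exp (e log x) for x > 0.
infixr 8 _^[_]_
_^[_]_ : (x : ℝ) → 0ᴿ <ᴿ x → ℝ → ℝ
x ^[ 0<x ] e = exp (e *ᴿ log x 0<x)

ιℕ : ℕ → ℝ
ιℕ n = ι (fromℕ n)

ιℕ-pos : ∀ n → 0 ℕ.< n → 0ᴿ <ᴿ ιℕ n
ιℕ-pos (suc n) _ = <ᴿ-intro (fromℕ-pos n) (0 , λ _ _ → ≤-refl)

ιℕ>1 : ∀ n → 2 ℕ.≤ n → 1ᴿ <ᴿ ιℕ n
ιℕ>1 n 2≤n = separated 0<1 (0 , λ _ _ → fromℕ-mono 2≤n)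

logℕ : (n : ℕ) → 0 ℕ.< n → ℝ
logℕ n 0<n = log (ιℕ n) (ιℕ-pos n 0<n)

logℕ-pos : ∀ n (0<n : 0 ℕ.< n) → 2 ℕ.≤ n → 0ᴿ <ᴿ logℕ n 0<n
logℕ-pos n 0<n 2≤n = log-pos (ιℕ-pos n 0<n) (ιℕ>1 n 2≤n)

logℕ>1 : ∀ n (0<n : 0 ℕ.< n) → 3 ℕ.≤ n → 1ᴿ <ᴿ logℕ n 0<n
logℕ>1 n 0<n 3≤n = separated (recip-pos (fromℕ-pos 11)) (2 , λ k 2≤k → begin
  1ℚ + recip (fromℕ 12)
    ≡⟨ refl ⟩
  2ℚ * (artanhTerm 0 ½ + artanhTerm 1 ½)
    ≤⟨ *-monoʳ 2ℚ (<⇒≤ 0<2) (+-mono-≤ (artanhTerm-mono 0) (artanhTerm-mono 1)) ⟩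
  2ℚ * (artanhTerm 0 z + artanhTerm 1 z)
    ≡⟨ cong (λ y → 2ℚ * (y + artanhTerm 1 z)) (+-identityˡ (artanhTerm 0 z)) ⟨
  2ℚ * Σ< 2 (λ i → artanhTerm i z)
    ≤⟨ *-monoʳ 2ℚ (<⇒≤ 0<2) (Σ<-mono (artanhTerm-nonneg 0≤z) 2≤k) ⟩
  2ℚ * Σ< k (λ i → artanhTerm i z) ∎)
  where
  open ≤-Reasoning
  q = fromℕ n
  z = (q + - 1ℚ * 1ℚ) * recip (q + 1ℚ)
  0<q : 0ℚ < q
  0<q = <-≤-trans (fromℕ-pos 2) (fromℕ-mono 3≤n)
  ½≤z : ½ ≤ z
  ½≤z = ≤-trans (+-monoʳ-≤ 1ℚ (neg-antimono-≤ (*-monoʳ 2ℚ (<⇒≤ 0<2)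
      (recip-antitone (fromℕ-pos 3) (+-monoˡ-≤ 1ℚ (fromℕ-mono 3≤n))))))
    (≤-reflexive (sym (cayley≡ 0<q)))
  0≤z : 0ℚ ≤ z
  0≤z = ≤-trans (<⇒≤ 0<½) ½≤z
  ^ℚ-mono : ∀ i → ½ ^ℚ i ≤ z ^ℚ i
  ^ℚ-mono zero    = ≤-refl
  ^ℚ-mono (suc i) = *-mono (<⇒≤ 0<½) (^ℚ-nonneg (<⇒≤ 0<½) i) ½≤z (^ℚ-mono i)
  artanhTerm-mono : ∀ i → artanhTerm i ½ ≤ artanhTerm i z
  artanhTerm-mono i = *-monoˡ (recip (fromℕ (suc (2 ℕ.* i)))) (<⇒≤ (recip-odd-pos i)) (^ℚ-mono (suc (2 ℕ.* i)))

-- log (log n) is a positive real exactly when n ≥ 3.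
module _ (n : ℕ) (3≤n : 3 ℕ.≤ n) where

  3≤⇒0< : 0 ℕ.< n
  3≤⇒0< = ℕ.≤-trans (ℕ.s≤s ℕ.z≤n) 3≤n

  3≤⇒0<log : 0ᴿ <ᴿ logℕ n 3≤⇒0<
  3≤⇒0<log = logℕ-pos n 3≤⇒0< (ℕ.≤-trans (ℕ.s≤s (ℕ.s≤s ℕ.z≤n)) 3≤n)

  loglog : ℝ
  loglog = log (logℕ n 3≤⇒0<) 3≤⇒0<log

  loglog-pos : 0ᴿ <ᴿ loglog
  loglog-pos = log-pos 3≤⇒0<log (logℕ>1 n 3≤⇒0< 3≤n)

  log/loglog : ℝ
  log/loglog = logℕ n 3≤⇒0< ÷ᴿ loglog [ loglog-pos ]

primeDivisors : ℕ → List ℕ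
primeDivisors n = filter (λ p → prime? p ×-dec (p ∣? n)) (upTo (suc n))

ω : ℕ → ℕ
ω n = length (primeDivisors n)

γ : ℕ → ℕ
γ n = product (primeDivisors n)

primeDivisors-prime : ∀ n → All Prime (primeDivisors n)
primeDivisors-prime n = All.map proj₁ (all-filter (λ p → prime? p ×-dec (p ∣? n)) (upTo (suc n)))

product-pos : ∀ {ps} → All Prime ps → 0 ℕ.< product ps
product-pos []         = ℕ.s≤s ℕ.z≤n
product-pos (hp ∷ hps) = ℕ.*-mono-≤ (ℕ.>-nonZero⁻¹ _ {{prime⇒nonZero hp}}) (product-pos hps)

length≡0⊎2≤product : ∀ {ps} → All Prime ps → length ps ≡ 0 ⊎ 2 ℕ.≤ product ps
length≡0⊎2≤product []         = inj₁ refl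
length≡0⊎2≤product (hp ∷ hps) =
  inj₂ (ℕ.*-mono-≤ (ℕ.nonTrivial⇒n>1 _ {{prime⇒nonTrivial hp}}) (product-pos hps))

logℕ^-pos : ∀ m (0<m : 0 ℕ.< m) k → k ≡ 0 ⊎ 2 ℕ.≤ m → 0ᴿ <ᴿ logℕ m 0<m ^ᴿ k
logℕ^-pos m 0<m .0 (inj₁ refl) = 1ᴿ-pos
logℕ^-pos m 0<m k  (inj₂ 2≤m)  = ^ᴿ-pos (logℕ-pos m 0<m 2≤m) k

γ-pos : ∀ n → 0 ℕ.< γ n
γ-pos n = product-pos {primeDivisors n} (primeDivisors-prime n)

-- For n = 1 this is 0 ^ 0 = 1.
logγ^ω : ℕ → ℝ
logγ^ω n = logℕ (γ n) (γ-pos n) ^ᴿ ω n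

logγ^ω-pos : ∀ n → 0ᴿ <ᴿ logγ^ω n
logγ^ω-pos n =
  logℕ^-pos (γ n) (γ-pos n) (ω n) (length≡0⊎2≤product {primeDivisors n} (primeDivisors-prime n))

H : ℕ → ℝ
H n = ιℕ (γ n) ÷ᴿ logγ^ω n [ logγ^ω-pos n ]

H-pos : ∀ n → 0ᴿ <ᴿ H n
H-pos n = *ᴿ-pos (ιℕ-pos (γ n) (γ-pos n))
  (inv-pos (logγ^ω-pos n))

W : ℕ → ℕ → ℕ
W x y = sum (map (λ j → ω (x ℕ.+ suc j)) (upTo y))

Conjecture1 : Set
Conjecture1 = ∀ ε → 0ᴿ <ᴿ ε → ∃[ C ] ∀ a b c → 0 ℕ.< a → 0 ℕ.< b → 0 ℕ.< c →
  gcd (gcd a b) c ≡ 1 → a ℕ.+ b ≡ c →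
  let n = a ℕ.* b ℕ.* c in ιℕ c <ᴿ C *ᴿ H n ^[ H-pos n ] (1ᴿ +ᴿ ε)

{-# OPTIONS --safe #-}

-- Let A and B be the products of (n + e)^C(i+1,e) over the even and the odd e ≤ i + 1, where n = x + 1.
-- Since log (A / B) is up to sign an iterated difference of log, the polynomial D = A - B has degree at
-- most d - (i + 1), where d = 2^i is the degree of A and B.  The common divisors of A and B are bounded
-- because those of n + e and n + o are, so A, B and D are up to a bounded factor an abc triple with
-- c ≫ x^d and γ(abc) ≪ x^(d+1), and abc is divisible by every large prime counted by W(x,y), where y = i.
-- If A = B there are no large primes at all.  With ε = 1/j, Conjecture 1 bounds (log γ)^W by
-- x^(1+O(1/j)); as x ≤ γ^(j+1), log γ may be replaced by log x.  On the other hand, if W exceeds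
-- (1 + 1/k) log x / log log x, then x^(1+1/k) ≤ (log x)^W.  For j large in terms of k and d these
-- inequalities are incompatible.
--
-- The power series are related as follows.  The function exp (2 artanh z) (1 - z) / (1 + z) changes by
-- O(h²) over an interval of length h, hence is constant, hence exp (log x) = x.  All estimates are made
-- for rational arguments and partial sums, uniformly in the argument.

module Submission where

open import Defs

-- The exponent d + 1 arises as follows: only the i + 2 numbers n + e with e ≤ i + 1 occur in A and
-- B, so the radical of AB is O(x^(i+2)), and D contributes O(x^(d-i-1)). That D has such a low
-- degree is inherited along i through D(i+1, n) = D(i, n) B(i, n+1) - B(i, n) D(i, n+1), in which
-- the leading terms cancel once more. The form of the argument is dictated by reals being sequences
-- and by `≤ᴿ` being a negation: the reverse strict inequality is refuted at a single late index,
-- where only rationals and integer powers occur. Hence logarithms are removed by exponentiation and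
-- the exponent 1 + 1/j by a j-th power. Since exp and log are inverse only in the limit, every
-- passage leaves a tolerance. Tolerances and constants are finally absorbed by spare factors x or
-- log x, and the bookkeeping of exponents at the end counts these factors.

module Analysis where

  open import Data.Empty using (⊥; ⊥-elim)
  import Data.Integer as ℤ
  open import Data.Nat as ℕ using (ℕ; zero; suc)
  import Data.Nat.Properties as ℕ
  open import Data.Product using (∃-syntax; _×_; _,_; proj₁; proj₂)
  open import Data.Rational renaming (∣_∣ to abs)
  open import Data.Rational.Properties
  open import Data.Rational.Solver using (module +-*-Solver)
  open import Data.Sum using (inj₁; inj₂; [_,_]′)
  open import Relation.Binary.PropositionalEquality hiding (J)
  open +-*-Solver

  -- Cauchy products and the functional equation of the exponential series.

  ¼ : ℚ
  ¼ = ½ * ½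

  abs-+≤ : ∀ {p q a b} → abs p ≤ a → abs q ≤ b → abs (p + q) ≤ a + b
  abs-+≤ {p} {q} hp hq = ≤-trans (∣p+q∣≤∣p∣+∣q∣ p q) (+-mono-≤ hp hq)

  abs-*≤ : ∀ {p q a b} → abs p ≤ a → abs q ≤ b → abs (p * q) ≤ a * b
  abs-*≤ {p} {q} {a} {b} hp hq = subst (_≤ a * b) (sym (∣p*q∣≡∣p∣*∣q∣ p q))
    (*-mono (abs-nonneg p) (abs-nonneg q) hp hq)

  Σ<-cong : ∀ {s t} → (∀ i → s i ≡ t i) → ∀ n → Σ< n s ≡ Σ< n t
  Σ<-cong h zero    = refl
  Σ<-cong h (suc n) = cong₂ _+_ (Σ<-cong h n) (h n)

  Σ<-head : ∀ n t → Σ< (suc n) t ≡ t 0 + Σ< n (λ i → t (suc i))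
  Σ<-head zero    t = +-comm 0ℚ (t 0)
  Σ<-head (suc n) t = trans (cong (_+ t (suc n)) (Σ<-head n t)) (+-assoc (t 0) _ _)

  Σ<-abs≤ : ∀ {t b} → (∀ i → abs (t i) ≤ b i) → ∀ n → abs (Σ< n t) ≤ Σ< n b
  Σ<-abs≤ h zero    = ≤-refl
  Σ<-abs≤ {t} h (suc n) = abs-+≤ {Σ< n t} (Σ<-abs≤ h n) (h n)

  -- Coefficient of the Cauchy product of two power series. Peeling off `u 0` and shifting `u` keeps
  -- inductions free of index subtraction.
  conv : (ℕ → ℚ) → (ℕ → ℚ) → ℕ → ℚ
  conv u v zero    = u 0 * v 0
  conv u v (suc n) = u 0 * v (suc n) + conv (λ i → u (suc i)) v n

  conv-cong : ∀ {u u′ v v′} → (∀ i → u i ≡ u′ i) → (∀ i → v i ≡ v′ i) → ∀ n → conv u v n ≡ conv u′ v′ n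
  conv-cong hu hv zero    = cong₂ _*_ (hu 0) (hv 0)
  conv-cong hu hv (suc n) = cong₂ _+_ (cong₂ _*_ (hu 0) (hv (suc n))) (conv-cong (λ i → hu (suc i)) hv n)

  conv-+ˡ : ∀ u u′ v n → conv (λ i → u i + u′ i) v n ≡ conv u v n + conv u′ v n
  conv-+ˡ u u′ v zero    = *-distribʳ-+ (v 0) (u 0) (u′ 0)
  conv-+ˡ u u′ v (suc n) = trans (cong ((u 0 + u′ 0) * v (suc n) +_) (conv-+ˡ _ _ v n))
    (solve 5 (λ a b c d e → (a :+ b) :* c :+ (d :+ e) := a :* c :+ d :+ (b :* c :+ e)) refl
      (u 0) (u′ 0) (v (suc n)) (conv (λ i → u (suc i)) v n) (conv (λ i → u′ (suc i)) v n))

  conv-*ˡ : ∀ c u v n → conv (λ i → c * u i) v n ≡ c * conv u v n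
  conv-*ˡ c u v zero    = *-assoc c (u 0) (v 0)
  conv-*ˡ c u v (suc n) = trans (cong (c * u 0 * v (suc n) +_) (conv-*ˡ c _ v n))
    (solve 4 (λ c a b d → c :* a :* b :+ c :* d := c :* (a :* b :+ d)) refl c (u 0) (v (suc n)) (conv (λ i → u (suc i)) v n))

  conv-*ʳ : ∀ c u v n → conv u (λ i → c * v i) n ≡ c * conv u v n
  conv-*ʳ c u v zero    = solve 3 (λ c a b → a :* (c :* b) := c :* (a :* b)) refl c (u 0) (v 0)
  conv-*ʳ c u v (suc n) = trans (cong (u 0 * (c * v (suc n)) +_) (conv-*ʳ c _ v n))
    (solve 4 (λ c a b d → a :* (c :* b) :+ c :* d := c :* (a :* b :+ d)) refl c (u 0) (v (suc n)) (conv (λ i → u (suc i)) v n))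

  -- Coefficients of the formal derivative of a power series.
  deriv : (ℕ → ℚ) → ℕ → ℚ
  deriv u i = fromℕ (suc i) * u (suc i)

  deriv-shift : ∀ u i → deriv u (suc i) ≡ deriv (λ j → u (suc j)) i + u (suc (suc i))
  deriv-shift u i = trans (cong (_* u (suc (suc i))) (fromℕ-suc (suc i)))
    (solve 2 (λ k a → (con 1ℚ :+ k) :* a := k :* a :+ a) refl (fromℕ (suc i)) (u (suc (suc i))))

  -- Product rule for formal power series, read off at one coefficient. It takes the place of the
  -- binomial theorem: through it, the coefficients of a product of exponentials satisfy a
  -- first-order recursion.
  leibniz : ∀ n u v → fromℕ (suc n) * conv u v (suc n) ≡ conv (deriv u) v n + conv u (deriv v) n
  leibniz zero u v = solve 4 (λ a b c d → con 1ℚ :* (a :* d :+ c :* b) := con 1ℚ :* c :* b :+ a :* (con 1ℚ :* d)) refl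
    (u 0) (v 0) (u 1) (v 1)
  leibniz (suc n) u v = begin
    fromℕ (suc (suc n)) * (u 0 * v (suc (suc n)) + X)
      ≡⟨ cong (_* (u 0 * v (suc (suc n)) + X)) (fromℕ-suc (suc n)) ⟩
    (1ℚ + k) * (u 0 * v (suc (suc n)) + X)
      ≡⟨ solve 4 (λ k a b x → (con 1ℚ :+ k) :* (a :* b :+ x) := a :* ((con 1ℚ :+ k) :* b) :+ (x :+ k :* x)) refl
           k (u 0) (v (suc (suc n))) X ⟩
    u 0 * ((1ℚ + k) * v (suc (suc n))) + (X + k * X)
      ≡⟨ cong₂ (λ a b → u 0 * (a * v (suc (suc n))) + (X + b)) (sym (fromℕ-suc (suc n))) (leibniz n Su v) ⟩
    u 0 * deriv v (suc n) + (u 1 * v (suc n) + Y + (Z + V))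
      ≡⟨ solve 6 (λ a b c y z w → a :+ (b :* c :+ y :+ (z :+ w)) := con 1ℚ :* b :* c :+ (z :+ y) :+ (a :+ w)) refl
           (u 0 * deriv v (suc n)) (u 1) (v (suc n)) Y Z V ⟩
    1ℚ * u 1 * v (suc n) + (Z + Y) + (u 0 * deriv v (suc n) + V)
      ≡⟨ cong (λ a → 1ℚ * u 1 * v (suc n) + a + (u 0 * deriv v (suc n) + V))
           (trans (sym (conv-+ˡ (deriv Su) SSu v n)) (conv-cong (λ i → sym (deriv-shift u i)) (λ _ → refl) n)) ⟩
    conv (deriv u) v (suc n) + conv u (deriv v) (suc n) ∎
    where
    open ≡-Reasoning
    k = fromℕ (suc n)
    Su SSu : ℕ → ℚ
    Su i = u (suc i)
    SSu i = u (suc (suc i))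
    X = conv Su v (suc n)
    Y = conv SSu v n
    Z = conv (deriv Su) v n
    V = conv Su (deriv v) n

  exps : ℚ → ℕ → ℚ
  exps p i = expTerm i p

  deriv-exps : ∀ p i → deriv (exps p) i ≡ p * exps p i
  deriv-exps p i = begin
    k * (p * p ^ℚ i * recip (fromℕ (suc i ℕ.!)))
      ≡⟨ cong (λ a → k * (p * p ^ℚ i * a)) (recip!-suc i) ⟩
    k * (p * p ^ℚ i * (recip k * c))
      ≡⟨ solve 5 (λ k p x a c → k :* (p :* x :* (a :* c)) := k :* a :* (p :* (x :* c))) refl k p (p ^ℚ i) (recip k) c ⟩
    k * recip k * (p * (p ^ℚ i * c))
      ≡⟨ trans (cong (_* (p * (p ^ℚ i * c))) (recip-inverse (fromℕ-pos i))) (*-identityˡ (p * (p ^ℚ i * c))) ⟩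
    p * exps p i ∎
    where
    open ≡-Reasoning
    k = fromℕ (suc i)
    c = recip (fromℕ (i ℕ.!))

  *-cancelˡ-fromℕ : ∀ n {p q} → fromℕ (suc n) * p ≡ fromℕ (suc n) * q → p ≡ q
  *-cancelˡ-fromℕ n {p} {q} h = trans (sym (un p)) (trans (cong (recip k *_) h) (un q))
    where
    k = fromℕ (suc n)
    un : ∀ a → recip k * (k * a) ≡ a
    un a = trans (solve 3 (λ r k a → r :* (k :* a) := k :* r :* a) refl (recip k) k a)
      (trans (cong (_* a) (recip-inverse (fromℕ-pos n))) (*-identityˡ a))

  -- Both sides satisfy (n + 1) a(n+1) = (p + q) a(n) with the same initial value, by `leibniz` and
  -- `deriv-exps`.
  conv-exps : ∀ p q n → conv (exps p) (exps q) n ≡ exps (p + q) n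
  conv-exps p q zero    = refl
  conv-exps p q (suc n) = *-cancelˡ-fromℕ n (begin
    fromℕ (suc n) * conv (exps p) (exps q) (suc n)
      ≡⟨ leibniz n (exps p) (exps q) ⟩
    conv (deriv (exps p)) (exps q) n + conv (exps p) (deriv (exps q)) n
      ≡⟨ cong₂ _+_
           (trans (conv-cong (deriv-exps p) (λ _ → refl) n) (conv-*ˡ p (exps p) (exps q) n))
           (trans (conv-cong (λ _ → refl) (deriv-exps q) n) (conv-*ʳ q (exps p) (exps q) n)) ⟩
    p * c + q * c
      ≡⟨ *-distribʳ-+ c p q ⟨
    (p + q) * c
      ≡⟨ cong ((p + q) *_) (conv-exps p q n) ⟩
    (p + q) * exps (p + q) n
      ≡⟨ deriv-exps (p + q) n ⟨
    fromℕ (suc n) * exps (p + q) (suc n) ∎)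
    where
    open ≡-Reasoning
    c = conv (exps p) (exps q) n

  -- The part of the Cauchy square lying beyond the n-th antidiagonal.
  overshoot : ℕ → (ℕ → ℚ) → (ℕ → ℚ) → ℚ
  overshoot zero    u v = 0ℚ
  overshoot (suc n) u v = overshoot n (λ i → u (suc i)) v + Σ< n (λ i → u (suc i)) * v n

  Σ<-conv : ∀ n u v → Σ< n u * Σ< n v ≡ Σ< n (conv u v) + overshoot n u v
  Σ<-conv zero    u v = refl
  Σ<-conv (suc n) u v = begin
    Σ< (suc n) u * Σ< (suc n) v
      ≡⟨ cong (_* Σ< (suc n) v) (Σ<-head n u) ⟩
    (u 0 + U) * (V + v n)
      ≡⟨ solve 4 (λ a U V b → (a :+ U) :* (V :+ b) := a :* (V :+ b) :+ (U :* V :+ U :* b)) refl (u 0) U V (v n) ⟩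
    u 0 * (V + v n) + (U * V + U * v n)
      ≡⟨ cong (λ a → u 0 * (V + v n) + (a + U * v n)) (Σ<-conv n Su v) ⟩
    u 0 * (V + v n) + (Σ< n (conv Su v) + overshoot n Su v + U * v n)
      ≡⟨ solve 4 (λ a b c d → a :+ (b :+ c :+ d) := a :+ b :+ (c :+ d)) refl (u 0 * (V + v n)) (Σ< n (conv Su v)) (overshoot n Su v) (U * v n) ⟩
    u 0 * (V + v n) + Σ< n (conv Su v) + overshoot (suc n) u v
      ≡⟨ cong (_+ overshoot (suc n) u v) (antidiagonals n) ⟨
    Σ< (suc n) (conv u v) + overshoot (suc n) u v ∎
    where
    open ≡-Reasoning
    Su : ℕ → ℚ
    Su i = u (suc i)
    U = Σ< n Su
    V = Σ< n v
    antidiagonals : ∀ m → Σ< (suc m) (conv u v) ≡ u 0 * Σ< (suc m) v + Σ< m (conv Su v)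
    antidiagonals zero    = solve 2 (λ a b → con 0ℚ :+ a :* b := a :* (con 0ℚ :+ b) :+ con 0ℚ) refl (u 0) (v 0)
    antidiagonals (suc m) = trans (cong (_+ conv u v (suc m)) (antidiagonals m))
      (solve 5 (λ a V b c d → a :* V :+ c :+ (a :* b :+ d) := a :* (V :+ b) :+ (c :+ d)) refl
        (u 0) (Σ< (suc m) v) (v (suc m)) (Σ< m (conv Su v)) (conv Su v m))

  Σ<-geometric : ∀ K n → Σ< n (λ i → K * ½ ^ℚ suc i) ≡ K - K * ½ ^ℚ n
  Σ<-geometric K zero    = solve 1 (λ K → con 0ℚ := K :- K :* con 1ℚ) refl K
  Σ<-geometric K (suc n) = trans (cong (_+ K * ½ ^ℚ suc n) (Σ<-geometric K n))
    (solve 2 (λ K x → K :- K :* x :+ K :* (con ½ :* x) := K :- K :* (con ½ :* x)) refl K (½ ^ℚ n))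

  -- The term - 4 * ¼ ^ n makes the bound reproduce itself under the recursion for overshoot.
  overshoot-bound : ∀ {L} → 0ℚ ≤ L → ∀ n {K u v} → 0ℚ ≤ K →
    (∀ i → abs (u i) ≤ K * ½ ^ℚ i) → (∀ i → abs (v i) ≤ L * ¼ ^ℚ i) →
    abs (overshoot n u v) ≤ K * L * (fromℕ 4 * ½ ^ℚ n - fromℕ 4 * ¼ ^ℚ n)
  overshoot-bound {L} 0≤L zero {K} 0≤K hu hv =
    ≤-reflexive (solve 2 (λ K L → con 0ℚ := K :* L :* (con (fromℕ 4) :* con 1ℚ :- con (fromℕ 4) :* con 1ℚ)) refl K L)
  overshoot-bound {L} 0≤L (suc n) {K} {u} {v} 0≤K hu hv = begin
    abs (overshoot n Su v + Σ< n Su * v n)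
      ≤⟨ abs-+≤ {overshoot n Su v} {Σ< n Su * v n}
           (overshoot-bound 0≤L n 0≤½K (λ i → ≤-trans (hu (suc i)) (≤-reflexive
             (solve 2 (λ K x → K :* (con ½ :* x) := con ½ :* K :* x) refl K (½ ^ℚ i)))) hv)
           (abs-*≤ {Σ< n Su} {v n} ΣSu≤K (hv n)) ⟩
    ½ * K * L * (fromℕ 4 * x - fromℕ 4 * y) + K * (L * y)
      ≡⟨ solve 4 (λ K L x y → con ½ :* K :* L :* (con (fromℕ 4) :* x :- con (fromℕ 4) :* y) :+ K :* (L :* y)
           := K :* L :* (con (fromℕ 4) :* (con ½ :* x) :- con (fromℕ 4) :* (con ¼ :* y))) refl K L x y ⟩
    K * L * (fromℕ 4 * (½ * x) - fromℕ 4 * (¼ * y)) ∎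
    where
    open ≤-Reasoning
    x = ½ ^ℚ n
    y = ¼ ^ℚ n
    Su : ℕ → ℚ
    Su i = u (suc i)
    0≤½K = *-nonneg (<⇒≤ 0<½) 0≤K
    ΣSu≤K : abs (Σ< n Su) ≤ K
    ΣSu≤K = ≤-trans (Σ<-abs≤ (λ i → hu (suc i)) n) (≤-trans (≤-reflexive (Σ<-geometric K n))
      (0≤-⇒≤ (subst (0ℚ ≤_) (solve 2 (λ K x → K :* x := K :- (K :- K :* x)) refl K x)
        (*-nonneg 0≤K (^ℚ-nonneg (<⇒≤ 0<½) n)))))

  -- Powers, and uniform estimates for the partial sums of exp.

  ^ℚ-mono : ∀ {p q} → 0ℚ ≤ p → p ≤ q → ∀ n → p ^ℚ n ≤ q ^ℚ n
  ^ℚ-mono 0≤p p≤q zero    = ≤-refl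
  ^ℚ-mono 0≤p p≤q (suc n) = *-mono 0≤p (^ℚ-nonneg 0≤p n) p≤q (^ℚ-mono 0≤p p≤q n)

  ^ℚ-+ : ∀ q m n → q ^ℚ (m ℕ.+ n) ≡ q ^ℚ m * q ^ℚ n
  ^ℚ-+ q zero    n = sym (*-identityˡ (q ^ℚ n))
  ^ℚ-+ q (suc m) n = trans (cong (q *_) (^ℚ-+ q m n)) (sym (*-assoc q (q ^ℚ m) (q ^ℚ n)))

  ^ℚ-* : ∀ q m n → q ^ℚ (m ℕ.* n) ≡ (q ^ℚ n) ^ℚ m
  ^ℚ-* q zero    n = refl
  ^ℚ-* q (suc m) n = trans (^ℚ-+ q n (m ℕ.* n)) (cong (q ^ℚ n *_) (^ℚ-* q m n))

  1≤^ℚ : ∀ {q} → 1ℚ ≤ q → ∀ n → 1ℚ ≤ q ^ℚ n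
  1≤^ℚ {q} h n = subst (_≤ q ^ℚ n) (1^ℚ n) (^ℚ-mono (<⇒≤ 0<1) h n)

  ^ℚ-monoʳ : ∀ {q} → 1ℚ ≤ q → ∀ {m n} → m ℕ.≤ n → q ^ℚ m ≤ q ^ℚ n
  ^ℚ-monoʳ h {n = n} ℕ.z≤n = 1≤^ℚ h n
  ^ℚ-monoʳ {q} h (ℕ.s≤s m≤n) = *-monoʳ q (≤-trans (<⇒≤ 0<1) h) (^ℚ-monoʳ h m≤n)

  ^ℚ-antitone : ∀ {ρ} → 0ℚ ≤ ρ → ρ ≤ 1ℚ → ∀ {m n} → m ℕ.≤ n → ρ ^ℚ n ≤ ρ ^ℚ m
  ^ℚ-antitone {ρ} 0≤ρ ρ≤1 {n = n} ℕ.z≤n = subst (ρ ^ℚ n ≤_) (1^ℚ n) (^ℚ-mono 0≤ρ ρ≤1 n)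
  ^ℚ-antitone {ρ} 0≤ρ ρ≤1 (ℕ.s≤s m≤n) = *-monoʳ ρ 0≤ρ (^ℚ-antitone 0≤ρ ρ≤1 m≤n)

  ½<1 : ½ < 1ℚ
  ½<1 = *<* (ℤ.+<+ (ℕ.s≤s (ℕ.s≤s ℕ.z≤n)))

  0≤½ : 0ℚ ≤ ½
  0≤½ = <⇒≤ 0<½

  0≤1 : 0ℚ ≤ 1ℚ
  0≤1 = <⇒≤ 0<1

  0≤2 : 0ℚ ≤ 2ℚ
  0≤2 = <⇒≤ 0<2

  0≤¼ : 0ℚ ≤ ¼
  0≤¼ = *-nonneg 0≤½ 0≤½

  ¼≤½ : ¼ ≤ ½
  ¼≤½ = *≤* (ℤ.+≤+ (ℕ.s≤s (ℕ.s≤s ℕ.z≤n)))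

  ≤-+ʳ : ∀ {p q r} → p ≤ q → 0ℚ ≤ r → p ≤ q + r
  ≤-+ʳ {p} {q} {r} h 0≤r = subst (_≤ q + r) (+-identityʳ p) (+-mono-≤ h 0≤r)

  ≤1*⇒ : ∀ {p q} → 0ℚ ≤ q → p ≤ 1ℚ → p * q ≤ q
  ≤1*⇒ {p} {q} 0≤q h = subst (p * q ≤_) (*-identityˡ q) (*-monoˡ q 0≤q h)

  geometric-eventually : ∀ {K ρ} → 0ℚ ≤ K → 0ℚ ≤ ρ → ρ < 1ℚ → ∀ {η} → 0ℚ < η →
    Eventually (λ n → K * ρ ^ℚ n ≤ η)
  geometric-eventually {K} 0≤K 0≤ρ ρ<1 0<η = let N , small = geometric-null 0≤K 0≤ρ ρ<1 0<η in
    N , λ n N≤n → ≤-trans (*-monoʳ K 0≤K (^ℚ-antitone 0≤ρ (<⇒≤ ρ<1) N≤n)) small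

  E : ℕ → ℚ → ℚ
  E n p = Σ< n (exps p)

  -- The terms at 4R are bounded, since factorials outgrow powers, and dividing by 4^i gives the
  -- decay. The rate ¼ is what `overshoot-bound` asks of its second factor, faster than the ½ asked
  -- of the first.
  exps-decay : ∀ {R} → 0ℚ ≤ R → ∃[ K ] 0ℚ ≤ K × (∀ {p} → abs p ≤ R → ∀ i → abs (exps p i) ≤ K * ¼ ^ℚ i)
  exps-decay {R} 0≤R = let K , 0≤K , hK = expTerm-bounded (*-nonneg (fromℕ-nonneg 4) 0≤R) in
    K , 0≤K , λ {p} hp i → let c = recip (fromℕ (i ℕ.!)) ; 0≤c = <⇒≤ (recip!-pos i) in begin
    abs (p ^ℚ i * c)                    ≤⟨ abs-*≤ {p ^ℚ i} {c} (abs-^ℚ hp i) (≤-reflexive (0≤p⇒∣p∣≡p 0≤c)) ⟩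
    R ^ℚ i * c                          ≡⟨ cong (_* c) (*-identityˡ (R ^ℚ i)) ⟨
    1ℚ * R ^ℚ i * c                     ≡⟨ cong (λ a → a * R ^ℚ i * c) (trans (sym (^ℚ-distrib-* ¼ (fromℕ 4) i)) (1^ℚ i)) ⟨
    ¼ ^ℚ i * fromℕ 4 ^ℚ i * R ^ℚ i * c  ≡⟨ solve 4 (λ x y z c → x :* y :* z :* c := y :* z :* c :* x) refl (¼ ^ℚ i) (fromℕ 4 ^ℚ i) (R ^ℚ i) c ⟩
    fromℕ 4 ^ℚ i * R ^ℚ i * c * ¼ ^ℚ i  ≡⟨ cong (λ a → a * c * ¼ ^ℚ i) (^ℚ-distrib-* (fromℕ 4) R i) ⟨
    expTerm i (fromℕ 4 * R) * ¼ ^ℚ i    ≤⟨ *-monoˡ (¼ ^ℚ i) (^ℚ-nonneg 0≤¼ i) (hK i) ⟩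
    K * ¼ ^ℚ i                          ∎
    where open ≤-Reasoning

  exps-decay½ : ∀ {K x i} → 0ℚ ≤ K → abs x ≤ K * ¼ ^ℚ i → abs x ≤ K * ½ ^ℚ i
  exps-decay½ {K} {i = i} 0≤K h = ≤-trans h (*-monoʳ K 0≤K (^ℚ-mono 0≤¼ ¼≤½ i))

  E-bounded : ∀ {R} → 0ℚ ≤ R → ∃[ M ] 0ℚ ≤ M × (∀ {p} → abs p ≤ R → ∀ n → abs (E n p) ≤ M)
  E-bounded {R} 0≤R = let K , 0≤K , hK = exps-decay 0≤R in 2ℚ * K , *-nonneg 0≤2 0≤K , λ hp n →
    ≤-trans (Σ<-abs≤ (λ i → exps-decay½ {i = i} 0≤K (hK hp i)) n) (bound 0≤K n)
    where
    bound : ∀ {K} → 0ℚ ≤ K → ∀ n → Σ< n (λ i → K * ½ ^ℚ i) ≤ 2ℚ * K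
    bound {K} 0≤K n = ≤-trans (≤-reflexive (trans
        (Σ<-cong (λ i → solve 2 (λ K x → K :* x := con 2ℚ :* K :* (con ½ :* x)) refl K (½ ^ℚ i)) n)
        (Σ<-geometric (2ℚ * K) n)))
      (0≤-⇒≤ (subst (0ℚ ≤_) (solve 2 (λ K x → K :* x := K :- (K :- K :* x)) refl (2ℚ * K) (½ ^ℚ n))
        (*-nonneg (*-nonneg 0≤2 0≤K) (^ℚ-nonneg 0≤½ n))))

  -- By `conv-exps` the first n antidiagonals add up to `E n (p + q)` exactly, so the defect is the
  -- overshoot alone. Its bound depends on p and q only through `R`.
  E-mult : ∀ {R} → 0ℚ ≤ R → ∀ {η} → 0ℚ < η → Eventually (λ n → ∀ p q → abs p ≤ R → abs q ≤ R →
    abs (E n p * E n q - E n (p + q)) ≤ η)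
  E-mult {R} 0≤R {η} 0<η = let K , 0≤K , hK = exps-decay 0≤R in eventually-map
    (λ {n} small p q hp hq → begin
      abs (E n p * E n q - E n (p + q))
        ≡⟨ cong abs (trans (cong₂ _-_ (Σ<-conv n (exps p) (exps q)) (Σ<-cong (λ i → sym (conv-exps p q i)) n))
             (solve 2 (λ a b → a :+ b :- a := b) refl (Σ< n (conv (exps p) (exps q))) (overshoot n (exps p) (exps q)))) ⟩
      abs (overshoot n (exps p) (exps q))
        ≤⟨ overshoot-bound 0≤K n 0≤K (λ i → exps-decay½ {i = i} 0≤K (hK hp i)) (hK hq) ⟩
      K * K * (fromℕ 4 * ½ ^ℚ n - fromℕ 4 * ¼ ^ℚ n)
        ≤⟨ 0≤-⇒≤ (subst (0ℚ ≤_) (solve 4 (λ K f x y → K :* K :* f :* y := K :* K :* f :* x :- K :* K :* (f :* x :- f :* y))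
             refl K (fromℕ 4) (½ ^ℚ n) (¼ ^ℚ n)) (*-nonneg (0≤C 0≤K) (^ℚ-nonneg 0≤¼ n))) ⟩
      K * K * fromℕ 4 * ½ ^ℚ n
        ≤⟨ small ⟩
      η ∎)
    (geometric-eventually (0≤C 0≤K) 0≤½ ½<1 0<η)
    where
    open ≤-Reasoning
    0≤C : ∀ {K} → 0ℚ ≤ K → 0ℚ ≤ K * K * fromℕ 4
    0≤C 0≤K = *-nonneg (*-nonneg 0≤K 0≤K) (fromℕ-nonneg 4)

  1≤E : ∀ {p n} → 0ℚ ≤ p → 1 ℕ.≤ n → 1ℚ ≤ E n p
  1≤E 0≤p 1≤n = term≤Σ< (expTerm-nonneg 0≤p) 1≤n

  E-nonneg : ∀ {p} n → 0ℚ ≤ p → 0ℚ ≤ E n p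
  E-nonneg {p} n 0≤p = Σ<-mono (expTerm-nonneg 0≤p) {0} {n} ℕ.z≤n

  1+p≤E : ∀ {p n} → 0ℚ ≤ p → 2 ℕ.≤ n → 1ℚ + p ≤ E n p
  1+p≤E {p} 0≤p 2≤n = ≤-trans
    (≤-reflexive (solve 1 (λ p → con 1ℚ :+ p := con 0ℚ :+ con 1ℚ :* con 1ℚ :+ p :* con 1ℚ :* con 1ℚ) refl p))
    (Σ<-mono (expTerm-nonneg 0≤p) 2≤n)

  1≤fromℕ-suc : ∀ n → 1ℚ ≤ fromℕ (suc n)
  1≤fromℕ-suc n = fromℕ-mono {1} {suc n} (ℕ.s≤s ℕ.z≤n)

  -- Truncated form of exp p ≤ 1 / (1 - p): each term after the first is at most p times its
  -- predecessor, so E ≤ 1 + p E.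
  E*[1-p]≤1 : ∀ {p} → 0ℚ ≤ p → ∀ n → E n p * (1ℚ - p) ≤ 1ℚ
  E*[1-p]≤1 {p} 0≤p n = 0≤-⇒≤ (subst (0ℚ ≤_)
    (solve 2 (λ e p → con 1ℚ :+ p :* e :- e := con 1ℚ :- e :* (con 1ℚ :- p)) refl (E n p) p)
    (≤⇒0≤- (begin
      E n p                                        ≤⟨ Σ<-mono (expTerm-nonneg 0≤p) (ℕ.n≤1+n n) ⟩
      E (suc n) p                                  ≡⟨ Σ<-head n (exps p) ⟩
      1ℚ * 1ℚ + Σ< n (λ i → exps p (suc i))        ≤⟨ +-monoʳ-≤ 1ℚ (tail n) ⟩
      1ℚ + p * E n p                               ∎)))
    where
    open ≤-Reasoning
    term : ∀ i → exps p (suc i) ≤ p * exps p i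
    term i = begin
      exps p (suc i)                     ≡⟨ *-identityˡ (exps p (suc i)) ⟨
      1ℚ * exps p (suc i)                ≤⟨ *-monoˡ (exps p (suc i)) (expTerm-nonneg 0≤p (suc i)) (1≤fromℕ-suc i) ⟩
      fromℕ (suc i) * exps p (suc i)     ≡⟨ deriv-exps p i ⟩
      p * exps p i                       ∎
    tail : ∀ n → Σ< n (λ i → exps p (suc i)) ≤ p * E n p
    tail zero    = ≤-reflexive (sym (*-zeroʳ p))
    tail (suc n) = ≤-trans (+-mono-≤ (tail n) (term n)) (≤-reflexive (sym (*-distribˡ-+ p (E n p) (exps p n))))

  -- Increments of the partial sums of artanh.

  A : ℕ → ℚ → ℚ
  A n z = Σ< n (λ i → artanhTerm i z)

  power-increment≤ : ∀ {z w} → 0ℚ ≤ z → z ≤ w → ∀ k → w ^ℚ suc k - z ^ℚ suc k ≤ (w - z) * (fromℕ (suc k) * w ^ℚ k)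
  power-increment≤ {z} {w} 0≤z z≤w k = ≤-trans (≤abs (w ^ℚ suc k - z ^ℚ suc k))
    (≤-trans (^ℚ-lipschitz (≤-reflexive (0≤p⇒∣p∣≡p (≤-trans 0≤z z≤w))) (≤-trans (≤-reflexive (0≤p⇒∣p∣≡p 0≤z)) z≤w) k)
      (≤-reflexive (cong (_* (fromℕ (suc k) * w ^ℚ k)) (0≤p⇒∣p∣≡p (≤⇒0≤- z≤w)))))

  power-increment≥ : ∀ {z w} → 0ℚ ≤ z → z ≤ w → ∀ k → (w - z) * (fromℕ (suc k) * z ^ℚ k) ≤ w ^ℚ suc k - z ^ℚ suc k
  power-increment≥ {z} {w} 0≤z z≤w zero = ≤-reflexive
    (solve 2 (λ z w → (w :- z) :* (con 1ℚ :* con 1ℚ) := w :* con 1ℚ :- z :* con 1ℚ) refl z w)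
  power-increment≥ {z} {w} 0≤z z≤w (suc k) = begin
    (w - z) * (fromℕ (suc (suc k)) * (z * z ^ℚ k))
      ≡⟨ cong (λ a → (w - z) * (a * (z * z ^ℚ k))) (fromℕ-suc (suc k)) ⟩
    (w - z) * ((1ℚ + fromℕ (suc k)) * (z * z ^ℚ k))
      ≡⟨ solve 4 (λ h k z x → h :* ((con 1ℚ :+ k) :* (z :* x)) := z :* (h :* (k :* x)) :+ h :* (z :* x)) refl (w - z) (fromℕ (suc k)) z (z ^ℚ k) ⟩
    z * ((w - z) * (fromℕ (suc k) * z ^ℚ k)) + (w - z) * z ^ℚ suc k
      ≤⟨ +-monoˡ-≤ ((w - z) * z ^ℚ suc k) (*-monoʳ z 0≤z (power-increment≥ 0≤z z≤w k)) ⟩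
    z * (w ^ℚ suc k - z ^ℚ suc k) + (w - z) * z ^ℚ suc k
      ≤⟨ +-monoˡ-≤ ((w - z) * z ^ℚ suc k) (*-monoˡ (w ^ℚ suc k - z ^ℚ suc k) (≤⇒0≤- (^ℚ-mono 0≤z z≤w (suc k))) z≤w) ⟩
    w * (w ^ℚ suc k - z ^ℚ suc k) + (w - z) * z ^ℚ suc k
      ≡⟨ solve 4 (λ w z a b → w :* (a :- b) :+ (w :- z) :* b := w :* a :- z :* b) refl w z (w ^ℚ suc k) (z ^ℚ suc k) ⟩
    w ^ℚ suc (suc k) - z ^ℚ suc (suc k) ∎
    where open ≤-Reasoning

  odd-cancel : ∀ i h x → h * (fromℕ (suc (2 ℕ.* i)) * x ^ℚ (2 ℕ.* i)) * recip (fromℕ (suc (2 ℕ.* i))) ≡ h * (x * x) ^ℚ i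
  odd-cancel i h x = trans
    (solve 4 (λ h k y c → h :* (k :* y) :* c := k :* c :* (h :* y)) refl h k (x ^ℚ (2 ℕ.* i)) (recip k))
    (trans (cong (_* (h * x ^ℚ (2 ℕ.* i))) (recip-inverse (fromℕ-pos (2 ℕ.* i))))
      (trans (*-identityˡ (h * x ^ℚ (2 ℕ.* i))) (cong (h *_) (^ℚ-double x i))))
    where k = fromℕ (suc (2 ℕ.* i))

  artanhTerm-increment≤ : ∀ {z w} → 0ℚ ≤ z → z ≤ w → ∀ i → artanhTerm i w - artanhTerm i z ≤ (w - z) * (w * w) ^ℚ i
  artanhTerm-increment≤ {z} {w} 0≤z z≤w i = ≤-trans
    (≤-reflexive (solve 3 (λ a b c → a :* c :- b :* c := (a :- b) :* c) refl (w ^ℚ suc (2 ℕ.* i)) (z ^ℚ suc (2 ℕ.* i)) c))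
    (≤-trans (*-monoˡ c (<⇒≤ (recip-odd-pos i)) (power-increment≤ 0≤z z≤w (2 ℕ.* i)))
      (≤-reflexive (odd-cancel i (w - z) w)))
    where c = recip (fromℕ (suc (2 ℕ.* i)))

  artanhTerm-increment≥ : ∀ {z w} → 0ℚ ≤ z → z ≤ w → ∀ i → (w - z) * (z * z) ^ℚ i ≤ artanhTerm i w - artanhTerm i z
  artanhTerm-increment≥ {z} {w} 0≤z z≤w i = ≤-trans (≤-reflexive (sym (odd-cancel i (w - z) z)))
    (≤-trans (*-monoˡ c (<⇒≤ (recip-odd-pos i)) (power-increment≥ 0≤z z≤w (2 ℕ.* i)))
      (≤-reflexive (solve 3 (λ a b c → (a :- b) :* c := a :* c :- b :* c) refl (w ^ℚ suc (2 ℕ.* i)) (z ^ℚ suc (2 ℕ.* i)) c)))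
    where c = recip (fromℕ (suc (2 ℕ.* i)))

  Σ<-mono-terms : ∀ {s t} → (∀ i → s i ≤ t i) → ∀ n → Σ< n s ≤ Σ< n t
  Σ<-mono-terms h zero    = ≤-refl
  Σ<-mono-terms h (suc n) = +-mono-≤ (Σ<-mono-terms h n) (h n)

  Σ<-difference : ∀ s t n → Σ< n (λ i → s i - t i) ≡ Σ< n s - Σ< n t
  Σ<-difference s t zero    = refl
  Σ<-difference s t (suc n) = trans (cong (_+ (s n - t n)) (Σ<-difference s t n))
    (solve 4 (λ a b c d → a :- b :+ (c :- d) := a :+ c :- (b :+ d)) refl (Σ< n s) (Σ< n t) (s n) (t n))

  geometric-sum : ∀ h x n → Σ< n (λ i → h * x ^ℚ i) * (1ℚ - x) ≡ h - h * x ^ℚ n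
  geometric-sum h x zero    = solve 2 (λ h x → con 0ℚ :* (con 1ℚ :- x) := h :- h :* con 1ℚ) refl h x
  geometric-sum h x (suc n) = trans (*-distribʳ-+ (1ℚ - x) (Σ< n (λ i → h * x ^ℚ i)) (h * x ^ℚ n))
    (trans (cong (_+ h * x ^ℚ n * (1ℚ - x)) (geometric-sum h x n))
      (solve 3 (λ h x y → h :- h :* y :+ h :* y :* (con 1ℚ :- x) := h :- h :* (x :* y)) refl h x (x ^ℚ n)))

  square<1 : ∀ {z} → 0ℚ ≤ z → z < 1ℚ → z * z < 1ℚ
  square<1 {z} 0≤z z<1 = ≤-<-trans (≤1*⇒ 0≤z (<⇒≤ z<1)) z<1

  -- Mean value inequality for artanh, whose derivative is 1 / (1 - x²): the i-th term has
  -- derivative x^(2i), largest at the right end w, and the factor 1 - w² clears the resulting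
  -- geometric sum.
  A-increment≤ : ∀ {z w} → 0ℚ ≤ z → z ≤ w → w < 1ℚ → ∀ n → (A n w - A n z) * (1ℚ - w * w) ≤ w - z
  A-increment≤ {z} {w} 0≤z z≤w w<1 n = begin
    (A n w - A n z) * (1ℚ - w * w)
      ≡⟨ cong (_* (1ℚ - w * w)) (Σ<-difference (λ i → artanhTerm i w) (λ i → artanhTerm i z) n) ⟨
    Σ< n (λ i → artanhTerm i w - artanhTerm i z) * (1ℚ - w * w)
      ≤⟨ *-monoˡ (1ℚ - w * w) (<⇒≤ (<⇒0<- (square<1 0≤w w<1))) (Σ<-mono-terms (artanhTerm-increment≤ 0≤z z≤w) n) ⟩
    Σ< n (λ i → (w - z) * (w * w) ^ℚ i) * (1ℚ - w * w)
      ≡⟨ geometric-sum (w - z) (w * w) n ⟩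
    w - z - (w - z) * (w * w) ^ℚ n
      ≤⟨ 0≤-⇒≤ (subst (0ℚ ≤_) (solve 2 (λ h y → y := h :- (h :- y)) refl (w - z) ((w - z) * (w * w) ^ℚ n))
           (*-nonneg (≤⇒0≤- z≤w) (^ℚ-nonneg (*-nonneg 0≤w 0≤w) n))) ⟩
    w - z ∎
    where
    open ≤-Reasoning
    0≤w = ≤-trans 0≤z z≤w

  -- Here the derivative is taken at the left end, where the truncated geometric sum falls short of
  -- 1 / (1 - z²). The subtracted term accounts for the missing tail and is paid for in `e′`.
  A-increment≥ : ∀ {z w} → 0ℚ ≤ z → z ≤ w → w < 1ℚ → ∀ n →
    w - z - (w - z) * (z * z) ^ℚ n ≤ (A n w - A n z) * (1ℚ - z * z)
  A-increment≥ {z} {w} 0≤z z≤w w<1 n = begin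
    w - z - (w - z) * (z * z) ^ℚ n
      ≡⟨ geometric-sum (w - z) (z * z) n ⟨
    Σ< n (λ i → (w - z) * (z * z) ^ℚ i) * (1ℚ - z * z)
      ≤⟨ *-monoˡ (1ℚ - z * z) (<⇒≤ (<⇒0<- (square<1 0≤z (≤-<-trans z≤w w<1)))) (Σ<-mono-terms (artanhTerm-increment≥ 0≤z z≤w) n) ⟩
    Σ< n (λ i → artanhTerm i w - artanhTerm i z) * (1ℚ - z * z)
      ≡⟨ cong (_* (1ℚ - z * z)) (Σ<-difference (λ i → artanhTerm i w) (λ i → artanhTerm i z) n) ⟩
    (A n w - A n z) * (1ℚ - z * z) ∎
    where open ≤-Reasoning

  A-zero : ∀ n → A n 0ℚ ≡ 0ℚ
  A-zero zero    = refl
  A-zero (suc n) = cong₂ _+_ (A-zero n)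
    (solve 2 (λ x c → con 0ℚ :* x :* c := con 0ℚ) refl (0ℚ ^ℚ (2 ℕ.* n)) (recip (fromℕ (suc (2 ℕ.* n)))))

  A-mono : ∀ {z w} → 0ℚ ≤ z → z ≤ w → ∀ n → A n z ≤ A n w
  A-mono {z} {w} 0≤z z≤w = Σ<-mono-terms λ i →
    *-monoˡ (recip (fromℕ (suc (2 ℕ.* i)))) (<⇒≤ (recip-odd-pos i)) (^ℚ-mono 0≤z z≤w (suc (2 ℕ.* i)))

  ≤*⇒*recip≤ : ∀ {p q s} → 0ℚ < s → p ≤ q * s → p * recip s ≤ q
  ≤*⇒*recip≤ {p} {q} {s} 0<s h = ≤-trans (*-monoˡ (recip s) (<⇒≤ (recip-pos 0<s)) h) (≤-reflexive
    (trans (*-assoc q s (recip s)) (trans (cong (q *_) (recip-inverse 0<s)) (*-identityʳ q))))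

  *≤⇒≤*recip : ∀ {p q s} → 0ℚ < s → p * s ≤ q → p ≤ q * recip s
  *≤⇒≤*recip {p} {q} {s} 0<s h = ≤-trans (≤-reflexive (sym
    (trans (*-assoc p s (recip s)) (trans (cong (p *_) (recip-inverse 0<s)) (*-identityʳ p)))))
    (*-monoˡ (recip s) (<⇒≤ (recip-pos 0<s)) h)

  -- Cancels a factor `G` of which only the lower bound `g` is known: if y ≤ x, then (x - y) g ≤ (x
  -- - y) G ≤ ε.
  cancel-slack : ∀ {x y g G ε} → 0ℚ < g → g ≤ G → 0ℚ ≤ ε → x * G ≤ y * G + ε → x ≤ y + ε * recip g
  cancel-slack {x} {y} {g} {G} {ε} 0<g g≤G 0≤ε h with ≤-total x y
  ... | inj₁ x≤y = ≤-+ʳ x≤y (*-nonneg 0≤ε (<⇒≤ (recip-pos 0<g)))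
  ... | inj₂ y≤x = ≤-trans (≤-reflexive (solve 2 (λ x y → x := y :+ (x :- y)) refl x y))
    (+-monoʳ-≤ y (*≤⇒≤*recip {x - y} {ε} 0<g (≤-trans (*-monoʳ (x - y) (≤⇒0≤- y≤x) g≤G)
      (0≤-⇒≤ {(x - y) * G} {ε} (subst (0ℚ ≤_) (solve 4 (λ x y G ε → y :* G :+ ε :- x :* G := ε :- (x :- y) :* G) refl x y G ε) (≤⇒0≤- h))))))

  p-q≤p : ∀ p {q} → 0ℚ ≤ q → p - q ≤ p
  p-q≤p p {q} 0≤q = subst (p - q ≤_) (+-identityʳ p) (+-monoʳ-≤ p (neg-antimono-≤ 0≤q))

  E-zero : ∀ {n} → 1 ℕ.≤ n → E n 0ℚ ≡ 1ℚ
  E-zero {suc n} _ = trans (Σ<-head n (exps 0ℚ)) (cong (1ℚ +_) (rest n))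
    where
    rest : ∀ n → Σ< n (λ i → exps 0ℚ (suc i)) ≡ 0ℚ
    rest zero    = refl
    rest (suc n) = cong₂ _+_ (rest n)
      (solve 2 (λ x c → con 0ℚ :* x :* c := con 0ℚ) refl (0ℚ ^ℚ n) (recip (fromℕ (suc n ℕ.!))))

  -- Constancy of exp (2 artanh z) (1 - z) / (1 + z) on [0, r].

  Q : ℚ → ℚ
  Q z = (1ℚ - z) * recip (1ℚ + z)

  -- φ n z tends to exp (2 artanh z) (1 - z) / (1 + z), which is shown to be constant.
  F φ : ℕ → ℚ → ℚ
  F n z = E n (2ℚ * A n z)
  φ n z = F n z * Q z

  0<1+ : ∀ {z} → 0ℚ ≤ z → 0ℚ < 1ℚ + z
  0<1+ = +-mono-<-≤ 0<1

  φ-clear : ∀ {w} → 0ℚ ≤ w → ∀ n b → φ n w * ((1ℚ + w) * b) ≡ F n w * ((1ℚ - w) * b)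
  φ-clear {w} 0≤w n b = trans
    (solve 4 (λ f w u b → f :* ((con 1ℚ :- w) :* u) :* ((con 1ℚ :+ w) :* b) := (con 1ℚ :+ w) :* u :* (f :* ((con 1ℚ :- w) :* b)))
      refl (F n w) w (recip (1ℚ + w)) b)
    (trans (cong (_* (F n w * ((1ℚ - w) * b))) (recip-inverse (0<1+ 0≤w))) (*-identityˡ (F n w * ((1ℚ - w) * b))))

  -- Over N + 1 equal steps the quadratic errors total at most κ / (N + 1), whereas e accumulates N
  -- + 1 times. So N has to be fixed before e is made small.
  subdivide : ∀ {f κ e r} → 0ℚ ≤ κ → r ≤ 1ℚ →
    (∀ {z w} → 0ℚ ≤ z → z ≤ w → w ≤ r → f w ≤ f z + (κ * ((w - z) * (w - z)) + e)) →
    ∀ {z} → 0ℚ ≤ z → z ≤ r → ∀ N → f z ≤ f 0ℚ + (κ * recip (fromℕ (suc N)) + fromℕ (suc N) * e)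
  subdivide {f} {κ} {e} {r} 0≤κ r≤1 step {z} 0≤z z≤r N = begin
    f z                                            ≡⟨ cong f Kh≡z ⟨
    f (K * h)                                      ≤⟨ walk (suc N) ℕ.≤-refl ⟩
    f 0ℚ + K * (κ * (h * h) + e)                   ≡⟨ cong (f 0ℚ +_) (solve 4 (λ K κ h e → K :* (κ :* (h :* h) :+ e) := κ :* (K :* h :* h) :+ K :* e) refl K κ h e) ⟩
    f 0ℚ + (κ * (K * h * h) + K * e)               ≡⟨ cong (λ a → f 0ℚ + (κ * (a * h) + K * e)) Kh≡z ⟩
    f 0ℚ + (κ * (z * h) + K * e)                   ≤⟨ +-monoʳ-≤ (f 0ℚ) (+-monoˡ-≤ (K * e) (*-monoʳ κ 0≤κ zh≤u)) ⟩
    f 0ℚ + (κ * u + K * e)                         ∎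
    where
    open ≤-Reasoning
    K = fromℕ (suc N)
    u = recip K
    h = z * u
    0≤u = <⇒≤ (recip-pos (fromℕ-pos N))
    0≤h : 0ℚ ≤ h
    0≤h = *-nonneg 0≤z 0≤u
    Kh≡z : K * h ≡ z
    Kh≡z = trans (solve 3 (λ K z u → K :* (z :* u) := K :* u :* z) refl K z u)
      (trans (cong (_* z) (recip-inverse (fromℕ-pos N))) (*-identityˡ z))
    zh≤u : z * h ≤ u
    zh≤u = ≤-trans (≤1*⇒ 0≤h (≤-trans z≤r r≤1)) (≤1*⇒ 0≤u (≤-trans z≤r r≤1))
    next : ∀ i → fromℕ (suc i) * h ≡ fromℕ i * h + h
    next i = trans (cong (_* h) (fromℕ-suc i)) (solve 2 (λ k h → (con 1ℚ :+ k) :* h := k :* h :+ h) refl (fromℕ i) h)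
    walk : ∀ i → i ℕ.≤ suc N → f (fromℕ i * h) ≤ f 0ℚ + fromℕ i * (κ * (h * h) + e)
    walk zero    _   = ≤-reflexive (trans (cong f (*-zeroˡ h)) (solve 2 (λ a b → a := a :+ con 0ℚ :* b) refl (f 0ℚ) (κ * (h * h) + e)))
    walk (suc i) i<N = begin
      f (fromℕ (suc i) * h)
        ≤⟨ step (*-nonneg (fromℕ-nonneg i) 0≤h) (*-monoˡ h 0≤h (fromℕ-mono (ℕ.n≤1+n i)))
             (≤-trans (*-monoˡ h 0≤h (fromℕ-mono i<N)) (≤-trans (≤-reflexive Kh≡z) z≤r)) ⟩
      f (fromℕ i * h) + (κ * ((fromℕ (suc i) * h - fromℕ i * h) * (fromℕ (suc i) * h - fromℕ i * h)) + e)
        ≡⟨ cong (λ d → f (fromℕ i * h) + (κ * (d * d) + e))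
             (trans (cong (_- fromℕ i * h) (next i)) (solve 2 (λ a h → a :+ h :- a := h) refl (fromℕ i * h) h)) ⟩
      f (fromℕ i * h) + (κ * (h * h) + e)
        ≤⟨ +-monoˡ-≤ (κ * (h * h) + e) (walk i (ℕ.≤-trans (ℕ.n≤1+n i) i<N)) ⟩
      f 0ℚ + fromℕ i * (κ * (h * h) + e) + (κ * (h * h) + e)
        ≡⟨ solve 3 (λ a k b → a :+ k :* b :+ b := a :+ (con 1ℚ :+ k) :* b) refl (f 0ℚ) (fromℕ i) (κ * (h * h) + e) ⟩
      f 0ℚ + (1ℚ + fromℕ i) * (κ * (h * h) + e)
        ≡⟨ cong (λ k → f 0ℚ + k * (κ * (h * h) + e)) (fromℕ-suc i) ⟨
      f 0ℚ + fromℕ (suc i) * (κ * (h * h) + e) ∎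

  recip-small : ∀ {K η} → 0ℚ ≤ K → 0ℚ < η → ∃[ N ] K * recip (fromℕ (suc N)) ≤ η
  recip-small {K} {η} 0≤K 0<η = let N , h = archimedean (K * recip η) in N , ≤*⇒*recip≤ (fromℕ-pos N) (begin
    K                         ≡⟨ trans (*-assoc K (recip η) η) (trans (cong (K *_) (trans (*-comm (recip η) η) (recip-inverse 0<η))) (*-identityʳ K)) ⟨
    K * recip η * η           ≤⟨ *-monoˡ η (<⇒≤ 0<η) (≤-trans h (fromℕ-mono (ℕ.n≤1+n N))) ⟩
    fromℕ (suc N) * η         ≡⟨ *-comm (fromℕ (suc N)) η ⟩
    η * fromℕ (suc N)         ∎)
    where open ≤-Reasoning

  module ExpArtanh {r : ℚ} (0≤r : 0ℚ ≤ r) (r<1 : r < 1ℚ) where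

    ρ = r * r

    0≤ρ : 0ℚ ≤ ρ
    0≤ρ = *-nonneg 0≤r 0≤r

    ρ<1 : ρ < 1ℚ
    ρ<1 = square<1 0≤r r<1

    0<1-ρ : 0ℚ < 1ℚ - ρ
    0<1-ρ = <⇒0<- ρ<1

    -- On [0, r] every `A n` is at most c, so the arguments 2 `A n` of the exponential stay within
    -- `R`, where `M` bounds all partial sums.
    c = recip (1ℚ - ρ)

    0≤c : 0ℚ ≤ c
    0≤c = <⇒≤ (recip-pos 0<1-ρ)

    R = 2ℚ * c

    0≤R : 0ℚ ≤ R
    0≤R = *-nonneg 0≤2 0≤c

    M : ℚ
    M = proj₁ (E-bounded 0≤R)

    0≤M : 0ℚ ≤ M
    0≤M = proj₁ (proj₂ (E-bounded 0≤R))

    E≤M : ∀ {p} → abs p ≤ R → ∀ n → abs (E n p) ≤ M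
    E≤M = proj₂ (proj₂ (E-bounded 0≤R))

    1-ρ≤ : ∀ {z} → 0ℚ ≤ z → z ≤ r → 1ℚ - ρ ≤ 1ℚ - z * z
    1-ρ≤ 0≤z z≤r = +-monoʳ-≤ 1ℚ (neg-antimono-≤ (*-mono 0≤z 0≤z z≤r z≤r))

    1-z²≤1 : ∀ {z} → 0ℚ ≤ z → 1ℚ - z * z ≤ 1ℚ
    1-z²≤1 {z} 0≤z = p-q≤p 1ℚ (*-nonneg 0≤z 0≤z)

    0≤1-z² : ∀ {z} → 0ℚ ≤ z → z ≤ r → 0ℚ ≤ 1ℚ - z * z
    0≤1-z² 0≤z z≤r = ≤-trans (<⇒≤ 0<1-ρ) (1-ρ≤ 0≤z z≤r)

    ≤1 : ∀ {z} → z ≤ r → z ≤ 1ℚ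
    ≤1 z≤r = ≤-trans z≤r (<⇒≤ r<1)

    A-nonneg : ∀ {z} → 0ℚ ≤ z → ∀ n → 0ℚ ≤ A n z
    A-nonneg {z} 0≤z n = subst (_≤ A n z) (A-zero n) (A-mono ≤-refl 0≤z n)

    A≤c : ∀ {z} → 0ℚ ≤ z → z ≤ r → ∀ n → A n z ≤ c
    A≤c {z} 0≤z z≤r n = subst (A n z ≤_) (*-identityˡ c) (*≤⇒≤*recip 0<1-ρ (begin
      A n z * (1ℚ - ρ)               ≤⟨ *-monoʳ (A n z) (A-nonneg 0≤z n) (1-ρ≤ 0≤z z≤r) ⟩
      A n z * (1ℚ - z * z)           ≡⟨ cong (_* (1ℚ - z * z)) (trans (sym (+-identityʳ (A n z))) (cong (λ a → A n z - a) (sym (A-zero n)))) ⟩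
      (A n z - A n 0ℚ) * (1ℚ - z * z) ≤⟨ A-increment≤ ≤-refl 0≤z (≤-<-trans z≤r r<1) n ⟩
      z - 0ℚ                         ≡⟨ +-identityʳ z ⟩
      z                              ≤⟨ ≤1 z≤r ⟩
      1ℚ                             ∎))
      where open ≤-Reasoning

    2A≤R : ∀ {z} → 0ℚ ≤ z → z ≤ r → ∀ n → abs (2ℚ * A n z) ≤ R
    2A≤R 0≤z z≤r n = ≤-trans (≤-reflexive (0≤p⇒∣p∣≡p (*-nonneg 0≤2 (A-nonneg 0≤z n)))) (*-monoʳ 2ℚ 0≤2 (A≤c 0≤z z≤r n))

    F-nonneg : ∀ {z} → 0ℚ ≤ z → ∀ n → 0ℚ ≤ F n z
    F-nonneg 0≤z n = E-nonneg n (*-nonneg 0≤2 (A-nonneg 0≤z n))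

    F≤M : ∀ {z} → 0ℚ ≤ z → z ≤ r → ∀ n → F n z ≤ M
    F≤M {z} 0≤z z≤r n = ≤-trans (≤abs (F n z)) (E≤M (2A≤R 0≤z z≤r n) n)

    Multiplicative : ℚ → ℕ → Set
    Multiplicative e n = ∀ p q → abs p ≤ R → abs q ≤ R → abs (E n p * E n q - E n (p + q)) ≤ e

    module Step {e : ℚ} {n : ℕ} (0≤e : 0ℚ ≤ e) (2≤n : 2 ℕ.≤ n) (mult : Multiplicative e n)
      {z w : ℚ} (0≤z : 0ℚ ≤ z) (z≤w : z ≤ w) (w≤r : w ≤ r) where

      private
        open ≤-Reasoning
        0≤w = ≤-trans 0≤z z≤w
        z≤r = ≤-trans z≤w w≤r
        h = w - z
        0≤h = ≤⇒0≤- z≤w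
        d = A n w - A n z
        p = 2ℚ * A n z
        s = 2ℚ * d
        Fz = F n z
        Fw = F n w
        0≤Fz = F-nonneg 0≤z n
        0≤Fw = F-nonneg 0≤w n
        a b : ℚ
        a = 1ℚ - w * w
        b = 1ℚ - z * z
        0≤a = 0≤1-z² 0≤w w≤r
        0≤b = 0≤1-z² 0≤z z≤r
        0≤s : 0ℚ ≤ s
        0≤s = *-nonneg 0≤2 (≤⇒0≤- (A-mono 0≤z z≤w n))
        s≤R : abs s ≤ R
        s≤R = ≤-trans (≤-reflexive (0≤p⇒∣p∣≡p 0≤s)) (*-monoʳ 2ℚ 0≤2
          (≤-trans (p-q≤p (A n w) (A-nonneg 0≤z n)) (A≤c 0≤w w≤r n)))
        split : Fw ≡ E n (p + s)
        split = cong (E n) (solve 2 (λ x y → con 2ℚ :* y := con 2ℚ :* x :+ con 2ℚ :* (y :- x)) refl (A n z) (A n w))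
        close : abs (Fz * E n s - Fw) ≤ e
        close = subst (λ x → abs (Fz * E n s - x) ≤ e) (sym split) (mult p s (2A≤R 0≤z z≤r n) s≤R)
        Fw≤ : Fw ≤ Fz * E n s + e
        Fw≤ = ≤-trans (≤-reflexive (solve 2 (λ x y → y := x :+ (:- (x :- y))) refl (Fz * E n s) Fw))
          (+-monoʳ-≤ (Fz * E n s) (≤-trans (-≤abs (Fz * E n s - Fw)) close))
        ≤Fw : Fz * E n s ≤ Fw + e
        ≤Fw = ≤-trans (≤-reflexive (solve 2 (λ x y → x := y :+ (x :- y)) refl (Fz * E n s) Fw))
          (+-monoʳ-≤ Fw (≤-trans (≤abs (Fz * E n s - Fw)) close))
        Fw[1-s]≤ : Fw * (1ℚ - s) ≤ Fz + e
        Fw[1-s]≤ with ≤-total 0ℚ (1ℚ - s)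
        ... | inj₁ 0≤1-s = begin
          Fw * (1ℚ - s)                             ≤⟨ *-monoˡ (1ℚ - s) 0≤1-s Fw≤ ⟩
          (Fz * E n s + e) * (1ℚ - s)               ≡⟨ solve 4 (λ f x e t → (f :* x :+ e) :* t := f :* (x :* t) :+ t :* e) refl Fz (E n s) e (1ℚ - s) ⟩
          Fz * (E n s * (1ℚ - s)) + (1ℚ - s) * e    ≤⟨ +-mono-≤ (*-monoʳ Fz 0≤Fz (E*[1-p]≤1 0≤s n))
                                                         (≤1*⇒ 0≤e (p-q≤p 1ℚ 0≤s)) ⟩
          Fz * 1ℚ + e                               ≡⟨ cong (_+ e) (*-identityʳ Fz) ⟩
          Fz + e                                    ∎
        ... | inj₂ 1-s≤0 = ≤-trans (*-monoʳ Fw 0≤Fw 1-s≤0) (≤-trans (≤-reflexive (*-zeroʳ Fw)) (+-nonneg 0≤Fz 0≤e))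
        quadratic≤ : ∀ {f x} → 0ℚ ≤ f → f ≤ M → 0ℚ ≤ x → x ≤ 1ℚ → f * (2ℚ * (h * h) * (1ℚ + x)) ≤ fromℕ 4 * M * (h * h)
        quadratic≤ {f} {x} 0≤f f≤M 0≤x x≤1 = begin
          f * (2ℚ * (h * h) * (1ℚ + x))
            ≤⟨ *-mono 0≤f (*-nonneg (*-nonneg 0≤2 (*-nonneg 0≤h 0≤h)) (+-nonneg 0≤1 0≤x)) f≤M
                 (*-monoʳ (2ℚ * (h * h)) (*-nonneg 0≤2 (*-nonneg 0≤h 0≤h)) (+-monoʳ-≤ 1ℚ x≤1)) ⟩
          M * (2ℚ * (h * h) * 2ℚ)
            ≡⟨ solve 2 (λ M h → M :* (con 2ℚ :* (h :* h) :* con 2ℚ) := con (fromℕ 4) :* M :* (h :* h)) refl M h ⟩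
          fromℕ 4 * M * (h * h) ∎
        *≤2 : ∀ {x y} → 0ℚ ≤ x → 0ℚ ≤ y → y ≤ r → (1ℚ - x) * (1ℚ + y) ≤ 2ℚ
        *≤2 {x} {y} 0≤x 0≤y y≤r = ≤-trans (*-monoˡ (1ℚ + y) (+-nonneg 0≤1 0≤y)
            (p-q≤p 1ℚ 0≤x))
          (≤-trans (≤-reflexive (*-identityˡ (1ℚ + y))) (+-monoʳ-≤ 1ℚ (≤1 y≤r)))
        1-ρ≤G : ∀ {x} → 1ℚ - ρ ≤ x → 1ℚ - ρ ≤ x * ((1ℚ + z) * (1ℚ + w))
        1-ρ≤G {x} hx = ≤-trans hx (≤-trans (≤-reflexive (sym (*-identityʳ x))) (*-monoʳ x (≤-trans (<⇒≤ 0<1-ρ) hx)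
          (*-mono {1ℚ} {1ℚ + z} {1ℚ} 0≤1 0≤1 (≤-+ʳ ≤-refl 0≤z) (≤-+ʳ ≤-refl 0≤w))))

      -- Up to e, Fw is Fz exp s with s (1 - w²) ≤ 2h, and exp s (1 - s) ≤ 1 turns this into Fw (1 -
      -- w² - 2h) ≤ Fz (1 - w²) + e. The quotient of the values of `Q` at w and z agrees with (1 -
      -- w² - 2h) / (1 - w²) to first order in h; the polynomial identity below exhibits the
      -- remainder 2h² (1 + w). Denominators are cleared throughout and cancelled only at the end.
      step≤ : φ n w ≤ φ n z + (2ℚ * e + fromℕ 4 * M * (h * h)) * c
      step≤ = cancel-slack {φ n w} {φ n z} 0<1-ρ (1-ρ≤G (1-ρ≤ 0≤w w≤r))
        (+-nonneg (*-nonneg 0≤2 0≤e) (*-nonneg (*-nonneg (fromℕ-nonneg 4) 0≤M) (*-nonneg 0≤h 0≤h))) (begin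
        φ n w * (a * ((1ℚ + z) * (1ℚ + w)))
          ≡⟨ cong (φ n w *_) (solve 3 (λ a z w → a :* (z :* w) := w :* (a :* z)) refl a (1ℚ + z) (1ℚ + w)) ⟩
        φ n w * ((1ℚ + w) * (a * (1ℚ + z)))
          ≡⟨ φ-clear 0≤w n (a * (1ℚ + z)) ⟩
        Fw * ((1ℚ - w) * (a * (1ℚ + z)))
          ≡⟨ solve 3 (λ f z w → f :* ((con 1ℚ :- w) :* ((con 1ℚ :- w :* w) :* (con 1ℚ :+ z)))
               := f :* (con 1ℚ :- w :* w :- con 2ℚ :* (w :- z)) :* ((con 1ℚ :- z) :* (con 1ℚ :+ w))
                  :+ f :* (con 2ℚ :* ((w :- z) :* (w :- z)) :* (con 1ℚ :+ w))) refl Fw z w ⟩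
        Fw * (a - 2ℚ * h) * N + Fw * (2ℚ * (h * h) * (1ℚ + w))
          ≤⟨ +-mono-≤ (*-monoˡ N 0≤N slope) (quadratic≤ 0≤Fw (F≤M 0≤w w≤r n) 0≤w (≤1 w≤r)) ⟩
        (Fz * a + e) * N + fromℕ 4 * M * (h * h)
          ≡⟨ cong (_+ fromℕ 4 * M * (h * h)) (solve 5 (λ f a e z w → (f :* a :+ e) :* (z :* w) := f :* (z :* (a :* w)) :+ z :* w :* e) refl Fz a e (1ℚ - z) (1ℚ + w)) ⟩
        Fz * ((1ℚ - z) * (a * (1ℚ + w))) + N * e + fromℕ 4 * M * (h * h)
          ≤⟨ +-monoˡ-≤ (fromℕ 4 * M * (h * h)) (+-monoʳ-≤ (Fz * ((1ℚ - z) * (a * (1ℚ + w)))) (*-monoˡ e 0≤e (*≤2 0≤z 0≤w w≤r))) ⟩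
        Fz * ((1ℚ - z) * (a * (1ℚ + w))) + 2ℚ * e + fromℕ 4 * M * (h * h)
          ≡⟨ cong (λ x → x + 2ℚ * e + fromℕ 4 * M * (h * h)) (φ-clear 0≤z n (a * (1ℚ + w))) ⟨
        φ n z * ((1ℚ + z) * (a * (1ℚ + w))) + 2ℚ * e + fromℕ 4 * M * (h * h)
          ≡⟨ solve 6 (λ f a z w x y → f :* (z :* (a :* w)) :+ x :+ y := f :* (a :* (z :* w)) :+ (x :+ y)) refl
               (φ n z) a (1ℚ + z) (1ℚ + w) (2ℚ * e) (fromℕ 4 * M * (h * h)) ⟩
        φ n z * (a * ((1ℚ + z) * (1ℚ + w))) + (2ℚ * e + fromℕ 4 * M * (h * h)) ∎)
        where
        N = (1ℚ - z) * (1ℚ + w)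
        0≤N : 0ℚ ≤ N
        0≤N = *-nonneg (≤⇒0≤- (≤1 z≤r)) (+-nonneg 0≤1 0≤w)
        sa≤2h : s * a ≤ 2ℚ * h
        sa≤2h = ≤-trans (≤-reflexive (*-assoc 2ℚ d a)) (*-monoʳ 2ℚ 0≤2 (A-increment≤ 0≤z z≤w (≤-<-trans w≤r r<1) n))
        slope : Fw * (a - 2ℚ * h) ≤ Fz * a + e
        slope = begin
          Fw * (a - 2ℚ * h)      ≤⟨ *-monoʳ Fw 0≤Fw (+-monoʳ-≤ a (neg-antimono-≤ sa≤2h)) ⟩
          Fw * (a - s * a)       ≡⟨ solve 3 (λ f a s → f :* (a :- s :* a) := f :* (con 1ℚ :- s) :* a) refl Fw a s ⟩
          Fw * (1ℚ - s) * a      ≤⟨ *-monoˡ a 0≤a Fw[1-s]≤ ⟩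
          (Fz + e) * a           ≡⟨ solve 3 (λ f a e → (f :+ e) :* a := f :* a :+ a :* e) refl Fz a e ⟩
          Fz * a + a * e         ≤⟨ +-monoʳ-≤ (Fz * a) (≤1*⇒ 0≤e (1-z²≤1 0≤w)) ⟩
          Fz * a + e             ∎

      -- The second summand covers the geometric tail lost in `A-increment≥`.
      e′ = e + 2ℚ * M * ρ ^ℚ n

      -- Mirror image of `step≤`: the derivative of artanh is taken at z, and 1 + s ≤ exp s replaces
      -- exp s (1 - s) ≤ 1.
      step≥ : φ n z ≤ φ n w + (2ℚ * e′ + fromℕ 4 * M * (h * h)) * c
      step≥ = cancel-slack {φ n z} {φ n w} 0<1-ρ (1-ρ≤G (1-ρ≤ 0≤z z≤r))
        (+-nonneg (*-nonneg 0≤2 0≤e′) (*-nonneg (*-nonneg (fromℕ-nonneg 4) 0≤M) (*-nonneg 0≤h 0≤h))) (begin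
        φ n z * (b * ((1ℚ + z) * (1ℚ + w)))
          ≡⟨ cong (φ n z *_) (solve 3 (λ a z w → a :* (z :* w) := z :* (a :* w)) refl b (1ℚ + z) (1ℚ + w)) ⟩
        φ n z * ((1ℚ + z) * (b * (1ℚ + w)))
          ≡⟨ φ-clear 0≤z n (b * (1ℚ + w)) ⟩
        Fz * ((1ℚ - z) * (b * (1ℚ + w)))
          ≡⟨ solve 3 (λ f z w → f :* ((con 1ℚ :- z) :* ((con 1ℚ :- z :* z) :* (con 1ℚ :+ w)))
               := f :* (con 1ℚ :- z :* z :+ con 2ℚ :* (w :- z)) :* ((con 1ℚ :- w) :* (con 1ℚ :+ z))
                  :+ f :* (con 2ℚ :* ((w :- z) :* (w :- z)) :* (con 1ℚ :+ z))) refl Fz z w ⟩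
        Fz * (b + 2ℚ * h) * N + Fz * (2ℚ * (h * h) * (1ℚ + z))
          ≤⟨ +-mono-≤ (*-monoˡ N 0≤N slope) (quadratic≤ 0≤Fz (F≤M 0≤z z≤r n) 0≤z (≤1 z≤r)) ⟩
        (Fw * b + e′) * N + fromℕ 4 * M * (h * h)
          ≡⟨ cong (_+ fromℕ 4 * M * (h * h)) (solve 5 (λ f a e z w → (f :* a :+ e) :* (w :* z) := f :* (w :* (a :* z)) :+ w :* z :* e) refl Fw b e′ (1ℚ + z) (1ℚ - w)) ⟩
        Fw * ((1ℚ - w) * (b * (1ℚ + z))) + N * e′ + fromℕ 4 * M * (h * h)
          ≤⟨ +-monoˡ-≤ (fromℕ 4 * M * (h * h)) (+-monoʳ-≤ (Fw * ((1ℚ - w) * (b * (1ℚ + z)))) (*-monoˡ e′ 0≤e′ (*≤2 0≤w 0≤z z≤r))) ⟩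
        Fw * ((1ℚ - w) * (b * (1ℚ + z))) + 2ℚ * e′ + fromℕ 4 * M * (h * h)
          ≡⟨ cong (λ x → x + 2ℚ * e′ + fromℕ 4 * M * (h * h)) (φ-clear 0≤w n (b * (1ℚ + z))) ⟨
        φ n w * ((1ℚ + w) * (b * (1ℚ + z))) + 2ℚ * e′ + fromℕ 4 * M * (h * h)
          ≡⟨ solve 6 (λ f a z w x y → f :* (w :* (a :* z)) :+ x :+ y := f :* (a :* (z :* w)) :+ (x :+ y)) refl
               (φ n w) b (1ℚ + z) (1ℚ + w) (2ℚ * e′) (fromℕ 4 * M * (h * h)) ⟩
        φ n w * (b * ((1ℚ + z) * (1ℚ + w))) + (2ℚ * e′ + fromℕ 4 * M * (h * h)) ∎)
        where
        N = (1ℚ - w) * (1ℚ + z)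
        0≤N : 0ℚ ≤ N
        0≤N = *-nonneg (≤⇒0≤- (≤1 w≤r)) (+-nonneg 0≤1 0≤z)
        y = (z * z) ^ℚ n
        0≤e′ : 0ℚ ≤ e′
        0≤e′ = +-nonneg 0≤e (*-nonneg (*-nonneg 0≤2 0≤M) (^ℚ-nonneg 0≤ρ n))
        2h≤ : 2ℚ * (h - h * y) ≤ s * b
        2h≤ = ≤-trans (*-monoʳ 2ℚ 0≤2 (A-increment≥ 0≤z z≤w (≤-<-trans w≤r r<1) n)) (≤-reflexive (sym (*-assoc 2ℚ d b)))
        tail≤ : Fz * (2ℚ * (h * y)) ≤ 2ℚ * M * ρ ^ℚ n
        tail≤ = ≤-trans (*-mono 0≤Fz (*-nonneg 0≤2 (*-nonneg 0≤h (^ℚ-nonneg (*-nonneg 0≤z 0≤z) n))) (F≤M 0≤z z≤r n)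
            (*-monoʳ 2ℚ 0≤2 (≤-trans (≤1*⇒ (^ℚ-nonneg (*-nonneg 0≤z 0≤z) n) h≤1) (^ℚ-mono (*-nonneg 0≤z 0≤z) (*-mono 0≤z 0≤z z≤r z≤r) n))))
          (≤-reflexive (solve 2 (λ M y → M :* (con 2ℚ :* y) := con 2ℚ :* M :* y) refl M (ρ ^ℚ n)))
          where
          h≤1 : h ≤ 1ℚ
          h≤1 = ≤-trans (p-q≤p w 0≤z) (≤1 w≤r)
        slope : Fz * (b + 2ℚ * h) ≤ Fw * b + e′
        slope = begin
          Fz * (b + 2ℚ * h)
            ≡⟨ solve 4 (λ f b h y → f :* (b :+ con 2ℚ :* h) := f :* (b :+ con 2ℚ :* (h :- h :* y)) :+ f :* (con 2ℚ :* (h :* y))) refl Fz b h y ⟩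
          Fz * (b + 2ℚ * (h - h * y)) + Fz * (2ℚ * (h * y))
            ≤⟨ +-mono-≤ (*-monoʳ Fz 0≤Fz (+-monoʳ-≤ b 2h≤)) tail≤ ⟩
          Fz * (b + s * b) + t
            ≡⟨ cong (_+ t) (solve 3 (λ f b s → f :* (b :+ s :* b) := f :* (con 1ℚ :+ s) :* b) refl Fz b s) ⟩
          Fz * (1ℚ + s) * b + t
            ≤⟨ +-monoˡ-≤ t (*-monoˡ b 0≤b (≤-trans (*-monoʳ Fz 0≤Fz (1+p≤E 0≤s 2≤n)) ≤Fw)) ⟩
          (Fw + e) * b + t
            ≡⟨ solve 4 (λ f b e t → (f :+ e) :* b :+ t := f :* b :+ (b :* e :+ t)) refl Fw b e t ⟩
          Fw * b + (b * e + t)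
            ≤⟨ +-monoʳ-≤ (Fw * b) (+-monoˡ-≤ t (≤1*⇒ 0≤e (1-z²≤1 0≤z))) ⟩
          Fw * b + e′ ∎
          where t = 2ℚ * M * ρ ^ℚ n

  *recip-cancel : ∀ q {s} → 0ℚ < s → q * recip s * s ≡ q
  *recip-cancel q {s} 0<s = trans (*-assoc q (recip s) s)
    (trans (cong (q *_) (trans (*-comm (recip s) s) (recip-inverse 0<s))) (*-identityʳ q))

  φ-zero : ∀ {n} → 1 ℕ.≤ n → φ n 0ℚ ≡ 1ℚ
  φ-zero {n} 1≤n = trans (*-identityʳ (F n 0ℚ))
    (trans (cong (λ a → E n (2ℚ * a)) (A-zero n)) (trans (cong (E n) (*-zeroʳ 2ℚ)) (E-zero 1≤n)))

  eventually-≥ : ∀ k → Eventually (k ℕ.≤_)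
  eventually-≥ k = k , λ _ h → h

  module _ {r : ℚ} (0≤r : 0ℚ ≤ r) (r<1 : r < 1ℚ) where
    open ExpArtanh 0≤r r<1

    -- As φ is 1 at 0, it suffices to apply `subdivide` to φ and to -φ. The number of steps is fixed
    -- first, so that the quadratic errors total at most η/2. Then θ is chosen such that the
    -- remaining errors 2θc, one for each step, total η/2, and n is taken so late that the defect of
    -- multiplicativity and the geometric tail are each at most θ/2.
    φ-limit : ∀ {η} → 0ℚ < η → Eventually (λ n → ∀ z → 0ℚ ≤ z → z ≤ r → abs (φ n z - 1ℚ) ≤ η)
    φ-limit {η} 0<η = eventually-∧ (λ f x → f x) (eventually-∧ (λ a b c → near a b c) mult tail) (eventually-≥ 2)
      where
      κ = fromℕ 4 * M * c
      0≤κ : 0ℚ ≤ κ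
      0≤κ = *-nonneg (*-nonneg (fromℕ-nonneg 4) 0≤M) 0≤c
      N = proj₁ (recip-small 0≤κ (half 0<η))
      K = fromℕ (suc N)
      C = K * (2ℚ * c)
      0<C : 0ℚ < C
      0<C = *-pos (fromℕ-pos N) (*-pos 0<2 (recip-pos 0<1-ρ))
      θ = ½ * η * recip C
      0<θ : 0ℚ < θ
      0<θ = *-pos (half 0<η) (recip-pos 0<C)
      e = ½ * θ
      0<e : 0ℚ < e
      0<e = half 0<θ
      mult : Eventually (Multiplicative e)
      mult = E-mult 0≤R 0<e
      tail : Eventually (λ n → 2ℚ * M * ρ ^ℚ n ≤ e)
      tail = geometric-eventually (*-nonneg 0≤2 0≤M) 0≤ρ ρ<1 0<e
      budget : κ * recip K + K * (2ℚ * θ * c) ≤ η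
      budget = ≤-trans (+-mono-≤ (proj₂ (recip-small 0≤κ (half 0<η)))
          (≤-reflexive (trans (solve 3 (λ K θ c → K :* (con 2ℚ :* θ :* c) := θ :* (K :* (con 2ℚ :* c))) refl K θ c) (*recip-cancel (½ * η) 0<C))))
        (≤-reflexive (½+½ η))
      module _ {n : ℕ} (m : Multiplicative e n) (t : 2ℚ * M * ρ ^ℚ n ≤ e) (2≤n : 2 ℕ.≤ n) where
        e≤θ : e ≤ θ
        e≤θ = ≤-trans (≤-+ʳ ≤-refl (<⇒≤ 0<e)) (≤-reflexive (½+½ θ))
        e′≤θ : e + 2ℚ * M * ρ ^ℚ n ≤ θ
        e′≤θ = ≤-trans (+-monoʳ-≤ e t) (≤-reflexive (½+½ θ))
        weaken : ∀ {x} → x ≤ θ → ∀ h → (2ℚ * x + fromℕ 4 * M * (h * h)) * c ≤ κ * (h * h) + 2ℚ * θ * c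
        weaken {x} x≤θ h = ≤-trans
          (≤-reflexive (solve 5 (λ f M h c x → (con 2ℚ :* x :+ f :* M :* (h :* h)) :* c := f :* M :* c :* (h :* h) :+ con 2ℚ :* x :* c) refl (fromℕ 4) M h c x))
          (+-monoʳ-≤ (κ * (h * h)) (*-monoˡ c 0≤c (*-monoʳ 2ℚ 0≤2 x≤θ)))
        up : ∀ {z w} → 0ℚ ≤ z → z ≤ w → w ≤ r → φ n w ≤ φ n z + (κ * ((w - z) * (w - z)) + 2ℚ * θ * c)
        up {z} {w} 0≤z z≤w w≤r = ≤-trans (Step.step≤ (<⇒≤ 0<e) 2≤n m 0≤z z≤w w≤r)
          (+-monoʳ-≤ (φ n z) (weaken e≤θ (w - z)))
        down : ∀ {z w} → 0ℚ ≤ z → z ≤ w → w ≤ r → - φ n w ≤ - φ n z + (κ * ((w - z) * (w - z)) + 2ℚ * θ * c)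
        down {z} {w} 0≤z z≤w w≤r = 0≤-⇒≤ {(- φ n w)} {(- φ n z + b)}
          (subst (0ℚ ≤_) (solve 3 (λ x y b → y :+ b :- x := :- x :+ b :- (:- y)) refl (φ n z) (φ n w) b)
            (≤⇒0≤- (≤-trans (Step.step≥ (<⇒≤ 0<e) 2≤n m 0≤z z≤w w≤r)
              (+-monoʳ-≤ (φ n w) (weaken e′≤θ (w - z))))))
          where b = κ * ((w - z) * (w - z)) + 2ℚ * θ * c
        near : ∀ z → 0ℚ ≤ z → z ≤ r → abs (φ n z - 1ℚ) ≤ η
        near z 0≤z z≤r = abs≤
          (≤-trans (+-monoˡ-≤ (- 1ℚ) (subst (λ a → φ n z ≤ a + B) (φ-zero 1≤n) (subdivide 0≤κ (<⇒≤ r<1) up 0≤z z≤r N)))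
            (≤-trans (≤-reflexive (solve 1 (λ b → con 1ℚ :+ b :- con 1ℚ := b) refl B)) budget))
          (≤-trans (≤-reflexive (solve 1 (λ x → :- (x :- con 1ℚ) := :- x :+ con 1ℚ) refl (φ n z)))
            (≤-trans (+-monoˡ-≤ 1ℚ (subst (λ a → - φ n z ≤ - a + B) (φ-zero 1≤n) (subdivide 0≤κ (<⇒≤ r<1) down 0≤z z≤r N)))
              (≤-trans (≤-reflexive (solve 1 (λ b → :- con 1ℚ :+ b :+ con 1ℚ := b) refl B)) budget)))
          where
          1≤n = ℕ.≤-trans (ℕ.n≤1+n 1) 2≤n
          B = κ * recip K + K * (2ℚ * θ * c)

  -- The exponential inverts the logarithm.

  A-odd : ∀ z n → A n (- z) ≡ - A n z
  A-odd z zero    = refl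
  A-odd z (suc n) = trans (cong₂ _+_ (A-odd z n) term) (sym (neg-distrib-+ (A n z) (artanhTerm n z)))
    where
    open ≡-Reasoning
    c = recip (fromℕ (suc (2 ℕ.* n)))
    term : artanhTerm n (- z) ≡ - artanhTerm n z
    term = begin
      - z * (- z) ^ℚ (2 ℕ.* n) * c         ≡⟨ cong (λ a → - z * a * c) (^ℚ-double (- z) n) ⟩
      - z * ((- z) * (- z)) ^ℚ n * c       ≡⟨ cong (λ a → - z * a ^ℚ n * c) (solve 1 (λ z → (:- z) :* (:- z) := z :* z) refl z) ⟩
      - z * (z * z) ^ℚ n * c               ≡⟨ cong (λ a → - z * a * c) (^ℚ-double z n) ⟨
      - z * z ^ℚ (2 ℕ.* n) * c             ≡⟨ solve 3 (λ z a c → :- z :* a :* c := :- (z :* a :* c)) refl z (z ^ℚ (2 ℕ.* n)) c ⟩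
      - artanhTerm n z                     ∎

  cayleyℚ : ℚ → ℚ
  cayleyℚ u = (u + - 1ℚ * 1ℚ) * recip (u + 1ℚ)

  module _ {u : ℚ} (0<u : 0ℚ < u) where
    private
      v = recip (u + 1ℚ)
      z = cayleyℚ u
      0<v : 0ℚ < v
      0<v = recip-pos (+-pos 0<u 0<1)
      1-z : 1ℚ - z ≡ 2ℚ * v
      1-z = trans (cong (λ a → 1ℚ - a) (cayley≡ 0<u)) (solve 1 (λ v → con 1ℚ :- (con 1ℚ :- con 2ℚ :* v) := con 2ℚ :* v) refl v)
      1+z : 1ℚ + z ≡ 2ℚ * (u * v)
      1+z = trans (solve 1 (λ z → con 1ℚ :+ z := con 1ℚ :- (:- z)) refl z)
        (trans (cong (λ a → 1ℚ - a) (-cayley≡ 0<u)) (solve 1 (λ v → con 1ℚ :- (con 1ℚ :- con 2ℚ :* v) := con 2ℚ :* v) refl (u * v)))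
      0<2v : 0ℚ < 2ℚ * v
      0<2v = *-pos 0<2 0<v
      0<2uv : 0ℚ < 2ℚ * (u * v)
      0<2uv = *-pos 0<2 (*-pos 0<u 0<v)

    Q-cayley : Q z * u ≡ 1ℚ
    Q-cayley = begin
      (1ℚ - z) * recip (1ℚ + z) * u                 ≡⟨ cong₂ (λ a b → a * recip b * u) 1-z 1+z ⟩
      2ℚ * v * recip (2ℚ * (u * v)) * u             ≡⟨ solve 3 (λ v w u → con 2ℚ :* v :* w :* u := con 2ℚ :* (u :* v) :* w) refl v (recip (2ℚ * (u * v))) u ⟩
      2ℚ * (u * v) * recip (2ℚ * (u * v))           ≡⟨ recip-inverse 0<2uv ⟩
      1ℚ                                            ∎
      where open ≡-Reasoning

    Q-neg-cayley : Q (- z) ≡ u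
    Q-neg-cayley = begin
      (1ℚ - (- z)) * recip (1ℚ + - z)               ≡⟨ cong₂ (λ a b → a * recip b) (trans (solve 1 (λ z → con 1ℚ :- (:- z) := con 1ℚ :+ z) refl z) 1+z) 1-z ⟩
      2ℚ * (u * v) * recip (2ℚ * v)                 ≡⟨ solve 3 (λ v w u → con 2ℚ :* (u :* v) :* w := u :* (con 2ℚ :* v :* w)) refl v (recip (2ℚ * v)) u ⟩
      u * (2ℚ * v * recip (2ℚ * v))                 ≡⟨ cong (u *_) (recip-inverse 0<2v) ⟩
      u * 1ℚ                                        ≡⟨ *-identityʳ u ⟩
      u                                             ∎
      where open ≡-Reasoning

  infix 4 _≈ᴿ_
  record _≈ᴿ_ (x y : ℝ) : Set where
    constructor within
    field close : ∀ {η} → 0ℚ < η → Eventually (λ n → abs (seq x n - seq y n) ≤ η)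
  open _≈ᴿ_ public

  -- Let z be the Cayley transform of u. If z ≥ 0, then φ ≈ 1 and Q z = 1/u give exp (2 artanh z) ≈
  -- u. If z ≤ 0, `φ-limit` is applied to -z, and the oddness of artanh together with exp p exp (-p)
  -- = 1 carries the result over. The estimates are uniform in u, so the sign of z may vary with the
  -- index.
  exp-log : ∀ x (0<x : 0ᴿ <ᴿ x) → exp (log x 0<x) ≈ᴿ x
  exp-log x 0<x .close {η} 0<η = eventually-∧ (λ f x → f x) (eventually-∧ (λ f lim → f lim)
    (eventually-∧ (λ f mul lim → f mul lim)
      (eventually-∧ (λ a b mul lim 1≤n → Near.near (proj₁ a) (proj₂ a) b mul lim 1≤n)
        (eventually-∧ _,_ (proj₂ (proj₂ lb)) (proj₂ (proj₂ bd))) (proj₂ (proj₂ cay)))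
      (E-mult 0≤R 0<η₁))
    (φ-limit 0≤r r<1 0<η₁)) (eventually-≥ 1)
    where
    open ≤-Reasoning
    lb = lowerBound 0<x
    bd = bounded x
    B = proj₁ bd
    0<B = proj₁ (proj₂ bd)
    cay = ∣cayley∣<1 x 0<x
    r = proj₁ cay
    r<1 = proj₁ (proj₂ cay)
    0≤r : 0ℚ ≤ r
    0≤r = ≤-trans (abs-nonneg (seq (cayley x 0<x) (proj₁ (proj₂ (proj₂ cay))))) (proj₂ (proj₂ (proj₂ cay)) (proj₁ (proj₂ (proj₂ cay))) ℕ.≤-refl)
    open ExpArtanh 0≤r r<1
    T = M + B
    0<T : 0ℚ < T
    0<T = +-mono-≤-< 0≤M 0<B
    η₁ = η * recip T
    0<η₁ : 0ℚ < η₁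
    0<η₁ = *-pos 0<η (recip-pos 0<T)
    module Near {n : ℕ} {u : ℚ} (lo : proj₁ lb ≤ u) (hi : abs u ≤ B) (∣z∣≤r : abs (cayleyℚ u) ≤ r) (mul : Multiplicative η₁ n)
      (lim : ∀ z → 0ℚ ≤ z → z ≤ r → abs (φ n z - 1ℚ) ≤ η₁) (1≤n : 1 ℕ.≤ n) where
      z = cayleyℚ u
      0<u : 0ℚ < u
      0<u = <-≤-trans (proj₁ (proj₂ lb)) lo
      nonneg-case : 0ℚ ≤ z → abs (F n z - u) ≤ η
      nonneg-case 0≤z = begin
        abs (F n z - u)                  ≡⟨ cong abs (trans (cong (_- u) Fz) (solve 2 (λ a u → a :* u :- u := (a :- con 1ℚ) :* u) refl (φ n z) u)) ⟩
        abs ((φ n z - 1ℚ) * u)           ≤⟨ abs-*≤ {φ n z - 1ℚ} {u} (lim z 0≤z (≤-trans (≤abs z) ∣z∣≤r)) hi ⟩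
        η₁ * B                           ≤⟨ *-monoʳ η₁ (<⇒≤ 0<η₁) (subst (_≤ T) (+-identityˡ B) (+-monoˡ-≤ B 0≤M)) ⟩
        η₁ * T                           ≡⟨ *recip-cancel η 0<T ⟩
        η                                ∎
        where
        Fz : F n z ≡ φ n z * u
        Fz = trans (sym (*-identityʳ (F n z))) (trans (cong (F n z *_) (sym (Q-cayley 0<u))) (sym (*-assoc (F n z) (Q z) u)))
      nonpos-case : z ≤ 0ℚ → abs (F n z - u) ≤ η
      nonpos-case z≤0 = begin
        abs (F n z - u)
          ≡⟨ cong (λ a → abs (a - u)) Fz ⟩
        abs (y - u)
          -- With f = E n p, both f u and f y are close to 1. The decomposition compares y with u
          -- through these two facts without dividing by f.
          ≡⟨ cong abs (solve 3 (λ y u f → y :- u := (y :* (:- (f :* u :- con 1ℚ))) :+ (f :* y :- con 1ℚ) :* u) refl y u (E n p)) ⟩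
        abs (y * (- (E n p * u - 1ℚ)) + (E n p * y - 1ℚ) * u)
          ≤⟨ abs-+≤ {y * (- (E n p * u - 1ℚ))} (abs-*≤ {y} (E≤M -p≤R n) φ≤) (abs-*≤ {E n p * y - 1ℚ} {u} one hi) ⟩
        M * η₁ + η₁ * B
          ≡⟨ solve 3 (λ M e B → M :* e :+ e :* B := e :* (M :+ B)) refl M η₁ B ⟩
        η₁ * T
          ≡⟨ *recip-cancel η 0<T ⟩
        η ∎
        where
        w = - z
        0≤w : 0ℚ ≤ w
        0≤w = neg-antimono-≤ z≤0
        w≤r : w ≤ r
        w≤r = ≤-trans (-≤abs z) ∣z∣≤r
        p = 2ℚ * A n w
        y = E n (- p)
        p≤R = 2A≤R 0≤w w≤r n
        -p≤R : abs (- p) ≤ R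
        -p≤R = subst (_≤ R) (sym (∣-p∣≡∣p∣ p)) p≤R
        Fz : F n z ≡ y
        Fz = cong (E n) (trans (cong (λ a → 2ℚ * A n a) (solve 1 (λ z → z := :- (:- z)) refl z))
          (trans (cong (2ℚ *_) (A-odd w n)) (solve 1 (λ a → con 2ℚ :* (:- a) := :- (con 2ℚ :* a)) refl (A n w))))
        φ≤ : abs (- (E n p * u - 1ℚ)) ≤ η₁
        φ≤ = ≤-trans (≤-reflexive (trans (∣-p∣≡∣p∣ (E n p * u - 1ℚ)) (cong (λ a → abs (E n p * a - 1ℚ)) (sym (Q-neg-cayley 0<u))))) (lim w 0≤w w≤r)
        one : abs (E n p * y - 1ℚ) ≤ η₁
        one = subst (λ a → abs (E n p * y - a) ≤ η₁) (trans (cong (E n) (+-inverseʳ p)) (E-zero 1≤n)) (mul p (- p) p≤R -p≤R)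
      near : abs (F n z - u) ≤ η
      near = [ nonneg-case , nonpos-case ]′ (≤-total 0ℚ z)

  -- Passing between logarithms, real powers and integer powers.

  <⇒¬≥ : ∀ {p q} → p < q → q ≤ p → ⊥
  <⇒¬≥ p<q q≤p = <-irrefl refl (<-≤-trans p<q q≤p)

  ≡⇒≈ᴿ : ∀ {x y} → (∀ n → seq x n ≡ seq y n) → x ≈ᴿ y
  ≡⇒≈ᴿ {x} {y} eq .close {η} 0<η = 0 , λ n _ →
    subst (_≤ η) (sym (trans (cong (λ a → abs (a - seq y n)) (eq n)) (cong abs (+-inverseʳ (seq y n))))) (<⇒≤ 0<η)

  ≈ᴿ-trans : ∀ {x y z} → x ≈ᴿ y → y ≈ᴿ z → x ≈ᴿ z
  ≈ᴿ-trans {x} {y} {z} p q .close {η} 0<η = eventually-∧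
    (λ {n} a b → ≤-trans (abs-triangle (seq x n) (seq y n) (seq z n)) (≤-trans (+-mono-≤ a b) (≤-reflexive (½+½ η))))
    (close p (half 0<η)) (close q (half 0<η))

  ≈ᴿ-sym : ∀ {x y} → x ≈ᴿ y → y ≈ᴿ x
  ≈ᴿ-sym {x} {y} p .close {η} 0<η =
    eventually-map (λ {n} → subst (_≤ η) (abs-minus-comm (seq x n) (seq y n))) (close p 0<η)

  *ᴿ-cong : ∀ {x x′ y y′} → x ≈ᴿ x′ → y ≈ᴿ y′ → x *ᴿ y ≈ᴿ x′ *ᴿ y′
  *ᴿ-cong {x} {x′} {y} {y′} p q .close {η} 0<η = let
      a , 0<a , ba = bounded x
      b , 0<b , bb = bounded y′
    in eventually-∧ (λ {n} (ha , hb) (hx , hy) →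
         *-close {b = seq y n} {c = seq x′ n} 0<a 0<b ha hb hx hy)
       (eventually-∧ _,_ ba bb)
       (eventually-∧ _,_ (close p (*-pos (half 0<η) (recip-pos 0<b))) (close q (*-pos (half 0<η) (recip-pos 0<a))))

  ^ᴿ-cong : ∀ {x y} → x ≈ᴿ y → ∀ k → x ^ᴿ k ≈ᴿ y ^ᴿ k
  ^ᴿ-cong p zero    = ≡⇒≈ᴿ λ _ → refl
  ^ᴿ-cong p (suc k) = *ᴿ-cong p (^ᴿ-cong p k)

  seq-^ᴿ : ∀ x k n → seq (x ^ᴿ k) n ≡ seq x n ^ℚ k
  seq-^ᴿ x zero    n = refl
  seq-^ᴿ x (suc k) n = cong (seq x n *_) (seq-^ᴿ x k n)

  exp-≡ : ∀ {x y} → (∀ n → seq x n ≡ seq y n) → exp x ≈ᴿ exp y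
  exp-≡ eq = ≡⇒≈ᴿ λ n → cong (E n) (eq n)

  exp-+ : ∀ x y → exp (x +ᴿ y) ≈ᴿ exp x *ᴿ exp y
  exp-+ x y .close {η} 0<η = let
      a , 0<a , ba = bounded x
      b , 0<b , bb = bounded y
    in eventually-∧ (λ {n} (ha , hb) m → ≤-trans
           (≤-reflexive (abs-minus-comm (E n (seq x n + seq y n)) (E n (seq x n) * E n (seq y n))))
           (m (seq x n) (seq y n) (≤-+ʳ ha (<⇒≤ 0<b)) (≤-trans (≤-+ʳ hb (<⇒≤ 0<a)) (≤-reflexive (+-comm b a)))))
         (eventually-∧ _,_ ba bb) (E-mult (<⇒≤ (+-pos 0<a 0<b)) 0<η)

  exp-ℕ* : ∀ k x → exp (ιℕ k *ᴿ x) ≈ᴿ exp x ^ᴿ k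
  exp-ℕ* zero    x .close {η} 0<η = 1 , λ n 1≤n →
    subst (_≤ η) (sym (cong (λ a → abs (a - 1ℚ)) (trans (cong (E n) (*-zeroˡ (seq x n))) (E-zero 1≤n)))) (<⇒≤ 0<η)
  exp-ℕ* (suc k) x = ≈ᴿ-trans
    (exp-≡ {ιℕ (suc k) *ᴿ x} {x +ᴿ ιℕ k *ᴿ x} λ n → trans (cong (_* seq x n) (fromℕ-suc k))
      (solve 2 (λ k x → (con 1ℚ :+ k) :* x := x :+ k :* x) refl (fromℕ k) (seq x n)))
    (≈ᴿ-trans (exp-+ x (ιℕ k *ᴿ x)) (*ᴿ-cong (≡⇒≈ᴿ λ _ → refl) (exp-ℕ* k x)))

  exp-ℕ*-log : ∀ k x (0<x : 0ᴿ <ᴿ x) → exp (ιℕ k *ᴿ log x 0<x) ≈ᴿ x ^ᴿ k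
  exp-ℕ*-log k x 0<x = ≈ᴿ-trans (exp-ℕ* k (log x 0<x)) (^ᴿ-cong (exp-log x 0<x) k)

  ≈⇒≤ : ∀ p q {η} → abs (p - q) ≤ η → p ≤ q + η
  ≈⇒≤ p q h = ≤-trans (≤-reflexive (solve 2 (λ p q → p := q :+ (p :- q)) refl p q)) (+-monoʳ-≤ q (≤-trans (≤abs (p - q)) h))

  ≈⇒≥ : ∀ p q {η} → abs (p - q) ≤ η → q ≤ p + η
  ≈⇒≥ p q {η} h = ≈⇒≤ q p (subst (_≤ η) (abs-minus-comm p q) h)

  E-mono : ∀ {p q} → 0ℚ ≤ p → p ≤ q → ∀ n → E n p ≤ E n q
  E-mono 0≤p p≤q = Σ<-mono-terms λ i → *-monoˡ (recip (fromℕ (i ℕ.!))) (<⇒≤ (recip!-pos i)) (^ℚ-mono 0≤p p≤q i)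

  eventually-nonneg : ∀ {x} → 0ᴿ <ᴿ x → Eventually (λ n → 0ℚ ≤ seq x n)
  eventually-nonneg 0<x = let η , 0<η , h = lowerBound 0<x in eventually-map (≤-trans (<⇒≤ 0<η)) h

  -- Exponentiates k log u ≤ m log v. `E` is compared at nonnegative arguments, where it is monotone
  -- term by term; the slack η remains because exp and log are inverse only in the limit.
  log-comparison : ∀ {u v} (0<u : 0ᴿ <ᴿ u) (0<v : 0ᴿ <ᴿ v) k m →
    Eventually (λ n → 0ℚ ≤ seq (log u 0<u) n) →
    Eventually (λ n → fromℕ k * seq (log u 0<u) n ≤ fromℕ m * seq (log v 0<v) n) →
    ∀ {η} → 0ℚ < η → Eventually (λ n → seq u n ^ℚ k ≤ seq v n ^ℚ m + η)
  log-comparison {u} {v} 0<u 0<v k m 0≤log le {η} 0<η = eventually-∧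
    (λ {n} (0≤l , l≤) (hu , hv) → begin
      seq u n ^ℚ k
        ≡⟨ seq-^ᴿ u k n ⟨
      seq (u ^ᴿ k) n
        ≤⟨ ≈⇒≥ (E n (fromℕ k * seq (log u 0<u) n)) (seq (u ^ᴿ k) n) hu ⟩
      E n (fromℕ k * seq (log u 0<u) n) + ½ * η
        ≤⟨ +-monoˡ-≤ (½ * η) (E-mono (*-nonneg (fromℕ-nonneg k) 0≤l) l≤ n) ⟩
      E n (fromℕ m * seq (log v 0<v) n) + ½ * η
        ≤⟨ +-monoˡ-≤ (½ * η) (≈⇒≤ (E n (fromℕ m * seq (log v 0<v) n)) (seq (v ^ᴿ m) n) hv) ⟩
      seq (v ^ᴿ m) n + ½ * η + ½ * η
        ≡⟨ trans (+-assoc (seq (v ^ᴿ m) n) (½ * η) (½ * η)) (cong₂ _+_ (seq-^ᴿ v m n) (½+½ η)) ⟩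
      seq v n ^ℚ m + η ∎)
    (eventually-∧ _,_ 0≤log le)
    (eventually-∧ _,_ (close (exp-ℕ*-log k u 0<u) (half 0<η)) (close (exp-ℕ*-log m v 0<v) (half 0<η)))
    where open ≤-Reasoning

  1/[_] : ℕ → ℝ
  1/[ j ] = ι (recip (fromℕ (suc j)))

  -- The denominator of `1/[ j ]` is j + 1, so the (j + 1)-st power has the integer exponent j + 2,
  -- and the real exponent of the conjecture disappears.
  power-1+1/ : ∀ u (0<u : 0ᴿ <ᴿ u) j → (u ^[ 0<u ] (1ᴿ +ᴿ 1/[ j ])) ^ᴿ suc j ≈ᴿ u ^ᴿ suc (suc j)
  power-1+1/ u 0<u j = ≈ᴿ-trans (≈ᴿ-sym (exp-ℕ* (suc j) e*l)) (≈ᴿ-trans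
    (exp-≡ {ιℕ (suc j) *ᴿ e*l} {ιℕ (suc (suc j)) *ᴿ log u 0<u} eq)
    (exp-ℕ*-log (suc (suc j)) u 0<u))
    where
    e*l = (1ᴿ +ᴿ 1/[ j ]) *ᴿ log u 0<u
    J = fromℕ (suc j)
    eq : ∀ n → J * ((1ℚ + recip J) * seq (log u 0<u) n) ≡ fromℕ (suc (suc j)) * seq (log u 0<u) n
    eq n = trans (solve 3 (λ J v l → J :* ((con 1ℚ :+ v) :* l) := (J :* v :+ J) :* l) refl J (recip J) (seq (log u 0<u) n))
      (cong (_* seq (log u 0<u) n) (trans (cong (_+ J) (recip-inverse (fromℕ-pos j))) (sym (fromℕ-suc (suc j)))))

  ^ℚ-pos : ∀ {q} → 0ℚ < q → ∀ n → 0ℚ < q ^ℚ n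
  ^ℚ-pos h zero    = 0<1
  ^ℚ-pos h (suc n) = *-pos h (^ℚ-pos h n)

  abs-^ℚ≡ : ∀ p n → abs (p ^ℚ n) ≡ abs p ^ℚ n
  abs-^ℚ≡ p zero    = refl
  abs-^ℚ≡ p (suc n) = trans (∣p*q∣≡∣p∣*∣q∣ p (p ^ℚ n)) (cong (abs p *_) (abs-^ℚ≡ p n))

  <ᴿ⇒eventually≤ : ∀ {x y} → x <ᴿ y → Eventually (λ n → seq x n ≤ seq y n)
  <ᴿ⇒eventually≤ (separated 0<gap ev) = eventually-map (≤-trans (≤-+ʳ ≤-refl (<⇒≤ 0<gap))) ev

  power-bound : ∀ {C M u} (0<u : 0ᴿ <ᴿ u) j c → Bounded C M → ιℕ c <ᴿ C *ᴿ u ^[ 0<u ] (1ᴿ +ᴿ 1/[ j ]) →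
    Eventually (λ n → fromℕ c ^ℚ suc j ≤ M ^ℚ suc j * (2ℚ * seq u n ^ℚ suc (suc j)))
  power-bound {C} {M} {u} 0<u j c bC c<CG = let
      η₀ , 0<η₀ , lb = lowerBound 0<u
      -- At late indices this tolerance is at most the (j + 2)-nd power of u itself, so replacing
      -- the real power by the integer one costs only the factor 2.
      η = η₀ ^ℚ suc (suc j)
    in eventually-∧ (λ {n} (hC , c≤) (η₀≤u , G≈) → let
           g = seq G n
           U = seq u n ^ℚ suc (suc j)
           0≤M = ≤-trans (abs-nonneg (seq C n)) hC
           0≤U = ^ℚ-nonneg (≤-trans (<⇒≤ 0<η₀) η₀≤u) (suc (suc j))
         in begin
           fromℕ c ^ℚ suc j
             ≤⟨ ^ℚ-mono (fromℕ-nonneg c) (≤-trans c≤ (≤-trans (≤abs (seq C n * g)) (abs-*≤ {seq C n} {g} hC ≤-refl))) (suc j) ⟩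
           (M * abs g) ^ℚ suc j
             ≡⟨ ^ℚ-distrib-* M (abs g) (suc j) ⟩
           M ^ℚ suc j * abs g ^ℚ suc j
             ≡⟨ cong (M ^ℚ suc j *_) (trans (sym (abs-^ℚ≡ g (suc j))) (cong abs (sym (seq-^ᴿ G (suc j) n)))) ⟩
           M ^ℚ suc j * abs (seq (G ^ᴿ suc j) n)
             ≤⟨ *-monoʳ (M ^ℚ suc j) (^ℚ-nonneg 0≤M (suc j)) (begin
                  abs (seq (G ^ᴿ suc j) n)
                    ≡⟨ cong abs (solve 2 (λ a b → a := b :+ (a :- b)) refl (seq (G ^ᴿ suc j) n) (seq (u ^ᴿ suc (suc j)) n)) ⟩
                  abs (seq (u ^ᴿ suc (suc j)) n + (seq (G ^ᴿ suc j) n - seq (u ^ᴿ suc (suc j)) n))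
                    ≤⟨ abs-+≤ {seq (u ^ᴿ suc (suc j)) n}
                         (≤-reflexive (trans (cong abs (seq-^ᴿ u (suc (suc j)) n)) (0≤p⇒∣p∣≡p 0≤U)))
                         (≤-trans G≈ (^ℚ-mono (<⇒≤ 0<η₀) η₀≤u (suc (suc j)))) ⟩
                  U + U
                    ≡⟨ solve 1 (λ U → U :+ U := con 2ℚ :* U) refl U ⟩
                  2ℚ * U ∎) ⟩
           M ^ℚ suc j * (2ℚ * U) ∎)
       (eventually-∧ _,_ bC (<ᴿ⇒eventually≤ c<CG))
       (eventually-∧ _,_ lb (close (power-1+1/ u 0<u j) (^ℚ-pos 0<η₀ (suc (suc j)))))
    where
    open ≤-Reasoning
    G = u ^[ 0<u ] (1ᴿ +ᴿ 1/[ j ])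

  -- The conjecture in integer powers: besides `power-bound`, multiplication by the (j + 2)-nd power
  -- of (log γ)^ω clears the denominator of `H`.
  conjecture-bound : ∀ {C M} j c n → Bounded C M → ιℕ c <ᴿ C *ᴿ H n ^[ H-pos n ] (1ᴿ +ᴿ 1/[ j ]) →
    Eventually (λ i → fromℕ c ^ℚ suc j * (seq (logℕ (γ n) (γ-pos n)) i ^ℚ ω n) ^ℚ suc (suc j) ≤
      M ^ℚ suc j * (2ℚ * fromℕ (γ n) ^ℚ suc (suc j)))
  conjecture-bound {C} {M} j c n bC c< = let η , 0<η , lb = lowerBound (logγ^ω-pos n) in eventually-∧
    (λ {i} (c≤) η≤L → let
        L = seq (logγ^ω n) i
        g = fromℕ (γ n)
        0<L = <-≤-trans 0<η η≤L
        J = suc (suc j)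
      in begin
        fromℕ c ^ℚ suc j * (seq (logℕ (γ n) (γ-pos n)) i ^ℚ ω n) ^ℚ J
          ≡⟨ cong (λ a → fromℕ c ^ℚ suc j * a ^ℚ J) (sym (seq-^ᴿ (logℕ (γ n) (γ-pos n)) (ω n) i)) ⟩
        fromℕ c ^ℚ suc j * L ^ℚ J
          ≤⟨ *-monoˡ (L ^ℚ J) (^ℚ-nonneg (<⇒≤ 0<L) J) c≤ ⟩
        M ^ℚ suc j * (2ℚ * (g * recip L) ^ℚ J) * L ^ℚ J
          ≡⟨ solve 4 (λ m t a l → m :* (t :* a) :* l := m :* (t :* (a :* l))) refl (M ^ℚ suc j) 2ℚ ((g * recip L) ^ℚ J) (L ^ℚ J) ⟩
        M ^ℚ suc j * (2ℚ * ((g * recip L) ^ℚ J * L ^ℚ J))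
          ≡⟨ cong (λ a → M ^ℚ suc j * (2ℚ * a)) (trans (sym (^ℚ-distrib-* (g * recip L) L J)) (cong (_^ℚ J) (*recip-cancel g 0<L))) ⟩
        M ^ℚ suc j * (2ℚ * g ^ℚ J) ∎)
    (power-bound {C} {M} (H-pos n) j c bC c<) lb
    where open ≤-Reasoning

  module _ {x : ℕ} (0<x : 0 ℕ.< x) (2≤x : 2 ℕ.≤ x) where

    private
      ℓ = logℕ x 0<x
      0≤ℓ : Eventually (λ n → 0ℚ ≤ seq ℓ n)
      0≤ℓ = eventually-nonneg (logℕ-pos x 0<x 2≤x)

    -- If log x were at least r log g + 1, then x ≈ exp (log x) would be, up to errors, at least exp
    -- 1 ≥ 2 times P = exp (r log g) ≈ g^r, contrary to x ≤ g^r. The summand 1 thus leaves a gap of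
    -- P ≥ 1, more than the three errors of ¼ together.
    logℕ-≤ : ∀ {g} (0<g : 0 ℕ.< g) → 2 ℕ.≤ g → ∀ r → fromℕ x ≤ fromℕ g ^ℚ r →
      Eventually (λ n → seq ℓ n ≤ fromℕ r * seq (logℕ g 0<g) n + 1ℚ)
    logℕ-≤ {g} 0<g 2≤g r x≤g^r = let b , 0<b , bb = bounded (ιℕ r *ᴿ λ′) in eventually-∧
      (λ {n} (0≤λ , (2≤n , hb)) (hx , (hg , mult)) → [ (λ h → h) , (λ h → ⊥-elim (absurd n b 0<b 0≤λ 2≤n hb hx hg mult h)) ]′
        (≤-total (seq ℓ n) (fromℕ r * seq λ′ n + 1ℚ)))
      (eventually-∧ _,_ (eventually-nonneg (logℕ-pos g 0<g 2≤g)) (eventually-∧ _,_ (eventually-≥ 2) bb))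
      (eventually-∧ _,_ (close (exp-log (ιℕ x) (ιℕ-pos x 0<x)) 0<¼) (eventually-∧ _,_
        (close (exp-ℕ*-log r (ιℕ g) (ιℕ-pos g 0<g)) 0<¼)
        (E-mult (<⇒≤ (+-pos 0<b 0<1)) 0<¼)))
      where
      open ≤-Reasoning
      λ′ = logℕ g 0<g
      0<¼ : 0ℚ < ¼
      0<¼ = *-pos 0<½ 0<½
      absurd : ∀ n b → 0ℚ < b → 0ℚ ≤ seq λ′ n → 2 ℕ.≤ n → abs (fromℕ r * seq λ′ n) ≤ b →
        abs (E n (seq ℓ n) - fromℕ x) ≤ ¼ → abs (E n (fromℕ r * seq λ′ n) - seq (ιℕ g ^ᴿ r) n) ≤ ¼ →
        (∀ p q → abs p ≤ b + 1ℚ → abs q ≤ b + 1ℚ → abs (E n p * E n q - E n (p + q)) ≤ ¼) →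
        fromℕ r * seq λ′ n + 1ℚ ≤ seq ℓ n → ⊥
      absurd n b 0<b 0≤λ 2≤n hb hx hg mult h = <⇒¬≥ 3¼<1 (begin
        1ℚ                            ≤⟨ 1≤E 0≤p (ℕ.≤-trans (ℕ.n≤1+n 1) 2≤n) ⟩
        P                             ≡⟨ solve 1 (λ P → P := P :* con 2ℚ :- P) refl P ⟩
        P * 2ℚ - P                    ≤⟨ +-monoˡ-≤ (- P) (begin
          P * 2ℚ                          ≤⟨ *-monoʳ P (E-nonneg n 0≤p) (1+p≤E 0≤1 2≤n) ⟩
          P * E n 1ℚ                      ≤⟨ ≈⇒≤ (P * E n 1ℚ) (E n (p + 1ℚ)) (mult p 1ℚ (≤-+ʳ hb 0≤1) (≤-trans (≤-+ʳ ≤-refl (<⇒≤ 0<b)) (≤-reflexive (+-comm 1ℚ b)))) ⟩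
          E n (p + 1ℚ) + ¼                ≤⟨ +-monoˡ-≤ ¼ (E-mono (+-nonneg 0≤p 0≤1) h n) ⟩
          E n (seq ℓ n) + ¼               ≤⟨ +-monoˡ-≤ ¼ (≈⇒≤ (E n (seq ℓ n)) (fromℕ x) hx) ⟩
          fromℕ x + ¼ + ¼                 ≤⟨ +-monoˡ-≤ ¼ (+-monoˡ-≤ ¼ (≤-trans x≤g^r (≤-reflexive (sym (seq-^ᴿ (ιℕ g) r n))))) ⟩
          seq (ιℕ g ^ᴿ r) n + ¼ + ¼       ≤⟨ +-monoˡ-≤ ¼ (+-monoˡ-≤ ¼ (≈⇒≥ P (seq (ιℕ g ^ᴿ r) n) hg)) ⟩
          P + ¼ + ¼ + ¼                   ∎) ⟩
        P + ¼ + ¼ + ¼ - P             ≡⟨ solve 1 (λ P → P :+ con ¼ :+ con ¼ :+ con ¼ :- P := con (¼ + ¼ + ¼)) refl P ⟩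
        ¼ + ¼ + ¼                     ∎)
        where
        p = fromℕ r * seq λ′ n
        P = E n p
        0≤p : 0ℚ ≤ p
        0≤p = *-nonneg (fromℕ-nonneg r) 0≤λ
        3¼<1 : ¼ + ¼ + ¼ < 1ℚ
        3¼<1 = 0<-⇒< {¼ + ¼ + ¼} {1ℚ} 0<¼

    private
      exp-ℓ : Eventually (λ n → abs (E n (seq ℓ n) - fromℕ x) ≤ 1ℚ)
      exp-ℓ = close (exp-log (ιℕ x) (ιℕ-pos x 0<x)) 0<1

    logℕ-≥ : ∀ {T M} → (∀ n → E n T ≤ M) → M + 1ℚ < fromℕ x → Eventually (λ n → T ≤ seq ℓ n)
    logℕ-≥ {T} {M} bT hM = eventually-∧ (λ {n} 0≤l hx → [ (λ h → h) , (λ l≤T →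
        ⊥-elim (<⇒¬≥ hM (≤-trans (≈⇒≥ (E n (seq ℓ n)) (fromℕ x) hx) (+-monoˡ-≤ 1ℚ (≤-trans (E-mono 0≤l l≤T n) (bT n)))))) ]′
      (≤-total T (seq ℓ n))) 0≤ℓ exp-ℓ

    -- The single term l^(N+1) / (N+1)! of the exponential series is at most x + 1 ≤ 2x. One factor
    -- l is spent on the constant 2 (N+1)!.
    logℕ-^≤ : ∀ N → Eventually (λ n → 2ℚ * fromℕ (suc N ℕ.!) ≤ seq ℓ n) → Eventually (λ n → seq ℓ n ^ℚ N ≤ fromℕ x)
    logℕ-^≤ N big = eventually-∧ (λ {n} (0≤l , hx) (2f≤l , N<n) → let
        l = seq ℓ n
        f = fromℕ (suc N ℕ.!)
        0<f = fromℕ-pos′ (suc N ℕ.!) {{suc N ℕ.!≢0}}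
        0<2f = *-pos 0<2 0<f
        l^N = l ^ℚ N
      in ≤-trans (*≤⇒≤*recip {l^N} {fromℕ x * (2ℚ * f)} 0<2f (begin
        l^N * (2ℚ * f)                   ≤⟨ *-monoʳ l^N (^ℚ-nonneg 0≤l N) 2f≤l ⟩
        l^N * l                          ≡⟨ *-comm l^N l ⟩
        l ^ℚ suc N                       ≡⟨ *recip-cancel′ 0<f (l ^ℚ suc N) ⟨
        exps l (suc N) * f               ≤⟨ *-monoˡ f (<⇒≤ 0<f) (term≤Σ< (expTerm-nonneg 0≤l) N<n) ⟩
        E n l * f                        ≤⟨ *-monoˡ f (<⇒≤ 0<f) (≤-trans (≈⇒≤ (E n (seq ℓ n)) (fromℕ x) hx) (+-monoʳ-≤ (fromℕ x) 1≤x)) ⟩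
        (fromℕ x + fromℕ x) * f          ≡⟨ solve 2 (λ x f → (x :+ x) :* f := x :* (con 2ℚ :* f)) refl (fromℕ x) f ⟩
        fromℕ x * (2ℚ * f)               ∎))
        (≤-reflexive (trans (*-assoc (fromℕ x) (2ℚ * f) (recip (2ℚ * f)))
          (trans (cong (fromℕ x *_) (recip-inverse 0<2f)) (*-identityʳ (fromℕ x))))))
      (eventually-∧ _,_ 0≤ℓ exp-ℓ) (eventually-∧ _,_ big (eventually-≥ (suc (suc N))))
      where
      open ≤-Reasoning
      1≤x : 1ℚ ≤ fromℕ x
      1≤x = fromℕ-mono {1} 0<x
      *recip-cancel′ : ∀ {s} → 0ℚ < s → ∀ q → q * recip s * s ≡ q
      *recip-cancel′ 0<s q = *recip-cancel q 0<s

-- Polynomial degree by iterated differences, and the polynomials A, B and D.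

module FiniteDifferences where

  open import Data.Bool.Base using (Bool; true; false; not)
  open import Data.Integer as ℤ using (ℤ; +_)
  import Data.Integer.Properties as ℤ
  open import Data.Integer.Solver using (module +-*-Solver)
  open import Data.List.Base using (List; []; _∷_; _++_; map; length)
  open import Data.List.Properties using (map-++; map-∘; map-cong; length-++; length-map)
  open import Data.List.Membership.Propositional using (_∈_)
  open import Data.List.Membership.Propositional.Properties using (∈-++⁺ˡ; ∈-++⁺ʳ; ∈-map⁺)
  open import Data.List.Relation.Unary.All as All using (All; []; _∷_)
  import Data.List.Relation.Unary.All.Properties as All
  open import Data.List.Relation.Unary.Any using (here)
  open import Data.Nat using (ℕ; zero; suc; _+_; _*_; _^_; _≤_; z≤n; s≤s)
  open import Data.Nat.ListAction using (product)
  open import Data.Nat.ListAction.Properties using (product-++)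
  open import Data.Nat.Properties
  import Data.Nat.Solver as ℕ
  open import Data.Product using (∃-syntax; _×_; _,_; proj₂)
  open import Data.Sum as Sum using (_⊎_; inj₁; inj₂)
  open import Function.Base using (_∘_)
  open import Relation.Binary.PropositionalEquality
  open +-*-Solver

  Δ : (ℕ → ℤ) → ℕ → ℤ
  Δ f n = f (suc n) ℤ.- f n

  -- Deg d f: the function f on ℕ is given by a polynomial of degree at most d.
  Deg : ℕ → (ℕ → ℤ) → Set
  Deg zero    f = ∀ n → Δ f n ≡ + 0
  Deg (suc d) f = Deg d (Δ f)

  Deg-cong : ∀ d {f g} → (∀ n → f n ≡ g n) → Deg d f → Deg d g
  Deg-cong zero    eq h n = trans (sym (cong₂ ℤ._-_ (eq (suc n)) (eq n))) (h n)
  Deg-cong (suc d) eq h = Deg-cong d (λ n → cong₂ ℤ._-_ (eq (suc n)) (eq n)) h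

  Deg-zero : ∀ d {f} → (∀ n → f n ≡ + 0) → Deg d f
  Deg-zero zero    eq n = cong₂ ℤ._-_ (eq (suc n)) (eq n)
  Deg-zero (suc d) eq = Deg-zero d (λ n → cong₂ ℤ._-_ (eq (suc n)) (eq n))

  Deg-+ : ∀ d {f g} → Deg d f → Deg d g → Deg d (λ n → f n ℤ.+ g n)
  Deg-+ zero {f} {g} hf hg n = trans
    (solve 4 (λ a b c d → a :+ b :- (c :+ d) := a :- c :+ (b :- d)) refl (f (suc n)) (g (suc n)) (f n) (g n))
    (cong₂ ℤ._+_ (hf n) (hg n))
  Deg-+ (suc d) {f} {g} hf hg = Deg-cong d
    (λ n → solve 4 (λ a b c d → a :- c :+ (b :- d) := a :+ b :- (c :+ d)) refl (f (suc n)) (g (suc n)) (f n) (g n))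
    (Deg-+ d hf hg)

  Deg-neg : ∀ d {f} → Deg d f → Deg d (λ n → ℤ.- f n)
  Deg-neg zero {f} h n = trans (solve 2 (λ a b → :- a :- (:- b) := :- (a :- b)) refl (f (suc n)) (f n)) (cong ℤ.-_ (h n))
  Deg-neg (suc d) {f} h = Deg-cong d
    (λ n → solve 2 (λ a b → :- (a :- b) := :- a :- (:- b)) refl (f (suc n)) (f n)) (Deg-neg d h)

  Deg-shift : ∀ d {f} → Deg d f → Deg d (f ∘ suc)
  Deg-shift zero    h n = h (suc n)
  Deg-shift (suc d) h = Deg-shift d h

  product-rule : ∀ f g n → f (suc n) ℤ.* Δ g n ℤ.+ Δ f n ℤ.* g n ≡ Δ (λ k → f k ℤ.* g k) n
  product-rule f g n = solve 4 (λ a b c d → a :* (b :- d) :+ (a :- c) :* d := a :* b :- c :* d) refl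
    (f (suc n)) (g (suc n)) (f n) (g n)

  Deg-* : ∀ a b {f g} → Deg a f → Deg b g → Deg (a + b) (λ n → f n ℤ.* g n)
  Deg-* zero zero {f} {g} hf hg n = trans (sym (product-rule f g n)) (cong₂ ℤ._+_
    (trans (cong (f (suc n) ℤ.*_) (hg n)) (ℤ.*-zeroʳ (f (suc n))))
    (trans (cong (ℤ._* g n) (hf n)) (ℤ.*-zeroˡ (g n))))
  Deg-* zero (suc b) {f} {g} hf hg = Deg-cong b (product-rule f g) (Deg-+ b
    (Deg-* zero b {f ∘ suc} (Deg-shift 0 {f} hf) hg)
    (Deg-zero b λ n → trans (cong (ℤ._* g n) (hf n)) (ℤ.*-zeroˡ (g n))))
  Deg-* (suc a) zero {f} {g} hf hg = Deg-cong (a + 0) (product-rule f g) (Deg-+ (a + 0)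
    (Deg-zero (a + 0) λ n → trans (cong (f (suc n) ℤ.*_) (hg n)) (ℤ.*-zeroʳ (f (suc n))))
    (Deg-* a zero hf hg))
  Deg-* (suc a) (suc b) {f} {g} hf hg = Deg-cong (a + suc b) (product-rule f g) (Deg-+ (a + suc b)
    (subst (λ d → Deg d (λ n → f (suc n) ℤ.* Δ g n)) (sym (+-suc a b)) (Deg-* (suc a) b {f ∘ suc} (Deg-shift (suc a) {f} hf) hg))
    (Deg-* a (suc b) hf hg))

  -- The leading terms of f(n) g(n+1) and g(n) f(n+1) cancel.
  Deg-cross : ∀ p q {f g} → Deg p f → Deg (suc q) g → Deg (p + q) (λ n → f n ℤ.* g (suc n) ℤ.- g n ℤ.* f (suc n))
  Deg-cross p q {f} {g} hf hg = Deg-cong (p + q)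
    (λ n → solve 4 (λ a b c d → a :* (b :- d) :+ :- ((c :- a) :* d) := a :* b :- d :* c) refl (f n) (g (suc n)) (f (suc n)) (g n))
    (Deg-+ (p + q) (Deg-* p q hf hg) (Deg-neg (p + q) (Δf*g p hf)))
    where
    Δf*g : ∀ p → Deg p f → Deg (p + q) (λ n → Δ f n ℤ.* g n)
    Δf*g zero    hf = Deg-zero q λ n → trans (cong (ℤ._* g n) (hf n)) (ℤ.*-zeroˡ (g n))
    Δf*g (suc p) hf = subst (λ d → Deg d (λ n → Δ f n ℤ.* g n)) (+-suc p q) (Deg-* p (suc q) hf hg)

  Deg-growth : ∀ d {f} → Deg d f → ∃[ K ] (∀ n → ℤ.∣ f n ∣ ≤ K * suc n ^ d)
  Deg-growth zero {f} h = ℤ.∣ f 0 ∣ , λ n → ≤-reflexive (trans (cong ℤ.∣_∣ (constant n)) (sym (*-identityʳ ℤ.∣ f 0 ∣)))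
    where
    constant : ∀ n → f n ≡ f 0
    constant zero    = refl
    constant (suc n) = trans (ℤ.i-j≡0⇒i≡j (f (suc n)) (f n) (h n)) (constant n)
  Deg-growth (suc d) {f} h = let K , hK = Deg-growth d h in ℤ.∣ f 0 ∣ + K , λ n → begin
    ℤ.∣ f n ∣                                        ≤⟨ sum-bound {K} hK n ⟩
    ℤ.∣ f 0 ∣ + n * (K * suc n ^ d)                  ≤⟨ +-monoʳ-≤ ℤ.∣ f 0 ∣ (*-monoˡ-≤ (K * suc n ^ d) (n≤1+n n)) ⟩
    ℤ.∣ f 0 ∣ + suc n * (K * suc n ^ d)              ≤⟨ +-monoˡ-≤ (suc n * (K * suc n ^ d)) (m≤m*n ℤ.∣ f 0 ∣ (suc n ^ suc d) {{m^n≢0 (suc n) (suc d)}}) ⟩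
    ℤ.∣ f 0 ∣ * suc n ^ suc d + suc n * (K * suc n ^ d)
      ≡⟨ N.solve 4 (λ a s K x → a N.:* (s N.:* x) N.:+ s N.:* (K N.:* x) N.:= (a N.:+ K) N.:* (s N.:* x)) refl ℤ.∣ f 0 ∣ (suc n) K (suc n ^ d) ⟩
    (ℤ.∣ f 0 ∣ + K) * suc n ^ suc d                  ∎
    where
    open ≤-Reasoning
    module N = ℕ.+-*-Solver
    sum-bound : ∀ {K} → (∀ n → ℤ.∣ Δ f n ∣ ≤ K * suc n ^ d) → ∀ n → ℤ.∣ f n ∣ ≤ ℤ.∣ f 0 ∣ + n * (K * suc n ^ d)
    sum-bound hK zero    = m≤m+n ℤ.∣ f 0 ∣ 0
    sum-bound {K} hK (suc n) = begin
      ℤ.∣ f (suc n) ∣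
        ≡⟨ cong ℤ.∣_∣ (solve 2 (λ a b → a := b :+ (a :- b)) refl (f (suc n)) (f n)) ⟩
      ℤ.∣ f n ℤ.+ Δ f n ∣
        ≤⟨ ℤ.∣i+j∣≤∣i∣+∣j∣ (f n) (Δ f n) ⟩
      ℤ.∣ f n ∣ + ℤ.∣ Δ f n ∣
        ≤⟨ +-mono-≤ (sum-bound {K} hK n) (hK n) ⟩
      ℤ.∣ f 0 ∣ + n * (K * suc n ^ d) + K * suc n ^ d
        ≡⟨ N.solve 3 (λ a n x → a N.:+ n N.:* x N.:+ x N.:= a N.:+ (N.con 1 N.:+ n) N.:* x) refl ℤ.∣ f 0 ∣ n (K * suc n ^ d) ⟩
      ℤ.∣ f 0 ∣ + suc n * (K * suc n ^ d)
        ≤⟨ +-monoʳ-≤ ℤ.∣ f 0 ∣ (*-monoʳ-≤ (suc n) (*-monoʳ-≤ K (^-monoˡ-≤ d (n≤1+n (suc n))))) ⟩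
      ℤ.∣ f 0 ∣ + suc n * (K * suc (suc n) ^ d) ∎

  -- Each j ≤ i + 1 occurs C(i+1, j) times in evens i or odds i, according to its parity.
  evens odds : ℕ → List ℕ
  evens zero    = 0 ∷ []
  evens (suc i) = evens i ++ map suc (odds i)
  odds  zero    = 1 ∷ []
  odds  (suc i) = odds i ++ map suc (evens i)

  shifted : ℕ → List ℕ → ℕ
  shifted n es = product (map (_+_ n) es)

  shifted-++ : ∀ n es os → shifted n (es ++ os) ≡ shifted n es * shifted n os
  shifted-++ n es os = trans (cong product (map-++ (_+_ n) es os)) (product-++ (map (_+_ n) es) (map (_+_ n) os))

  shifted-suc : ∀ n es → shifted n (map suc es) ≡ shifted (suc n) es
  shifted-suc n es = cong product (trans (sym (map-∘ es)) (map-cong (+-suc n) es))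

  shifted-++-suc : ∀ n es os → shifted n (es ++ map suc os) ≡ shifted n es * shifted (suc n) os
  shifted-++-suc n es os = trans (shifted-++ n es (map suc os)) (cong (shifted n es *_) (shifted-suc n os))

  -- Equal to 2^i - i - 1. The recursion is the degree given by `Deg-cross` for `D i` and `B i`, the
  -- latter of degree `gapDegree i + i + 1`.
  gapDegree : ℕ → ℕ
  gapDegree zero    = 0
  gapDegree (suc i) = gapDegree i + (gapDegree i + i)

  -- Equal to 2^i, written so that its excess i + 1 over `gapDegree i` is visible by computation;
  -- `Deg-cross` and the final count of exponents rely on this.
  degree : ℕ → ℕ
  degree i = suc (gapDegree i + i)

  degree-suc : ∀ i → degree (suc i) ≡ degree i + degree i
  degree-suc i = N.solve 2 (λ e i → N.con 1 N.:+ (e N.:+ (e N.:+ i) N.:+ (N.con 1 N.:+ i))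
      N.:= N.con 1 N.:+ (e N.:+ i) N.:+ (N.con 1 N.:+ (e N.:+ i))) refl (gapDegree i) i
    where module N = ℕ.+-*-Solver

  A B D : ℕ → ℕ → ℤ
  A i n = + shifted n (evens i)
  B i n = + shifted n (odds i)
  D i n = A i n ℤ.- B i n

  A-suc : ∀ i n → A (suc i) n ≡ A i n ℤ.* B i (suc n)
  A-suc i n = trans (cong +_ (shifted-++-suc n (evens i) (odds i))) (ℤ.pos-* (shifted n (evens i)) (shifted (suc n) (odds i)))

  B-suc : ∀ i n → B (suc i) n ≡ B i n ℤ.* A i (suc n)
  B-suc i n = trans (cong +_ (shifted-++-suc n (odds i) (evens i))) (ℤ.pos-* (shifted n (odds i)) (shifted (suc n) (evens i)))

  -- Replacing A by D + B in the next difference A(n) B(n+1) - B(n) A(n+1) cancels the products of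
  -- two values of B. What remains pairs D, already of low degree, with B, and `Deg-cross` increases
  -- the deficit of the degree by one.
  D-suc : ∀ i n → D i n ℤ.* B i (suc n) ℤ.- B i n ℤ.* D i (suc n) ≡ D (suc i) n
  D-suc i n = trans
    (solve 4 (λ a b a′ b′ → (a :- b) :* b′ :- b :* (a′ :- b′) := a :* b′ :- b :* a′) refl (A i n) (B i n) (A i (suc n)) (B i (suc n)))
    (sym (cong₂ ℤ._-_ (A-suc i n) (B-suc i n)))

  linear : ∀ k → Deg 1 (λ n → + ((n + k) * 1))
  linear k = Deg-cong 1 {λ n → + n ℤ.+ + k} (λ n → sym (trans (cong +_ (*-identityʳ (n + k))) (ℤ.pos-+ n k)))
    (λ n → cong₂ ℤ._-_ (difference (suc n)) (difference n))
    where
    difference : ∀ n → Δ (λ n → + n ℤ.+ + k) n ≡ + 1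
    difference n = solve 2 (λ n k → con (+ 1) :+ n :+ k :- (n :+ k) := con (+ 1)) refl (+ n) (+ k)

  A-B-degree : ∀ i → Deg (degree i) (A i) × Deg (degree i) (B i)
  A-B-degree zero = linear 0 , linear 1
  A-B-degree (suc i) = let a , b = A-B-degree i in
      subst (λ d → Deg d (A (suc i))) (sym (degree-suc i)) (Deg-cong (degree i + degree i) (λ n → sym (A-suc i n))
        (Deg-* (degree i) (degree i) {A i} {λ n → B i (suc n)} a (Deg-shift (degree i) {B i} b)))
    , subst (λ d → Deg d (B (suc i))) (sym (degree-suc i)) (Deg-cong (degree i + degree i) (λ n → sym (B-suc i n))
        (Deg-* (degree i) (degree i) {B i} {λ n → A i (suc n)} b (Deg-shift (degree i) {A i} a)))

  D-degree : ∀ i → Deg (gapDegree i) (D i)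
  D-degree zero n = cong₂ ℤ._-_ (gap (suc n)) (gap n)
    where
    gap : ∀ n → D 0 n ≡ ℤ.- + 1
    gap n = trans (cong₂ (λ a b → + a ℤ.- + b) (trans (*-identityʳ (n + 0)) (+-identityʳ n)) (trans (*-identityʳ (n + 1)) (+-comm n 1)))
      (solve 1 (λ n → n :- (con (+ 1) :+ n) := :- con (+ 1)) refl (+ n))
  D-degree (suc i) = Deg-cong (gapDegree (suc i)) (D-suc i)
    (Deg-cross (gapDegree i) (gapDegree i + i) {D i} {B i} (D-degree i) (proj₂ (A-B-degree i)))

  isEven : ℕ → Bool
  isEven zero    = true
  isEven (suc n) = not (isEven n)

  evens-even : ∀ i → All (λ e → isEven e ≡ true) (evens i)
  odds-odd   : ∀ i → All (λ o → isEven o ≡ false) (odds i)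
  evens-even zero    = refl ∷ []
  evens-even (suc i) = All.++⁺ (evens-even i) (All.map⁺ (All.map (cong not) (odds-odd i)))
  odds-odd zero    = refl ∷ []
  odds-odd (suc i) = All.++⁺ (odds-odd i) (All.map⁺ (All.map (cong not) (evens-even i)))

  evens-≤ : ∀ i → All (_≤ suc i) (evens i)
  odds-≤  : ∀ i → All (_≤ suc i) (odds i)
  evens-≤ zero    = z≤n ∷ []
  evens-≤ (suc i) = All.++⁺ (All.map m≤n⇒m≤1+n (evens-≤ i)) (All.map⁺ (All.map s≤s (odds-≤ i)))
  odds-≤ zero    = s≤s z≤n ∷ []
  odds-≤ (suc i) = All.++⁺ (All.map m≤n⇒m≤1+n (odds-≤ i)) (All.map⁺ (All.map s≤s (evens-≤ i)))

  evens∪odds : ∀ i {j} → j ≤ suc i → j ∈ evens i ⊎ j ∈ odds i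
  evens∪odds zero    {zero}        _             = inj₁ (here refl)
  evens∪odds zero    {suc zero}    _             = inj₂ (here refl)
  evens∪odds zero    {suc (suc _)} (s≤s ())
  evens∪odds (suc i) {zero}        _             = Sum.map ∈-++⁺ˡ ∈-++⁺ˡ (evens∪odds i z≤n)
  evens∪odds (suc i) {suc j}       (s≤s j≤1+i)   = Sum.swap (Sum.map
    (λ h → ∈-++⁺ʳ (odds i) (∈-map⁺ suc h)) (λ h → ∈-++⁺ʳ (evens i) (∈-map⁺ suc h)) (evens∪odds i j≤1+i))

  length-evens : ∀ i → length (evens i) ≡ degree i
  length-odds  : ∀ i → length (odds i) ≡ degree i
  length-evens zero    = refl
  length-evens (suc i) = trans (length-++ (evens i)) (trans
    (cong₂ _+_ (length-evens i) (trans (length-map suc (odds i)) (length-odds i))) (sym (degree-suc i)))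
  length-odds zero    = refl
  length-odds (suc i) = trans (length-++ (odds i)) (trans
    (cong₂ _+_ (length-odds i) (trans (length-map suc (evens i)) (length-evens i))) (sym (degree-suc i)))

  shifted≥ : ∀ n es → n ^ length es ≤ shifted n es
  shifted≥ n []       = ≤-refl
  shifted≥ n (e ∷ es) = *-mono-≤ (m≤m+n n e) (shifted≥ n es)

-- Common divisors, radicals and sets of primes.

module NumberTheory where

  open FiniteDifferences
  open import Data.Empty using (⊥; ⊥-elim)
  open import Data.Integer as ℤ using (ℤ; +_)
  import Data.Integer.Properties as ℤ
  open import Data.List.Base using (List; []; _∷_; _++_; map; length; filter; upTo; applyUpTo; concat)
  open import Data.List.Properties using (map-upTo; length-++; length-map; length-upTo)
  open import Data.List.Membership.Propositional using (_∈_)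
  open import Data.List.Membership.Propositional.Properties using
    (∈-++⁺ˡ; ∈-++⁺ʳ; ∈-++⁻; ∈-map⁺; ∈-filter⁺; ∈-filter⁻; ∈-upTo⁺; ∈-upTo⁻; ∈-applyUpTo⁻; ∈-concat⁻′; ∈-∃++)
  open import Data.List.Relation.Binary.Disjoint.Propositional using (Disjoint)
  open import Data.List.Relation.Unary.All as All using (All; []; _∷_)
  import Data.List.Relation.Unary.All.Properties as All
  open import Data.List.Relation.Unary.AllPairs using (_∷_)
  import Data.List.Relation.Unary.AllPairs.Properties as AllPairs
  open import Data.List.Relation.Unary.Any using (here; there)
  open import Data.List.Relation.Unary.Unique.Propositional using (Unique)
  import Data.List.Relation.Unary.Unique.Propositional.Properties as Unique
  open import Data.Nat
    using (ℕ; zero; suc; _+_; _*_; _∸_; _^_; _≤_; _<_; _<?_; z≤n; s≤s; NonZero; >-nonZero; nonTrivial⇒n>1)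
  open import Data.Nat.Coprimality using (Coprime; coprime-/gcd; coprime-divisor; coprime⇒gcd≡1)
  open import Data.Nat.DivMod using (_/_; m/n*n≡m)
  open import Data.Nat.Divisibility
  open import Data.Nat.GCD using (gcd; gcd[m,n]∣m; gcd[m,n]∣n; gcd[m,n]≡0⇒m≡0)
  open import Data.Nat.ListAction using (product; sum)
  open import Data.Nat.ListAction.Properties using (∈⇒∣product)
  open import Data.Nat.Primality using (Prime; prime?; prime⇒nonTrivial; prime⇒irreducible; ¬prime[1]; euclidsLemma)
  open import Data.Nat.Properties
  open import Data.Nat.Solver using (module +-*-Solver)
  open import Data.Product using (∃-syntax; _×_; _,_; proj₁; proj₂)
  open import Data.Sum using (_⊎_; inj₁; inj₂; [_,_]′; swap)
  open import Function.Base using (_∘_; id)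
  open import Relation.Binary.Definitions using (tri<; tri≈; tri>)
  open import Relation.Binary.PropositionalEquality hiding (J)
  open import Relation.Nullary using (yes; no)
  open import Relation.Nullary.Decidable using (_×-dec_)

  infix 4 _∣_≤_
  _∣_≤_ : ℕ → ℕ → ℕ → Set
  a ∣ b ≤ s = ∀ {h} → h ∣ a → h ∣ b → h ≤ s

  gcd-cofactors : ∀ a b → 0 < a → ∃[ u ] ∃[ v ] a ≡ u * gcd a b × b ≡ v * gcd a b × Coprime u v
  gcd-cofactors a b 0<a = a / gcd a b , b / gcd a b , sym (m/n*n≡m (gcd[m,n]∣m a b)) , sym (m/n*n≡m (gcd[m,n]∣n a b)) , coprime-/gcd a b
    where
    instance
      gcd≢0 : NonZero (gcd a b)
      gcd≢0 = >-nonZero (n≢0⇒n>0 λ eq → <⇒≢ 0<a (sym (gcd[m,n]≡0⇒m≡0 eq)))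

  -- Write h = u g with g = gcd h a. The cofactor u is coprime to a / g, hence divides the product
  -- of the remaining entries, while g is a common divisor of a and N. So each entry contributes a
  -- factor of at most s.
  common-divisor-product : ∀ {s N} → 0 < N → ∀ as → All (λ a → a ∣ N ≤ s) as → product as ∣ N ≤ s ^ length as
  common-divisor-product 0<N []       _          h∣1 _ = ∣⇒≤ h∣1
  common-divisor-product {s} {N} 0<N (a ∷ as) (ha ∷ has) {h} h∣p h∣N =
    let 0<h = n≢0⇒n>0 λ {refl → <⇒≢ 0<N (sym (0∣⇒≡0 h∣N))}
        u , v , h≡ , a≡ , cop = gcd-cofactors h a 0<h
        g = gcd h a
        instance g≢0 = >-nonZero (n≢0⇒n>0 λ eq → <⇒≢ 0<h (sym (gcd[m,n]≡0⇒m≡0 eq)))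
        u∣rest : u ∣ product as
        u∣rest = coprime-divisor cop (*-cancelʳ-∣ g (subst₂ _∣_ h≡
          (trans (cong (_* product as) a≡) (trans (*-assoc v g (product as)) (trans (cong (v *_) (*-comm g (product as))) (sym (*-assoc v (product as) g))))) h∣p))
        u∣N : u ∣ N
        u∣N = ∣-trans (divides g (trans h≡ (*-comm u g))) h∣N
    in ≤-trans (≤-reflexive (trans h≡ (*-comm u g)))
         (*-mono-≤ (ha (gcd[m,n]∣n h a) (∣-trans (gcd[m,n]∣m h a) h∣N)) (common-divisor-product 0<N as has u∣rest u∣N))

  ∣-difference : ∀ {n m h i j} → i < j → j ≤ m → h ∣ n + i → h ∣ n + j → h ≤ m
  ∣-difference {n} {m} {h} {i} {j} i<j j≤m hi hj = ≤-trans (∣⇒≤ {{>-nonZero (m<n⇒0<n∸m i<j)}} (∣m+n∣m⇒∣n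
    (subst (h ∣_) (trans (cong (_+_ n) (sym (m+[n∸m]≡n (<⇒≤ i<j)))) (sym (+-assoc n i (j ∸ i)))) hj) hi)) (≤-trans (m∸n≤m j i) j≤m)

  shifts-common-divisor : ∀ {n m i j} → i ≢ j → i ≤ m → j ≤ m → n + i ∣ n + j ≤ m
  shifts-common-divisor {i = i} {j} i≢j i≤m j≤m hi hj with <-cmp i j
  ... | tri< i<j _ _ = ∣-difference i<j j≤m hi hj
  ... | tri≈ _ i≡j _ = ⊥-elim (i≢j i≡j)
  ... | tri> _ _ j<i = ∣-difference j<i i≤m hj hi

  evens≢odds : ∀ i {e o} → e ∈ evens i → o ∈ odds i → e ≢ o
  evens≢odds i e∈ o∈ refl with trans (sym (All.lookup (evens-even i) e∈)) (All.lookup (odds-odd i) o∈)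
  ... | ()

  evens-odds-common-divisor : ∀ i n {e o} → e ∈ evens i → o ∈ odds i → n + e ∣ n + o ≤ suc i
  evens-odds-common-divisor i n e∈ o∈ =
    shifts-common-divisor (evens≢odds i e∈ o∈) (All.lookup (evens-≤ i) e∈) (All.lookup (odds-≤ i) o∈)

  shifted-pos : ∀ n es → 0 < shifted (suc n) es
  shifted-pos n []       = s≤s z≤n
  shifted-pos n (e ∷ es) = *-mono-≤ (s≤s (z≤n {n + e})) (shifted-pos n es)

  gcdBound : ℕ → ℕ
  gcdBound i = (suc i ^ degree i) ^ degree i

  -- A common divisor of two shifts divides the difference of an even and an odd number, which is
  -- nonzero and at most i + 1. `common-divisor-product` is then used twice, once for each of the
  -- two products; the bound does not involve n.
  A-B-common-divisor : ∀ i n → shifted (suc n) (evens i) ∣ shifted (suc n) (odds i) ≤ gcdBound i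
  A-B-common-divisor i n = subst (shifted N (evens i) ∣ shifted N (odds i) ≤_) (cong₂ (λ a b → (suc i ^ a) ^ b) (len (odds i) (length-odds i)) (len (evens i) (length-evens i)))
    (common-divisor-product (shifted-pos n (odds i)) (map (_+_ N) (evens i)) (All.map⁺ (All.tabulate λ {e} e∈ h∣e h∣os →
      common-divisor-product (s≤s z≤n) (map (_+_ N) (odds i)) (All.map⁺ (All.tabulate λ {o} o∈ h∣o h∣e →
        evens-odds-common-divisor i N e∈ o∈ h∣e h∣o)) h∣os h∣e)))
    where
    N = suc n
    len : ∀ es → length es ≡ degree i → length (map (_+_ N) es) ≡ degree i
    len es h = trans (length-map (_+_ N) es) h

  prime∣shifted⇒ : ∀ {p n} → Prime p → ∀ es → p ∣ shifted n es → ∃[ e ] e ∈ es × p ∣ n + e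
  prime∣shifted⇒ pp []       p∣1 = ⊥-elim (¬prime[1] (subst Prime (∣1⇒≡1 p∣1) pp))
  prime∣shifted⇒ {n = n} pp (e ∷ es) p∣  with euclidsLemma (n + e) (shifted n es) pp p∣
  ... | inj₁ p∣a = e , here refl , p∣a
  ... | inj₂ p∣as = let b , b∈ , p∣b = prime∣shifted⇒ pp es p∣as in b , there b∈ , p∣b

  ∣shifted : ∀ n {e es} → e ∈ es → n + e ∣ shifted n es
  ∣shifted n e∈ = ∈⇒∣product (∈-map⁺ (_+_ n) e∈)

  large-prime-∤-both : ∀ i n {p} → Prime p → suc i < p → p ∣ shifted n (evens i) → p ∣ shifted n (odds i) → ⊥
  large-prime-∤-both i n pp i<p pA pB =
    let e , e∈ , p∣e = prime∣shifted⇒ pp (evens i) pA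
        o , o∈ , p∣o = prime∣shifted⇒ pp (odds i) pB
    in <⇒≱ i<p (evens-odds-common-divisor i n e∈ o∈ p∣e p∣o)

  ∈primeDivisors⇒ : ∀ {n p} → p ∈ primeDivisors n → Prime p × p ∣ n
  ∈primeDivisors⇒ {n} p∈ = proj₂ (∈-filter⁻ (λ p → prime? p ×-dec (p ∣? n)) {xs = upTo (suc n)} p∈)

  ∈primeDivisors⇐ : ∀ {n p} → 0 < n → Prime p → p ∣ n → p ∈ primeDivisors n
  ∈primeDivisors⇐ {n} 0<n pp p∣n = ∈-filter⁺ (λ p → prime? p ×-dec (p ∣? n))
    (∈-upTo⁺ (s≤s (∣⇒≤ {{>-nonZero 0<n}} p∣n))) (pp , p∣n)

  primeDivisors-unique : ∀ n → Unique (primeDivisors n)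
  primeDivisors-unique n = Unique.filter⁺ (λ p → prime? p ×-dec (p ∣? n)) (Unique.upTo⁺ (suc n))

  prime∣prime⇒≡ : ∀ {p q} → Prime p → Prime q → p ∣ q → p ≡ q
  prime∣prime⇒≡ pp pq p∣q with prime⇒irreducible pq p∣q
  ... | inj₁ refl = ⊥-elim (¬prime[1] pp)
  ... | inj₂ p≡q  = p≡q

  distinct-primes-product∣ : ∀ {ps} → Unique ps → All Prime ps → ∀ {N} → All (_∣ N) ps → product ps ∣ N
  distinct-primes-product∣ {[]} _ _ _ = 1∣ _
  distinct-primes-product∣ {p ∷ ps} (p∉ ∷ u) (pp ∷ pps) {N} (divides k N≡ ∷ ds) =
    subst (p * product ps ∣_) (trans (*-comm p k) (sym N≡)) (*-monoʳ-∣ p (distinct-primes-product∣ u pps (strip p∉ pps ds)))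
    where
    strip : ∀ {qs} → All (p ≢_) qs → All Prime qs → All (_∣ N) qs → All (_∣ k) qs
    strip [] [] [] = []
    strip (p≢q ∷ ne) (pq ∷ pqs) (q∣N ∷ dvs) with euclidsLemma k p pq (subst (_ ∣_) N≡ q∣N)
    ... | inj₁ q∣k = q∣k ∷ strip ne pqs dvs
    ... | inj₂ q∣p = ⊥-elim (p≢q (sym (prime∣prime⇒≡ pq pp q∣p)))

  -- Multiplicities in n are irrelevant, so N may be far smaller than n. It will be applied to a
  -- product in which each shift occurs only once.
  γ≤ : ∀ {n N} → 0 < N → (∀ {p} → Prime p → p ∣ n → p ∣ N) → γ n ≤ N
  γ≤ {n} 0<N h = ∣⇒≤ {{>-nonZero 0<N}} (distinct-primes-product∣ (primeDivisors-unique n) (primeDivisors-prime n)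
    (All.tabulate λ p∈ → let pp , p∣n = ∈primeDivisors⇒ {n} p∈ in h pp p∣n))

  2^length≤product : ∀ {ps} → All Prime ps → 2 ^ length ps ≤ product ps
  2^length≤product []         = ≤-refl
  2^length≤product (pp ∷ pps) = *-mono-≤ (Data.Nat.nonTrivial⇒n>1 _ {{prime⇒nonTrivial pp}}) (2^length≤product pps)

  2^ω≤γ : ∀ n → 2 ^ ω n ≤ γ n
  2^ω≤γ n = 2^length≤product (primeDivisors-prime n)

  unique-⊆⇒length≤ : ∀ {xs ys : List ℕ} → Unique xs → (∀ {x} → x ∈ xs → x ∈ ys) → length xs ≤ length ys
  unique-⊆⇒length≤ {[]} _ _ = z≤n
  unique-⊆⇒length≤ {x ∷ xs} (x∉ ∷ u) sub with ∈-∃++ (sub (here refl))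
  ... | us , vs , refl = begin
    suc (length xs)                    ≤⟨ s≤s (unique-⊆⇒length≤ u λ z∈ → avoid z∈ (∈-++⁻ us (sub (there z∈)))) ⟩
    suc (length (us ++ vs))            ≡⟨ cong suc (length-++ us) ⟩
    suc (length us + length vs)        ≡⟨ +-suc (length us) (length vs) ⟨
    length us + suc (length vs)        ≡⟨ length-++ us ⟨
    length (us ++ x ∷ vs)              ∎
    where
    open ≤-Reasoning
    avoid : ∀ {z} → z ∈ xs → z ∈ us ⊎ z ∈ x ∷ vs → z ∈ us ++ vs
    avoid z∈ (inj₁ z∈us)         = ∈-++⁺ˡ z∈us
    avoid z∈ (inj₂ (here refl))  = ⊥-elim (All.lookup x∉ z∈ refl)
    avoid z∈ (inj₂ (there z∈vs)) = ∈-++⁺ʳ us z∈vs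

  large : ℕ → List ℕ → List ℕ
  large m = filter (m <?_)

  length≤large : ∀ m {ps} → Unique ps → length ps ≤ suc m + length (large m ps)
  length≤large m {ps} u = begin
    length ps                                 ≤⟨ unique-⊆⇒length≤ {ys = upTo (suc m) ++ large m ps} u split ⟩
    length (upTo (suc m) ++ large m ps)       ≡⟨ trans (length-++ (upTo (suc m))) (cong (_+ length (large m ps)) (length-upTo (suc m))) ⟩
    suc m + length (large m ps)               ∎
    where
    open ≤-Reasoning
    split : ∀ {p} → p ∈ ps → p ∈ upTo (suc m) ++ large m ps
    split {p} p∈ with m <? p
    ... | yes m<p = ∈-++⁺ʳ (upTo (suc m)) (∈-filter⁺ (m <?_) p∈ m<p)
    ... | no  m≮p = ∈-++⁺ˡ (∈-upTo⁺ (s≤s (≮⇒≥ m≮p)))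

  largeDivisors : ℕ → ℕ → ℕ → List ℕ
  largeDivisors m x j = large m (primeDivisors (x + suc j))

  ∈largeDivisors⇒ : ∀ m x j {p} → p ∈ largeDivisors m x j → m < p × Prime p × p ∣ x + suc j
  ∈largeDivisors⇒ m x j p∈ = let p∈′ , m<p = ∈-filter⁻ (m <?_) {xs = primeDivisors (x + suc j)} p∈ in m<p , ∈primeDivisors⇒ {x + suc j} p∈′

  allLarge : ℕ → ℕ → ℕ → List ℕ
  allLarge m x y = concat (applyUpTo (largeDivisors m x) y)

  ∈allLarge⇒ : ∀ m x y {p} → p ∈ allLarge m x y → m < p × Prime p × (∃[ j ] j < y × p ∣ suc x + j)
  ∈allLarge⇒ m x y {p} p∈ with ∈-concat⁻′ (applyUpTo (largeDivisors m x) y) p∈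
  ... | ps , p∈ps , ps∈ with ∈-applyUpTo⁻ (largeDivisors m x) ps∈
  ... | j , j<y , refl = let m<p , pp , p∣ = ∈largeDivisors⇒ m x j p∈ps in m<p , pp , j , j<y , subst (p ∣_) (+-suc x j) p∣

  allLarge-unique : ∀ {m} x {y} → y ≤ m → Unique (allLarge m x y)
  allLarge-unique {m} x {y} y≤m = Unique.concat⁺
    (All.applyUpTo⁺₂ (largeDivisors m x) y (λ j → Unique.filter⁺ (m <?_) (primeDivisors-unique (x + suc j))))
    (AllPairs.applyUpTo⁺₁ (largeDivisors m x) y disjoint)
    where
    disjoint : ∀ {i j} → i < j → j < y → Disjoint (largeDivisors m x i) (largeDivisors m x j)
    disjoint {i} {j} i<j j<y (pi , pj) = let m<p , _ , p∣i = ∈largeDivisors⇒ m x i pi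
                                             _   , _ , p∣j = ∈largeDivisors⇒ m x j pj
      in <⇒≱ m<p (∣-difference {x} (s≤s i<j) (≤-trans j<y y≤m) p∣i p∣j)

  W≤allLarge : ∀ m x y → W x y ≤ y * suc m + length (allLarge m x y)
  W≤allLarge m x y = ≤-trans (≤-reflexive (cong sum (map-upTo (λ j → ω (x + suc j)) y))) (go y id)
    where
    open ≤-Reasoning
    open +-*-Solver
    go : ∀ y f → sum (applyUpTo (λ j → ω (x + suc (f j))) y) ≤ y * suc m + length (concat (applyUpTo (largeDivisors m x ∘ f) y))
    go zero    f = z≤n
    go (suc y) f = begin
      ω (x + suc (f 0)) + sum (applyUpTo (λ j → ω (x + suc (f (suc j)))) y)
        ≤⟨ +-mono-≤ (length≤large m (primeDivisors-unique (x + suc (f 0)))) (go y (f ∘ suc)) ⟩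
      suc m + length l + (y * suc m + length r)
        ≡⟨ solve 4 (λ m l y r → m :+ l :+ (y :* m :+ r) := m :+ y :* m :+ (l :+ r)) refl (suc m) (length l) y (length r) ⟩
      suc y * suc m + (length l + length r)
        ≡⟨ cong (_+_ (suc y * suc m)) (length-++ l) ⟨
      suc y * suc m + length (l ++ r) ∎
      where
      l = largeDivisors m x (f 0)
      r = concat (applyUpTo (largeDivisors m x ∘ f ∘ suc) y)

  ^-distribʳ-* : ∀ k m n → (m * n) ^ k ≡ m ^ k * n ^ k
  ^-distribʳ-* zero    m n = refl
  ^-distribʳ-* (suc k) m n = trans (cong (m * n *_) (^-distribʳ-* k m n)) (*-interchange m n (m ^ k) (n ^ k))
    where
    *-interchange : ∀ a b c d → a * b * (c * d) ≡ a * c * (b * d)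
    *-interchange = solve 4 (λ a b c d → a :* b :* (c :* d) := a :* c :* (b :* d)) refl
      where open +-*-Solver

  *-pos⇒pos : ∀ m {n} → 0 < m * n → 0 < m
  *-pos⇒pos (suc m) _ = s≤s z≤n

  -- Construction of the abc triple.

  -- What is left of P < R and R - P after division by gcd P R. `K` bounds the common divisors, so c
  -- keeps the size of `R`; above the threshold `m` no prime of P or R is lost in the division.
  record ReducedTriple (m K P R : ℕ) : Set where
    field
      a b c    : ℕ
      0<a      : 0 < a
      0<b      : 0 < b
      0<c      : 0 < c
      coprime  : gcd (gcd a b) c ≡ 1
      a+b≡c    : a + b ≡ c
      R≤c*K    : R ≤ c * K
      prime∣⇒  : ∀ {p} → Prime p → p ∣ a * b * c → p ∣ P ⊎ p ∣ R ⊎ p ∣ R ∸ P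
      ∣prime⇐  : ∀ {p} → Prime p → m < p → p ∣ P ⊎ p ∣ R → p ∣ a * b * c

  reduce : ∀ {m K P R} → 0 < P → P < R → P ∣ R ≤ K → (∀ {p} → Prime p → m < p → p ∣ P → p ∣ R → ⊥) → ReducedTriple m K P R
  reduce {m} {K} {P} {R} 0<P P<R hK hm with gcd-cofactors P R 0<P
  ... | a , c , P≡ , R≡ , cop = record
    { a = a ; b = b ; c = c
    ; 0<a = 0<a
    ; 0<b = m<n⇒0<n∸m a<c
    ; 0<c = ≤-<-trans z≤n a<c
    ; coprime = coprime⇒gcd≡1 (λ (d∣ab , d∣c) → cop (∣-trans d∣ab (gcd[m,n]∣m a b) , d∣c))
    ; a+b≡c = m+[n∸m]≡n (<⇒≤ a<c)
    ; R≤c*K = ≤-trans (≤-reflexive R≡) (*-monoʳ-≤ c (hK (gcd[m,n]∣m P R) (gcd[m,n]∣n P R)))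
    ; prime∣⇒ = λ pp p∣ → [ (λ p∣ab → [ (λ p∣a → inj₁ (up {y = a} P≡ p∣a)) , (λ p∣b → inj₂ (inj₂ (up {y = b} R∸P≡ p∣b))) ]′ (euclidsLemma a b pp p∣ab))
                          , (λ p∣c → inj₂ (inj₁ (up {y = c} R≡ p∣c))) ]′ (euclidsLemma (a * b) c pp p∣)
    ; ∣prime⇐ = λ pp m<p → [ (λ p∣P → ∣-trans (down {y = a} pp m<p P≡ p∣P) (∣-trans (m∣m*n {a} b) (m∣m*n c)))
                           , (λ p∣R → ∣-trans (down {y = c} pp m<p R≡ p∣R) (n∣m*n (a * b))) ]′
    }
    where
    g = gcd P R
    b = c ∸ a
    0<a : 0 < a
    0<a = *-pos⇒pos a (subst (0 <_) P≡ 0<P)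
    a<c : a < c
    a<c = *-cancelʳ-< g a c (subst₂ _<_ P≡ R≡ P<R)
    R∸P≡ : R ∸ P ≡ b * g
    R∸P≡ = trans (cong₂ _∸_ R≡ P≡) (sym (*-distribʳ-∸ g c a))
    up : ∀ {p x y} → x ≡ y * g → p ∣ y → p ∣ x
    up {p} x≡ p∣y = subst (p ∣_) (sym x≡) (∣-trans p∣y (m∣m*n g))
    down : ∀ {p x y} → Prime p → m < p → x ≡ y * g → p ∣ x → p ∣ y
    down {p} {x} {y} pp m<p x≡ p∣x with euclidsLemma y g pp (subst (p ∣_) x≡ p∣x)
    ... | inj₁ p∣y = p∣y
    ... | inj₂ p∣g = ⊥-elim (hm pp m<p (∣-trans p∣g (gcd[m,n]∣m P R)) (∣-trans p∣g (gcd[m,n]∣n P R)))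

  shifted≤ : ∀ n {k} es → All (_≤ k) es → shifted n es ≤ (n + k) ^ length es
  shifted≤ n []       []         = ≤-refl
  shifted≤ n (e ∷ es) (e≤k ∷ hs) = *-mono-≤ (+-monoʳ-≤ n e≤k) (shifted≤ n es hs)

  smallPrimeBound : ℕ → ℕ
  smallPrimeBound y = y * suc (suc y)

  record Triple (y K x : ℕ) : Set where
    field
      a b c    : ℕ
      0<a      : 0 < a
      0<b      : 0 < b
      0<c      : 0 < c
      coprime  : gcd (gcd a b) c ≡ 1
      a+b≡c    : a + b ≡ c
      c-large  : x ^ degree y ≤ c * gcdBound y
      γ-small  : γ (a * b * c) ≤ K * x ^ suc (degree y)
      ω-large  : W x y ≤ smallPrimeBound y + ω (a * b * c)

  module _ (y : ℕ) where

    private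
      m = suc y
      d = degree y
      e = gapDegree y
      growth = Deg-growth e (D-degree y)
      K₀ = proj₁ growth

    -- The first factor comes from n + m ≤ x (y + 3), once for each of the y + 2 shifts, the second
    -- from the growth of D at n, where n + 1 ≤ 3x.
    radicalBound : ℕ
    radicalBound = (y + 3) ^ suc m * (K₀ * 3 ^ e)

    module _ {x : ℕ} (1≤x : 1 ≤ x) where
      private
        n = suc x
        -- Each shift n + j with j ≤ y + 1 occurs once, without its binomial multiplicity. So Π has
        -- degree y + 2 only, and yet contains every prime of AB.
        Π = shifted n (upTo (suc m))

        0<Π : 0 < Π
        0<Π = shifted-pos x (upTo (suc m))

        j∈ : ∀ {j} → j < y → j ∈ evens y ⊎ j ∈ odds y
        j∈ j<y = evens∪odds y (≤-trans (<⇒≤ j<y) (n≤1+n y))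

        Π-bound : Π ≤ x ^ suc m * (y + 3) ^ suc m
        Π-bound = begin
          Π                                     ≤⟨ shifted≤ n (upTo (suc m)) (All.tabulate λ j∈ → ≤-pred (∈-upTo⁻ j∈)) ⟩
          (n + m) ^ length (upTo (suc m))       ≡⟨ cong ((n + m) ^_) (length-upTo (suc m)) ⟩
          (n + m) ^ suc m                       ≤⟨ ^-monoˡ-≤ (suc m) n+m≤ ⟩
          (x * (y + 3)) ^ suc m                 ≡⟨ ^-distribʳ-* (suc m) x (y + 3) ⟩
          x ^ suc m * (y + 3) ^ suc m           ∎
          where
          open ≤-Reasoning
          open +-*-Solver
          n+m≤ : n + m ≤ x * (y + 3)
          n+m≤ = begin
            n + m               ≡⟨ solve 2 (λ x y → con 1 :+ x :+ (con 1 :+ y) := x :+ con 1 :* (y :+ con 2)) refl x y ⟩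
            x + 1 * (y + 2)     ≤⟨ +-monoʳ-≤ x (*-monoˡ-≤ (y + 2) 1≤x) ⟩
            x + x * (y + 2)     ≡⟨ solve 2 (λ x y → x :+ x :* (y :+ con 2) := x :* (y :+ con 3)) refl x y ⟩
            x * (y + 3)         ∎

        D-bound : ℤ.∣ D y n ∣ ≤ K₀ * (3 ^ e * x ^ e)
        D-bound = ≤-trans (proj₂ growth n) (*-monoʳ-≤ K₀ (≤-trans (^-monoˡ-≤ e (begin
          suc (suc x)        ≡⟨ solve 1 (λ x → con 2 :+ x := con 2 :* con 1 :+ x) refl x ⟩
          2 * 1 + x          ≤⟨ +-monoˡ-≤ x (*-monoʳ-≤ 2 1≤x) ⟩
          2 * x + x          ≡⟨ solve 1 (λ x → con 2 :* x :+ x := con 3 :* x) refl x ⟩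
          3 * x              ∎)) (≤-reflexive (^-distribʳ-* e 3 x))))
          where
          open ≤-Reasoning
          open +-*-Solver

        -- The exponents add up to (y + 2) + `gapDegree y` = d + 1: the degree gap y + 1 of D pays
        -- for all but one of the shifts.
        bound : Π * ℤ.∣ D y n ∣ ≤ radicalBound * x ^ suc d
        bound = begin
          Π * ℤ.∣ D y n ∣
            ≤⟨ *-mono-≤ Π-bound D-bound ⟩
          x ^ suc m * (y + 3) ^ suc m * (K₀ * (3 ^ e * x ^ e))
            ≡⟨ solve 5 (λ a b k t s → a :* b :* (k :* (t :* s)) := b :* (k :* t) :* (a :* s)) refl (x ^ suc m) ((y + 3) ^ suc m) K₀ (3 ^ e) (x ^ e) ⟩
          radicalBound * (x ^ suc m * x ^ e)
            ≡⟨ cong (radicalBound *_) (trans (sym (^-distribˡ-+-* x (suc m) e)) (cong (λ k → x ^ suc (suc k)) (+-comm y e))) ⟩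
          radicalBound * x ^ suc d ∎
          where
          open ≤-Reasoning
          open +-*-Solver

        module _ {P R : ℕ} (P<R : P < R) (gap : R ∸ P ≡ ℤ.∣ D y n ∣) (n^d≤R : n ^ d ≤ R)
          (covered : ∀ {p j} → j < y → p ∣ n + j → p ∣ P ⊎ p ∣ R)
          (P⇒Π : ∀ {p} → Prime p → p ∣ P → p ∣ Π) (R⇒Π : ∀ {p} → Prime p → p ∣ R → p ∣ Π)
          (T : ReducedTriple m (gcdBound y) P R) where
          open ReducedTriple T

          assemble : Triple y radicalBound x
          assemble = record
            { a = a ; b = b ; c = c ; 0<a = 0<a ; 0<b = 0<b ; 0<c = 0<c ; coprime = coprime ; a+b≡c = a+b≡c
            ; c-large = ≤-trans (^-monoˡ-≤ d (n≤1+n x)) (≤-trans n^d≤R R≤c*K)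
            ; γ-small = ≤-trans (γ≤ (*-mono-≤ 0<Π (m<n⇒0<n∸m P<R)) λ pp p∣ →
                [ (λ p∣P → ∣-trans (P⇒Π pp p∣P) (m∣m*n (R ∸ P)))
                , [ (λ p∣R → ∣-trans (R⇒Π pp p∣R) (m∣m*n (R ∸ P))) , (λ p∣ → ∣-trans p∣ (n∣m*n Π)) ]′ ]′ (prime∣⇒ pp p∣))
                (≤-trans (≤-reflexive (cong (Π *_) gap)) bound)
            ; ω-large = ≤-trans (W≤allLarge m x y) (+-monoʳ-≤ (smallPrimeBound y)
                (unique-⊆⇒length≤ (allLarge-unique x (n≤1+n y)) λ p∈ → let m<p , pp , j , j<y , p∣ = ∈allLarge⇒ m x y p∈
                  in ∈primeDivisors⇐ {a * b * c} (*-mono-≤ (*-mono-≤ 0<a 0<b) 0<c) pp (∣prime⇐ pp m<p (covered j<y p∣))))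
            }

        A⇒Π : ∀ {p} → Prime p → p ∣ shifted n (evens y) → p ∣ Π
        A⇒Π pp p∣ = let e , e∈ , p∣e = prime∣shifted⇒ pp (evens y) p∣ in
          ∣-trans p∣e (∣shifted n (∈-upTo⁺ (s≤s (All.lookup (evens-≤ y) e∈))))

        B⇒Π : ∀ {p} → Prime p → p ∣ shifted n (odds y) → p ∣ Π
        B⇒Π pp p∣ = let e , e∈ , p∣e = prime∣shifted⇒ pp (odds y) p∣ in
          ∣-trans p∣e (∣shifted n (∈-upTo⁺ (s≤s (All.lookup (odds-≤ y) e∈))))

        covered : ∀ {p j} → j < y → p ∣ n + j → p ∣ shifted n (evens y) ⊎ p ∣ shifted n (odds y)
        covered j<y p∣ = [ (λ j∈ → inj₁ (∣-trans p∣ (∣shifted n j∈))) , (λ j∈ → inj₂ (∣-trans p∣ (∣shifted n j∈))) ]′ (j∈ j<y)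

        gap≡ : ∀ {P R} → P < R → R ∸ P ≡ ℤ.∣ + R ℤ.- + P ∣
        gap≡ {P} {R} P<R = sym (cong ℤ.∣_∣ (trans (ℤ.m-n≡m⊖n R P) (ℤ.⊖-≥ (<⇒≤ P<R))))

      -- The larger of the two products serves as R. If they are equal, every prime above y + 1
      -- dividing one of the shifts divides both products, which is excluded; so `W` does not exceed
      -- the allowance for small primes.
      triple : W x y ≤ smallPrimeBound y ⊎ Triple y radicalBound x
      triple with <-cmp (shifted n (evens y)) (shifted n (odds y))
      ... | tri< A<B _ _ = inj₂ (assemble A<B (trans (gap≡ A<B) (ℤ.∣i-j∣≡∣j-i∣ (B y n) (A y n)))
        (subst (λ k → n ^ k ≤ shifted n (odds y)) (length-odds y) (shifted≥ n (odds y)))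
        covered A⇒Π B⇒Π (reduce (shifted-pos x (evens y)) A<B (A-B-common-divisor y x) (large-prime-∤-both y n)))
      ... | tri> _ _ B<A = inj₂ (assemble B<A (gap≡ B<A)
        (subst (λ k → n ^ k ≤ shifted n (evens y)) (length-evens y) (shifted≥ n (evens y)))
        (λ j<y p∣ → swap (covered j<y p∣)) B⇒Π A⇒Π
        (reduce (shifted-pos x (odds y)) B<A (λ h∣B h∣A → A-B-common-divisor y x h∣A h∣B) (λ pp m<p pB pA → large-prime-∤-both y n pp m<p pA pB)))
      ... | tri≈ _ A≡B _ = inj₁ (≤-trans (W≤allLarge m x y) (≤-trans (+-monoʳ-≤ (smallPrimeBound y)
        (unique-⊆⇒length≤ {ys = []} (allLarge-unique x (n≤1+n y)) λ p∈ → let m<p , pp , j , j<y , p∣ = ∈allLarge⇒ m x y p∈ in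
          ⊥-elim ([ (λ pA → large-prime-∤-both y n pp m<p pA (subst (_ ∣_) A≡B pA))
                  , (λ pB → large-prime-∤-both y n pp m<p (subst (_ ∣_) (sym A≡B) pB) pB) ]′ (covered j<y p∣))))
        (≤-reflexive (+-identityʳ (smallPrimeBound y)))))

-- Comparison of exponents.

module Conclusion where

  open Analysis
  open FiniteDifferences using (degree)
  open NumberTheory using (gcdBound; radicalBound; smallPrimeBound; Triple; triple; 2^ω≤γ)
  open import Data.Empty using (⊥)
  open import Data.Nat as ℕ using (ℕ; zero; suc)
  open import Data.Nat.GCD using (gcd)
  import Data.Nat.Properties as ℕ
  import Data.Nat.Solver as ℕ
  open import Data.Product using (∃-syntax; Σ-syntax; _×_; _,_; proj₁; proj₂)
  open import Data.Rational hiding (∣_∣)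
  open import Data.Rational.Properties
  open import Data.Rational.Solver using (module +-*-Solver)
  open import Data.Sum using ([_,_]′)
  open import Relation.Binary.PropositionalEquality hiding (J)
  open +-*-Solver

  fromℕ-^ : ∀ m n → fromℕ (m ℕ.^ n) ≡ fromℕ m ^ℚ n
  fromℕ-^ m zero    = refl
  fromℕ-^ m (suc n) = trans (fromℕ-* m (m ℕ.^ n)) (cong (fromℕ m *_) (fromℕ-^ m n))

  cancelʳ : ∀ {p q} r → 0ℚ < r → p * r ≤ q * r → p ≤ q
  cancelʳ r 0<r = *-cancelʳ-≤-pos r {{positive 0<r}}

  eventually⇒⊥ : ∀ {P : ℕ → Set} → Eventually P → (∀ {n} → P n → ⊥) → ⊥
  eventually⇒⊥ (N , p) f = f (p N ℕ.≤-refl)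

  eventually-const : ∀ {P : Set} → Eventually (λ _ → P) → P
  eventually-const (N , p) = p N ℕ.≤-refl

  -- With ε = 1/j for this j, the two powers of x compared at the end differ by a single factor x.
  module Exponents (k d : ℕ) where
    j₀ j J s : ℕ
    j₀ = k ℕ.* (k ℕ.+ 2) ℕ.* (d ℕ.+ 1) ℕ.+ k
    j = suc j₀
    J = suc j
    s = suc (suc k)

    e₁ : ℕ
    e₁ = d ℕ.+ j ℕ.+ 2

    -- This determines j: as (k + 1)² - k (k + 2) = 1, the equation is linear in j with coefficient
    -- 1. The left side comes from the lower bound for (log x)^(kW), raised to the power J (k + 1);
    -- the right side is the exponent obtained from the conjecture, increased by one.
    exponents : J ℕ.* suc k ℕ.* suc k ≡ suc (suc (k ℕ.* suc (s ℕ.* e₁)))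
    exponents = N.solve 2 (λ k d → let j = N.con 1 N.:+ (k N.:* (k N.:+ N.con 2) N.:* (d N.:+ N.con 1) N.:+ k) in
      (N.con 1 N.:+ j) N.:* (N.con 1 N.:+ k) N.:* (N.con 1 N.:+ k)
      N.:= N.con 1 N.:+ (N.con 1 N.:+ k N.:* (N.con 1 N.:+ (N.con 2 N.:+ k) N.:* (d N.:+ j N.:+ N.con 2)))) refl k d
      where module N = ℕ.+-*-Solver

    -- On the left is the exponent of γ^J ≪ x^(J(d+1)) with one further x for the constants; on the
    -- right, jd is the contribution of c^j, and e₁ is what remains for the powers of log γ.
    cross : suc (J ℕ.* suc d) ≡ j ℕ.* d ℕ.+ e₁
    cross = N.solve 2 (λ j d → N.con 1 N.:+ (N.con 1 N.:+ j) N.:* (N.con 1 N.:+ d) N.:= j N.:* d N.:+ (d N.:+ j N.:+ N.con 2)) refl j d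
      where module N = ℕ.+-*-Solver

  module _ {X : ℚ} (2≤X : 2ℚ ≤ X) where
    private
      1≤2 : 1ℚ ≤ 2ℚ
      1≤2 = fromℕ-mono {1} {2} (ℕ.s≤s ℕ.z≤n)
      1≤X = ≤-trans 1≤2 2≤X
      0<X = <-≤-trans 0<1 1≤X
      0≤X = <⇒≤ 0<X

    ^-suc-≰ : ∀ e → X ^ℚ suc e ≤ X ^ℚ e → ⊥
    ^-suc-≰ e h = <⇒¬≥ 1<2 (≤-trans 2≤X (cancelʳ (X ^ℚ e) (^ℚ-pos 0<X e) (≤-trans h (≤-reflexive (sym (*-identityˡ (X ^ℚ e)))))))
      where
      1<2 : 1ℚ < 2ℚ
      1<2 = 0<-⇒< {1ℚ} {2ℚ} 0<1

    module _ {ℓ : ℚ} (1≤ℓ : 1ℚ ≤ ℓ) (k W : ℕ) (lower : X ^ℚ suc k ≤ ℓ ^ℚ (k ℕ.* W) + ½) where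
      private
        0≤ℓ = ≤-trans 0≤1 1≤ℓ

      lower′ : X ^ℚ suc k ≤ 2ℚ * ℓ ^ℚ (k ℕ.* W)
      lower′ = begin
        X ^ℚ suc k                               ≤⟨ lower ⟩
        ℓ ^ℚ (k ℕ.* W) + ½                       ≤⟨ +-monoʳ-≤ (ℓ ^ℚ (k ℕ.* W)) (≤-trans (<⇒≤ ½<1) (1≤^ℚ 1≤ℓ (k ℕ.* W))) ⟩
        ℓ ^ℚ (k ℕ.* W) + ℓ ^ℚ (k ℕ.* W)          ≡⟨ solve 1 (λ a → a :+ a := con 2ℚ :* a) refl (ℓ ^ℚ (k ℕ.* W)) ⟩
        2ℚ * ℓ ^ℚ (k ℕ.* W)                      ∎
        where open ≤-Reasoning

      -- A bounded W makes (log x)^(kW) at most x, and the lower bound then forces x² ≤ 2x.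
      few-primes-impossible : ∀ {N} → 1 ℕ.≤ k → fromℕ 3 ≤ X → ℓ ^ℚ N ≤ X → k ℕ.* W ℕ.≤ N → ⊥
      few-primes-impossible {N} 1≤k 3≤X ℓ^N≤X kW≤N = <⇒¬≥ 2<3 (≤-trans 3≤X (cancelʳ X 0<X (begin
        X * X                            ≡⟨ cong (X *_) (*-identityʳ X) ⟨
        X ^ℚ 2                           ≤⟨ ^ℚ-monoʳ 1≤X (ℕ.s≤s 1≤k) ⟩
        X ^ℚ suc k                       ≤⟨ lower′ ⟩
        2ℚ * ℓ ^ℚ (k ℕ.* W)              ≤⟨ *-monoʳ 2ℚ 0≤2 (≤-trans (^ℚ-monoʳ 1≤ℓ kW≤N) ℓ^N≤X) ⟩
        2ℚ * X                           ∎)))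
        where
        open ≤-Reasoning
        2<3 : 2ℚ < fromℕ 3
        2<3 = 0<-⇒< {2ℚ} {fromℕ 3} 0<1

      module _ {l c G K₁ K₂ M : ℚ} {ω K₃ N d : ℕ} (1≤d : 1 ℕ.≤ d) (1≤l : 1ℚ ≤ l)
        (0≤c : 0ℚ ≤ c) (0≤G : 0ℚ ≤ G) (0≤K₁ : 0ℚ ≤ K₁) (0≤K₂ : 0ℚ ≤ K₂) (0≤M : 0ℚ ≤ M) where
        open Exponents k d

        κ : ℚ
        κ = K₁ ^ℚ j * (M ^ℚ j * 2ℚ)

        0≤κ : 0ℚ ≤ κ
        0≤κ = *-nonneg (^ℚ-nonneg 0≤K₁ j) (*-nonneg (^ℚ-nonneg 0≤M j) 0≤2)

        module _ (c-large : X ^ℚ d ≤ c * K₁) (abc : c ^ℚ j * (l ^ℚ ω) ^ℚ J ≤ M ^ℚ j * (2ℚ * G ^ℚ J)) where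
          private
            L = (l ^ℚ ω) ^ℚ J
            1≤L : 1ℚ ≤ L
            1≤L = 1≤^ℚ (1≤^ℚ 1≤l ω) J

          power≤ : X ^ℚ (j ℕ.* d) * L ≤ κ * G ^ℚ J
          power≤ = begin
            X ^ℚ (j ℕ.* d) * L             ≡⟨ cong (_* L) (^ℚ-* X j d) ⟩
            (X ^ℚ d) ^ℚ j * L              ≤⟨ *-monoˡ L (≤-trans 0≤1 1≤L) (^ℚ-mono (^ℚ-nonneg 0≤X d) c-large j) ⟩
            (c * K₁) ^ℚ j * L              ≡⟨ cong (_* L) (^ℚ-distrib-* c K₁ j) ⟩
            c ^ℚ j * K₁ ^ℚ j * L           ≡⟨ solve 3 (λ c k l → c :* k :* l := k :* (c :* l)) refl (c ^ℚ j) (K₁ ^ℚ j) L ⟩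
            K₁ ^ℚ j * (c ^ℚ j * L)         ≤⟨ *-monoʳ (K₁ ^ℚ j) (^ℚ-nonneg 0≤K₁ j) abc ⟩
            K₁ ^ℚ j * (M ^ℚ j * (2ℚ * G ^ℚ J))
              ≡⟨ solve 4 (λ k m t g → k :* (m :* (t :* g)) := k :* (m :* t) :* g) refl (K₁ ^ℚ j) (M ^ℚ j) 2ℚ (G ^ℚ J) ⟩
            κ * G ^ℚ J                     ∎
            where open ≤-Reasoning

          -- A crude use of the conjecture, with L replaced by 1 and one factor x spent on κ. It
          -- prepares `logℕ-≤`, which bounds log x by J log γ + 1.
          radical-large : 2 ℕ.≤ j → κ ≤ X → X ≤ G ^ℚ J
          radical-large 2≤j κ≤X = cancelʳ X 0<X (begin
            X * X                          ≡⟨ cong (X *_) (*-identityʳ X) ⟨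
            X ^ℚ 2                         ≤⟨ ^ℚ-monoʳ 1≤X (ℕ.*-mono-≤ 2≤j 1≤d) ⟩
            X ^ℚ (j ℕ.* d)                 ≡⟨ *-identityʳ (X ^ℚ (j ℕ.* d)) ⟨
            X ^ℚ (j ℕ.* d) * 1ℚ            ≤⟨ *-monoʳ (X ^ℚ (j ℕ.* d)) (^ℚ-nonneg 0≤X (j ℕ.* d)) 1≤L ⟩
            X ^ℚ (j ℕ.* d) * L             ≤⟨ power≤ ⟩
            κ * G ^ℚ J                     ≤⟨ *-monoˡ (G ^ℚ J) (^ℚ-nonneg 0≤G J) κ≤X ⟩
            X * G ^ℚ J                     ≡⟨ *-comm X (G ^ℚ J) ⟩
            G ^ℚ J * X                     ∎)
            where open ≤-Reasoning

          module _ (γ-small : G ≤ K₂ * X ^ℚ suc d) (κK₂≤X : κ * K₂ ^ℚ J ≤ X)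
            (ℓ≤ : ℓ ≤ fromℕ J * l + 1ℚ) (ℓ-large : fromℕ (suc J) ^ℚ s ≤ ℓ) (ℓ^N≤X : ℓ ^ℚ N ≤ X)
            (2^≤X : 2ℚ ^ℚ (J ℕ.* suc k) ≤ X) (ω-large : W ℕ.≤ K₃ ℕ.+ ω) (N-large : K₃ ℕ.* (J ℕ.* suc k) ℕ.≤ N) where

            open ≤-Reasoning

            -- The spare x in `cross` absorbs κ K₂^J, and the contribution x^(jd) of c cancels.
            L≤ : L ≤ X ^ℚ e₁
            L≤ = cancelʳ (X ^ℚ (j ℕ.* d)) (^ℚ-pos 0<X (j ℕ.* d)) (begin
              L * X ^ℚ (j ℕ.* d)                      ≡⟨ *-comm L (X ^ℚ (j ℕ.* d)) ⟩
              X ^ℚ (j ℕ.* d) * L                      ≤⟨ power≤ ⟩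
              κ * G ^ℚ J                              ≤⟨ *-monoʳ κ 0≤κ (^ℚ-mono 0≤G γ-small J) ⟩
              κ * (K₂ * X ^ℚ suc d) ^ℚ J              ≡⟨ cong (κ *_) (trans (^ℚ-distrib-* K₂ (X ^ℚ suc d) J) (cong (K₂ ^ℚ J *_) (sym (^ℚ-* X J (suc d))))) ⟩
              κ * (K₂ ^ℚ J * X ^ℚ (J ℕ.* suc d))      ≡⟨ *-assoc κ (K₂ ^ℚ J) (X ^ℚ (J ℕ.* suc d)) ⟨
              κ * K₂ ^ℚ J * X ^ℚ (J ℕ.* suc d)        ≤⟨ *-monoˡ (X ^ℚ (J ℕ.* suc d)) (^ℚ-nonneg 0≤X (J ℕ.* suc d)) κK₂≤X ⟩
              X ^ℚ suc (J ℕ.* suc d)                  ≡⟨ cong (X ^ℚ_) cross ⟩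
              X ^ℚ (j ℕ.* d ℕ.+ e₁)                   ≡⟨ ^ℚ-+ X (j ℕ.* d) e₁ ⟩
              X ^ℚ (j ℕ.* d) * X ^ℚ e₁                ≡⟨ *-comm (X ^ℚ (j ℕ.* d)) (X ^ℚ e₁) ⟩
              X ^ℚ e₁ * X ^ℚ (j ℕ.* d)                ∎)

            -- Passing from log γ to log x costs the constant (J + 1)^s, which one factor ℓ absorbs.
            -- The price is the exponent k + 2 in place of k + 1.
            ℓ^≤l^ : ℓ ^ℚ suc k ≤ l ^ℚ s
            ℓ^≤l^ = cancelʳ ℓ (<-≤-trans 0<1 1≤ℓ) (begin
              ℓ ^ℚ suc k * ℓ                          ≡⟨ *-comm (ℓ ^ℚ suc k) ℓ ⟩
              ℓ ^ℚ s                                  ≤⟨ ^ℚ-mono 0≤ℓ ℓ≤[1+J]l s ⟩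
              (fromℕ (suc J) * l) ^ℚ s                ≡⟨ ^ℚ-distrib-* (fromℕ (suc J)) l s ⟩
              fromℕ (suc J) ^ℚ s * l ^ℚ s             ≤⟨ *-monoˡ (l ^ℚ s) (^ℚ-nonneg (≤-trans 0≤1 1≤l) s) ℓ-large ⟩
              ℓ * l ^ℚ s                              ≡⟨ *-comm ℓ (l ^ℚ s) ⟩
              l ^ℚ s * ℓ                              ∎)
              where
              ℓ≤[1+J]l : ℓ ≤ fromℕ (suc J) * l
              ℓ≤[1+J]l = ≤-trans ℓ≤ (≤-trans (+-monoʳ-≤ (fromℕ J * l) 1≤l) (≤-reflexive (trans
                (solve 2 (λ J l → J :* l :+ l := (con 1ℚ :+ J) :* l) refl (fromℕ J) l) (cong (_* l) (sym (fromℕ-suc J))))))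

            ℓ^ω≤ : ℓ ^ℚ (J ℕ.* ω ℕ.* suc k) ≤ X ^ℚ (s ℕ.* e₁)
            ℓ^ω≤ = begin
              ℓ ^ℚ (J ℕ.* ω ℕ.* suc k)                ≡⟨ ^ℚ-* ℓ (J ℕ.* ω) (suc k) ⟩
              (ℓ ^ℚ suc k) ^ℚ (J ℕ.* ω)               ≤⟨ ^ℚ-mono (^ℚ-nonneg 0≤ℓ (suc k)) ℓ^≤l^ (J ℕ.* ω) ⟩
              (l ^ℚ s) ^ℚ (J ℕ.* ω)                   ≡⟨ ^ℚ-* l (J ℕ.* ω) s ⟨
              l ^ℚ (J ℕ.* ω ℕ.* s)                    ≡⟨ cong (l ^ℚ_) (ℕ.*-comm (J ℕ.* ω) s) ⟩
              l ^ℚ (s ℕ.* (J ℕ.* ω))                  ≡⟨ trans (^ℚ-* l s (J ℕ.* ω)) (cong (_^ℚ s) (^ℚ-* l J ω)) ⟩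
              L ^ℚ s                                  ≤⟨ ^ℚ-mono (≤-trans 0≤1 1≤L) L≤ s ⟩
              (X ^ℚ e₁) ^ℚ s                          ≡⟨ ^ℚ-* X s e₁ ⟨
              X ^ℚ (s ℕ.* e₁)                         ∎

            -- The part of W not accounted for by ω is at most K₃, and `ℓ^N≤X` lets a single factor
            -- x pay for it.
            ℓ^W≤ : ℓ ^ℚ (W ℕ.* (J ℕ.* suc k)) ≤ X ^ℚ suc (s ℕ.* e₁)
            ℓ^W≤ = begin
              ℓ ^ℚ (W ℕ.* (J ℕ.* suc k))              ≤⟨ ^ℚ-monoʳ 1≤ℓ (ℕ.*-monoˡ-≤ (J ℕ.* suc k) ω-large) ⟩
              ℓ ^ℚ ((K₃ ℕ.+ ω) ℕ.* (J ℕ.* suc k))     ≡⟨ cong (ℓ ^ℚ_) (N.solve 4 (λ a w b c → (a N.:+ w) N.:* (b N.:* c) N.:= a N.:* (b N.:* c) N.:+ b N.:* w N.:* c) refl K₃ ω J (suc k)) ⟩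
              ℓ ^ℚ (K₃ ℕ.* (J ℕ.* suc k) ℕ.+ J ℕ.* ω ℕ.* suc k)
                ≡⟨ ^ℚ-+ ℓ (K₃ ℕ.* (J ℕ.* suc k)) (J ℕ.* ω ℕ.* suc k) ⟩
              ℓ ^ℚ (K₃ ℕ.* (J ℕ.* suc k)) * ℓ ^ℚ (J ℕ.* ω ℕ.* suc k)
                ≤⟨ *-mono (^ℚ-nonneg 0≤ℓ (K₃ ℕ.* (J ℕ.* suc k))) (^ℚ-nonneg 0≤ℓ (J ℕ.* ω ℕ.* suc k)) (≤-trans (^ℚ-monoʳ 1≤ℓ N-large) ℓ^N≤X) ℓ^ω≤ ⟩
              X * X ^ℚ (s ℕ.* e₁)                     ∎
              where module N = ℕ.+-*-Solver

            -- Raised to the power J (k + 1), `lower′` becomes an inequality between powers of x,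
            -- one factor x having absorbed the power of 2. By `exponents` the left side still has
            -- one x too many.
            many-primes-impossible : ⊥
            many-primes-impossible = ^-suc-≰ (suc (k ℕ.* suc (s ℕ.* e₁))) (begin
              X ^ℚ suc (suc (k ℕ.* suc (s ℕ.* e₁)))                    ≡⟨ cong (X ^ℚ_) exponents ⟨
              X ^ℚ (J ℕ.* suc k ℕ.* suc k)                             ≡⟨ ^ℚ-* X (J ℕ.* suc k) (suc k) ⟩
              (X ^ℚ suc k) ^ℚ (J ℕ.* suc k)                            ≤⟨ ^ℚ-mono (^ℚ-nonneg 0≤X (suc k)) lower′ (J ℕ.* suc k) ⟩
              (2ℚ * ℓ ^ℚ (k ℕ.* W)) ^ℚ (J ℕ.* suc k)                   ≡⟨ ^ℚ-distrib-* 2ℚ (ℓ ^ℚ (k ℕ.* W)) (J ℕ.* suc k) ⟩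
              2ℚ ^ℚ (J ℕ.* suc k) * (ℓ ^ℚ (k ℕ.* W)) ^ℚ (J ℕ.* suc k)  ≡⟨ cong (2ℚ ^ℚ (J ℕ.* suc k) *_) (trans (sym (^ℚ-* ℓ (J ℕ.* suc k) (k ℕ.* W)))
                                                                             (trans (cong (ℓ ^ℚ_) (N.solve 3 (λ a k w → a N.:* (k N.:* w) N.:= k N.:* (w N.:* a)) refl (J ℕ.* suc k) k W)) (^ℚ-* ℓ k (W ℕ.* (J ℕ.* suc k))))) ⟩
              2ℚ ^ℚ (J ℕ.* suc k) * (ℓ ^ℚ (W ℕ.* (J ℕ.* suc k))) ^ℚ k  ≤⟨ *-mono (^ℚ-nonneg 0≤2 (J ℕ.* suc k)) (^ℚ-nonneg (^ℚ-nonneg 0≤ℓ (W ℕ.* (J ℕ.* suc k))) k) 2^≤X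
                                                                             (^ℚ-mono (^ℚ-nonneg 0≤ℓ (W ℕ.* (J ℕ.* suc k))) ℓ^W≤ k) ⟩
              X * (X ^ℚ suc (s ℕ.* e₁)) ^ℚ k                           ≡⟨ cong (X *_) (^ℚ-* X k (suc (s ℕ.* e₁))) ⟨
              X ^ℚ suc (k ℕ.* suc (s ℕ.* e₁))                          ∎)
              where module N = ℕ.+-*-Solver

  -- Since 1/k ≤ η ≤ δ, multiplication by k log log x leaves integer coefficients, as
  -- `log-comparison` requires.
  log-ratio : ∀ {k W η δ ℓ ll} → 1ℚ ≤ fromℕ k * η → η ≤ δ → 0ℚ ≤ ℓ → 0ℚ < ll →
    (1ℚ + δ) * (ℓ * recip ll) ≤ fromℕ W → fromℕ (suc k) * ℓ ≤ fromℕ (k ℕ.* W) * ll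
  log-ratio {k} {W} {η} {δ} {ℓ} {ll} 1≤kη η≤δ 0≤ℓ 0<ll h = begin
    fromℕ (suc k) * ℓ                              ≡⟨ cong (_* ℓ) (fromℕ-suc k) ⟩
    (1ℚ + K) * ℓ                                   ≤⟨ *-monoˡ ℓ 0≤ℓ (+-monoˡ-≤ K (≤-trans 1≤kη (*-monoʳ K (fromℕ-nonneg k) η≤δ))) ⟩
    (K * δ + K) * ℓ                                ≡⟨ solve 3 (λ K d l → (K :* d :+ K) :* l := K :* ((con 1ℚ :+ d) :* l)) refl K δ ℓ ⟩
    K * ((1ℚ + δ) * ℓ)                             ≡⟨ cong (λ a → K * ((1ℚ + δ) * a)) (*recip-cancel ℓ 0<ll) ⟨
    K * ((1ℚ + δ) * (ℓ * recip ll * ll))           ≡⟨ solve 4 (λ K d a b → K :* (d :* (a :* b)) := K :* (d :* a :* b)) refl K (1ℚ + δ) (ℓ * recip ll) ll ⟩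
    K * ((1ℚ + δ) * (ℓ * recip ll) * ll)           ≤⟨ *-monoʳ K (fromℕ-nonneg k) (*-monoˡ ll (<⇒≤ 0<ll) h) ⟩
    K * (fromℕ W * ll)                             ≡⟨ *-assoc K (fromℕ W) ll ⟨
    K * fromℕ W * ll                               ≡⟨ cong (_* ll) (fromℕ-* k W) ⟨
    fromℕ (k ℕ.* W) * ll                           ∎
    where
    open ≤-Reasoning
    K = fromℕ k

  abstract
    above : ℚ → ℕ
    above q = proj₁ (archimedean q)

    ≤above : ∀ q → q ≤ fromℕ (above q)
    ≤above q = proj₂ (archimedean q)

    1≤above*η : ∀ {η} → 0ℚ < η → 1ℚ ≤ fromℕ (suc (above (recip η))) * η
    1≤above*η {η} 0<η = ≤-trans (≤-reflexive (trans (sym (recip-inverse 0<η)) (*-comm η (recip η))))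
      (*-monoˡ η (<⇒≤ 0<η) (≤-trans (≤above (recip η)) (fromℕ-mono (ℕ.n≤1+n (above (recip η))))))

  BoundedByH : ℝ → ℕ → ℕ → ℕ → Set
  BoundedByH C j c n = ιℕ c <ᴿ C *ᴿ H n ^[ H-pos n ] (1ᴿ +ᴿ 1/[ j ])

  -- Choice of constants and the final contradiction.

  module Assembly (δ : ℝ) (y k₀ : ℕ) {η : ℚ} (1≤kη : 1ℚ ≤ fromℕ (suc k₀) * η) (η≤δ : Eventually (λ n → η ≤ seq δ n))
    (C : ℝ) (abc : ∀ a b c → 0 ℕ.< a → 0 ℕ.< b → 0 ℕ.< c → gcd (gcd a b) c ≡ 1 → a ℕ.+ b ≡ c →
      BoundedByH C (Exponents.j₀ (suc k₀) (degree y)) c (a ℕ.* b ℕ.* c))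
    {M : ℚ} (0≤M : 0ℚ ≤ M) (bC : Bounded C M) where

    k d : ℕ
    k = suc k₀
    d = degree y

    open Exponents k d

    K₁ K₂ : ℚ
    K₁ = fromℕ (gcdBound y)
    K₂ = fromℕ (radicalBound y)

    K₃ N : ℕ
    -- The successor puts ω ≤ 1 into the case of few primes; otherwise γ ≥ 4, and log γ ≥ 1 is
    -- available. In N, the first summand serves the small primes in the main case, the second the
    -- case W ≤ K₃.
    K₃ = suc (smallPrimeBound y)
    N = K₃ ℕ.* (J ℕ.* suc k) ℕ.+ k ℕ.* K₃

    κ₁ κ₂ T Mᵀ : ℚ
    κ₁ = K₁ ^ℚ j * (M ^ℚ j * 2ℚ)
    κ₂ = κ₁ * K₂ ^ℚ J
    -- A threshold for log x: the first summand gives (log x)^N ≤ x by `logℕ-^≤`, the second absorbs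
    -- (J + 1)^s in `ℓ^≤l^`.
    T = 2ℚ * fromℕ (suc N ℕ.!) + fromℕ (suc J) ^ℚ s

    0≤T₁ : 0ℚ ≤ 2ℚ * fromℕ (suc N ℕ.!)
    0≤T₁ = *-nonneg 0≤2 (fromℕ-nonneg (suc N ℕ.!))

    1≤T₂ : 1ℚ ≤ fromℕ (suc J) ^ℚ s
    1≤T₂ = 1≤^ℚ (1≤fromℕ-suc J) s

    0≤T : 0ℚ ≤ T
    0≤T = +-nonneg 0≤T₁ (≤-trans 0≤1 1≤T₂)

    Mᵀ = proj₁ (E-bounded 0≤T)

    E-T≤ : ∀ n → E n T ≤ Mᵀ
    E-T≤ n = ≤-trans (≤abs (E n T)) (proj₂ (proj₂ (E-bounded 0≤T)) (≤-reflexive (0≤p⇒∣p∣≡p 0≤T)) n)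

    x₀ : ℕ
    -- The 3 makes log log x positive. The next three summands let one factor x absorb κ₁, κ₂ and
    -- the power of 2. The last forces log x ≥ T, with 2 rather than 1 because `logℕ-≥` asks for a
    -- strict inequality.
    x₀ = 3 ℕ.+ (above κ₁ ℕ.+ (above κ₂ ℕ.+ (above (2ℚ ^ℚ (J ℕ.* suc k)) ℕ.+ above (Mᵀ + 2ℚ))))

    module _ {x : ℕ} (x₀≤x : x₀ ℕ.≤ x) where

      3≤x : 3 ℕ.≤ x
      3≤x = ℕ.≤-trans (ℕ.m≤m+n 3 _) x₀≤x

      0<x : 0 ℕ.< x
      0<x = 3≤⇒0< x 3≤x

      2≤x : 2 ℕ.≤ x
      2≤x = ℕ.≤-trans (ℕ.n≤1+n 2) 3≤x

      X : ℚ
      X = fromℕ x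

      ≤X : ∀ q → above q ℕ.≤ x → q ≤ X
      ≤X q h = ≤-trans (≤above q) (fromℕ-mono h)

      rest≤x : above κ₁ ℕ.+ (above κ₂ ℕ.+ (above (2ℚ ^ℚ (J ℕ.* suc k)) ℕ.+ above (Mᵀ + 2ℚ))) ℕ.≤ x
      rest≤x = ℕ.m+n≤o⇒n≤o 3 x₀≤x

      κ₁≤X : κ₁ ≤ X
      κ₁≤X = ≤X κ₁ (ℕ.m+n≤o⇒m≤o (above κ₁) rest≤x)

      κ₂≤X : κ₂ ≤ X
      κ₂≤X = ≤X κ₂ (ℕ.m+n≤o⇒m≤o (above κ₂) (ℕ.m+n≤o⇒n≤o (above κ₁) rest≤x))

      rest′≤x : above (2ℚ ^ℚ (J ℕ.* suc k)) ℕ.+ above (Mᵀ + 2ℚ) ℕ.≤ x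
      rest′≤x = ℕ.m+n≤o⇒n≤o (above κ₂) (ℕ.m+n≤o⇒n≤o (above κ₁) rest≤x)

      2^≤X : 2ℚ ^ℚ (J ℕ.* suc k) ≤ X
      2^≤X = ≤X (2ℚ ^ℚ (J ℕ.* suc k)) (ℕ.m+n≤o⇒m≤o (above (2ℚ ^ℚ (J ℕ.* suc k))) rest′≤x)

      Mᵀ+1<X : Mᵀ + 1ℚ < X
      Mᵀ+1<X = <-≤-trans (+-monoʳ-< Mᵀ (0<-⇒< {1ℚ} {2ℚ} 0<1)) (≤X (Mᵀ + 2ℚ) (ℕ.m+n≤o⇒n≤o (above (2ℚ ^ℚ (J ℕ.* suc k))) rest′≤x))

      ℓ : ℝ
      ℓ = logℕ x 0<x

      T≤ℓ : Eventually (λ n → T ≤ seq ℓ n)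
      T≤ℓ = logℕ-≥ 0<x 2≤x E-T≤ Mᵀ+1<X

      ℓ^N≤X : Eventually (λ n → seq ℓ n ^ℚ N ≤ X)
      ℓ^N≤X = logℕ-^≤ 0<x 2≤x N (eventually-map (≤-trans (≤-+ʳ ≤-refl (≤-trans 0≤1 1≤T₂))) T≤ℓ)

      ℓ-large : Eventually (λ n → fromℕ (suc J) ^ℚ s ≤ seq ℓ n)
      ℓ-large = eventually-map (≤-trans (≤-trans (≤-+ʳ ≤-refl 0≤T₁) (≤-reflexive (+-comm (fromℕ (suc J) ^ℚ s) (2ℚ * fromℕ (suc N ℕ.!)))))) T≤ℓ

      0≤ℓ : Eventually (λ n → 0ℚ ≤ seq ℓ n)
      0≤ℓ = eventually-map (≤-trans (≤-trans 0≤1 1≤T₂)) ℓ-large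

      module _ (R<W : (1ᴿ +ᴿ δ) *ᴿ log/loglog x 3≤x <ᴿ ιℕ (W x y)) where

        lower : Eventually (λ n → X ^ℚ suc k ≤ seq ℓ n ^ℚ (k ℕ.* W x y) + ½)
        lower = let ξ , 0<ξ , ξ≤ll = lowerBound (loglog-pos x 3≤x) in
          log-comparison (ιℕ-pos x 0<x) (3≤⇒0<log x 3≤x) (suc k) (k ℕ.* W x y) 0≤ℓ
            (eventually-∧ (λ (η≤ , 0≤l) (ξ≤ , R≤W) → log-ratio {k} {W x y} 1≤kη η≤ 0≤l (<-≤-trans 0<ξ ξ≤) R≤W)
              (eventually-∧ _,_ η≤δ 0≤ℓ) (eventually-∧ _,_ ξ≤ll (<ᴿ⇒eventually≤ R<W)))
            0<½

        facts : Eventually (λ n → (X ^ℚ suc k ≤ seq ℓ n ^ℚ (k ℕ.* W x y) + ½) × (fromℕ (suc J) ^ℚ s ≤ seq ℓ n) × (seq ℓ n ^ℚ N ≤ X))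
        facts = eventually-∧ _,_ lower (eventually-∧ _,_ ℓ-large ℓ^N≤X)

        2≤X : 2ℚ ≤ X
        2≤X = fromℕ-mono 2≤x

        few : W x y ℕ.≤ K₃ → ⊥
        few W≤ = eventually⇒⊥ facts λ {n} (lo , big , pow) →
          few-primes-impossible 2≤X {seq ℓ n} (≤-trans 1≤T₂ big) k (W x y) lo {N} (ℕ.s≤s ℕ.z≤n) (fromℕ-mono 3≤x) pow
            (ℕ.≤-trans (ℕ.*-monoʳ-≤ k W≤) (ℕ.m≤n+m (k ℕ.* K₃) (K₃ ℕ.* (J ℕ.* suc k))))

        module Many (c n : ℕ) (c-large : x ℕ.^ d ℕ.≤ c ℕ.* gcdBound y) (γ-small : γ n ℕ.≤ radicalBound y ℕ.* x ℕ.^ suc d)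
          (ω-large : W x y ℕ.≤ smallPrimeBound y ℕ.+ ω n)
          (c< : BoundedByH C j₀ c n) where

          few-case : ω n ℕ.≤ 1 → ⊥
          few-case ω≤1 = few (ℕ.≤-trans ω-large (ℕ.≤-trans (ℕ.+-monoʳ-≤ (smallPrimeBound y) ω≤1) (ℕ.≤-reflexive (ℕ.+-comm (smallPrimeBound y) 1))))

          module _ (2≤ω : 2 ℕ.≤ ω n) where

            3≤g : 3 ℕ.≤ γ n
            3≤g = ℕ.≤-trans (ℕ.n≤1+n 3) (ℕ.≤-trans (ℕ.^-monoʳ-≤ 2 2≤ω) (2^ω≤γ n))

            2≤g : 2 ℕ.≤ γ n
            2≤g = ℕ.≤-trans (ℕ.n≤1+n 2) 3≤g

            1≤l : Eventually (λ i → 1ℚ ≤ seq (logℕ (γ n) (γ-pos n)) i)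
            1≤l = <ᴿ⇒eventually≤ (logℕ>1 (γ n) (γ-pos n) 3≤g)

            abc-bound : Eventually (λ i → fromℕ c ^ℚ j * (seq (logℕ (γ n) (γ-pos n)) i ^ℚ ω n) ^ℚ J ≤ M ^ℚ j * (2ℚ * fromℕ (γ n) ^ℚ J))
            abc-bound = conjecture-bound {C} {M} j₀ c n bC c<

            c-large′ : X ^ℚ d ≤ fromℕ c * K₁
            c-large′ = subst₂ _≤_ (fromℕ-^ x d) (fromℕ-* c (gcdBound y)) (fromℕ-mono c-large)

            γ-small′ : fromℕ (γ n) ≤ K₂ * X ^ℚ suc d
            γ-small′ = subst (fromℕ (γ n) ≤_) (trans (fromℕ-* (radicalBound y) (x ℕ.^ suc d)) (cong (K₂ *_) (fromℕ-^ x (suc d)))) (fromℕ-mono γ-small)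

            2≤j : 2 ℕ.≤ j
            2≤j = ℕ.s≤s (ℕ.≤-trans (ℕ.s≤s ℕ.z≤n) (ℕ.m≤n+m k (k ℕ.* (k ℕ.+ 2) ℕ.* (d ℕ.+ 1))))

            -- `radical-large` is applied at one late index, but its conclusion does not mention the
            -- index and so holds outright. Only then can `logℕ-≤` be invoked.
            x≤γ^J : X ≤ fromℕ (γ n) ^ℚ J
            x≤γ^J = eventually-const (eventually-∧ (λ {i} (lo , big , _) (1≤ , ab) →
              radical-large 2≤X {seq ℓ i} (≤-trans 1≤T₂ big) k (W x y) lo {seq (logℕ (γ n) (γ-pos n)) i} {fromℕ c} {fromℕ (γ n)} {K₁} {K₂} {M} {ω n} {K₃} {N} {d} (ℕ.s≤s ℕ.z≤n) 1≤ (fromℕ-nonneg c) (fromℕ-nonneg (γ n))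
                (fromℕ-nonneg (gcdBound y)) (fromℕ-nonneg (radicalBound y)) 0≤M c-large′ ab 2≤j κ₁≤X)
              facts (eventually-∧ _,_ 1≤l abc-bound))

            ℓ≤ : Eventually (λ i → seq ℓ i ≤ fromℕ J * seq (logℕ (γ n) (γ-pos n)) i + 1ℚ)
            ℓ≤ = logℕ-≤ 0<x 2≤x (γ-pos n) 2≤g J x≤γ^J

            many-case : ⊥
            many-case = eventually⇒⊥ (eventually-∧ _,_ facts (eventually-∧ _,_ ℓ≤ (eventually-∧ _,_ 1≤l abc-bound)))
              λ {i} ((lo , big , pow) , (le , (1≤ , ab))) →
              many-primes-impossible 2≤X {seq ℓ i} (≤-trans 1≤T₂ big) k (W x y) lo {seq (logℕ (γ n) (γ-pos n)) i} {fromℕ c} {fromℕ (γ n)} {K₁} {K₂} {M} {ω n} {K₃} {N} {d} (ℕ.s≤s ℕ.z≤n) 1≤ (fromℕ-nonneg c) (fromℕ-nonneg (γ n))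
                (fromℕ-nonneg (gcdBound y)) (fromℕ-nonneg (radicalBound y)) 0≤M c-large′ ab γ-small′ κ₂≤X
                le big pow 2^≤X (ℕ.≤-trans ω-large (ℕ.n≤1+n _)) (ℕ.m≤m+n (K₃ ℕ.* (J ℕ.* suc k)) (k ℕ.* K₃))

          impossible : ⊥
          impossible = [ few-case , many-case ]′ (ℕ.≤-<-connex (ω n) 1)

        many : Triple y (radicalBound y) x → ⊥
        many t = Many.impossible c (a ℕ.* b ℕ.* c) c-large γ-small ω-large (abc a b c 0<a 0<b 0<c coprime a+b≡c)
          where open Triple t

        impossible : ⊥
        impossible = [ (λ W≤ → few (ℕ.m≤n⇒m≤1+n W≤)) , many ]′ (triple y (ℕ.≤-trans (ℕ.s≤s ℕ.z≤n) 3≤x))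

  conclusion : Conjecture1 → ∀ δ → 0ᴿ <ᴿ δ → ∀ y → ∃[ x₀ ] (∀ x → x₀ ℕ.≤ x →
    Σ[ 3≤x ∈ 3 ℕ.≤ x ] (ιℕ (W x y) ≤ᴿ (1ᴿ +ᴿ δ) *ᴿ log/loglog x 3≤x))
  conclusion conj δ 0<δ y = x₀ , λ x x₀≤x → 3≤x x₀≤x , impossible x₀≤x
    where
    lower-bound : ∃[ η ] 0ℚ < η × Eventually (λ n → η ≤ seq δ n)
    lower-bound = lowerBound 0<δ
    k₀ : ℕ
    k₀ = above (recip (proj₁ lower-bound))
    ε = 1/[ Exponents.j₀ (suc k₀) (degree y) ]
    abc = conj ε (<ᴿ-intro (recip-pos (fromℕ-pos (Exponents.j₀ (suc k₀) (degree y)))) (0 , λ _ _ → ≤-refl))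
    bound : ∃[ M ] 0ℚ < M × Bounded (proj₁ abc) M
    bound = bounded (proj₁ abc)
    open Assembly δ y k₀ (1≤above*η (proj₁ (proj₂ lower-bound))) (proj₂ (proj₂ lower-bound))
      (proj₁ abc) (proj₂ abc) (<⇒≤ (proj₁ (proj₂ bound))) (proj₂ (proj₂ bound))

open import Data.Nat using (ℕ; _≤_)
open import Data.Product using (∃-syntax; Σ-syntax)

theorem1 : Conjecture1 → ∀ (δ : ℝ) → 0ᴿ <ᴿ δ → ∀ (y : ℕ) → 1 ≤ y →
    ∃[ x₀ ] (∀ (x : ℕ) → x₀ ≤ x →
    Σ[ 3≤x ∈ 3 ≤ x ] (ιℕ (W x y) ≤ᴿ (1ᴿ +ᴿ δ) *ᴿ log/loglog x 3≤x))
theorem1 conj δ 0<δ y _ = Conclusion.conclusion conj δ 0<δ y
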